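{- Let $n\ge 6$ be an integer, and call an $n$-vertex graph extremal for $P^2_6$ if it contains no subgraph isomorphic to $P^2_6$ and has exactly $\mathrm{ex}(n,P^2_6)$ edges. Up to isomorphism, the extremal graphs for $P^2_6$ are exactly the following: if $n\equiv 1\pmod 6$: the graphs $F^{\lceil n/2\rceil,j}_n$ and $H^{\lfloor n/2\rfloor}_n$; if $n\equiv 2\pmod 6$: the graphs $F^{n/2,j}_n$ and $F^{n/2+1,j}_n$; if $n\equiv 3\pmod 6$: the graphs $F^{\lceil n/2\rceil,j}_n$ and $H^{\lceil n/2\rceil+1}_n$; if $n\equiv 0\pmod 6$: $H^{n/2}_n$; if $n\equiv 4\pmod 6$: $H^{n/2+1}_n$; if $n\equiv 5\pmod 6$: $H^{\lceil n/2\rceil}_n$. Here, in each $F^{i,j}_n$, $j$ ranges over all integers with $1\le j\le i$ and $3\mid (i-j)$.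
   Context: All graphs are finite, simple and undirected. $P^2_k$ is the square of the path on $k$ vertices $v_1,\dots,v_k$: $v_i,v_j$ adjacent iff $1\le |i-j|\le 2$. $\mathrm{ex}(n,H)$ is the maximum number of edges in an $n$-vertex graph not containing $H$ as a subgraph. For $1\le i\le n-1$ consider $K_{i,n-i}$ with classes $X$, $|X|=i$, and $Y$, $|Y|=n-i$. For $1\le j\le i$ with $3\mid(i-j)$, $F^{i,j}_n$ is obtained by adding inside $X$ a vertex-disjoint union of $(i-j)/3$ triangles and one star on the remaining $j$ vertices of $X$ (a center joined to the other $j-1$ vertices; for $j=1$ this is a single vertex and nothing is added). For $3\mid i$, $H^i_n$ is obtained by adding inside $X$ a vertex-disjoint union of $i/3$ triangles covering $X$. No edges are added inside $Y$. -}

module Defs where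

open import Data.Bool using (Bool; true; false; _∧_; _∨_; not; if_then_else_)
open import Data.Bool.Properties using (∨-comm)
open import Data.Nat using (ℕ; zero; suc; _+_; _∸_; _≤_; _<ᵇ_; _≡ᵇ_; _/_; _%_)
open import Data.Nat.Divisibility using (_∣_)
open import Data.Fin using (Fin; toℕ; _≟_; _<?_)
open import Data.List using (List; map; allFin)
open import Data.Nat.ListAction using (sum)
open import Data.Product using (Σ; _×_; _,_; ∃-syntax)
open import Data.Sum using (_⊎_)
open import Data.Empty using (⊥)
open import Relation.Nullary using (¬_; yes; no)
open import Relation.Nullary.Decidable using (⌊_⌋)
open import Relation.Binary.PropositionalEquality using (_≡_; refl; sym)
open import Function.Definitions using (Injective)

record Graph (n : ℕ) : Set where
  field
    adj    : Fin n → Fin n → Bool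
    symm   : ∀ a b → adj a b ≡ adj b a
    irrefl : ∀ a → adj a a ≡ false
open Graph public

edgeCount : ∀ {n} → Graph n → ℕ
edgeCount {n} G =
  sum (map (λ a → sum (map (λ b → if ⌊ a <? b ⌋ ∧ adj G a b then 1 else 0)
                           (allFin n)))
           (allFin n))

Contains : ∀ {k n} → Graph k → Graph n → Set
Contains {k} {n} H G =
  Σ (Fin k → Fin n) λ f →
    Injective _≡_ _≡_ f × (∀ a b → adj H a b ≡ true → adj G (f a) (f b) ≡ true)

Extremal : ∀ {k n} → Graph k → Graph n → Set
Extremal {k} {n} H G =
  ¬ Contains H G × (∀ (G' : Graph n) → ¬ Contains H G' → edgeCount G' ≤ edgeCount G)

record _≅_ {n : ℕ} (G G' : Graph n) : Set where
  field
    to      : Fin n → Fin n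
    from    : Fin n → Fin n
    from-to : ∀ a → from (to a) ≡ a
    to-from : ∀ a → to (from a) ≡ a
    pres    : ∀ a b → adj G a b ≡ adj G' (to a) (to b)

symAdj : ∀ {n} → (ℕ → ℕ → Bool) → Fin n → Fin n → Bool
symAdj R a b = not ⌊ a ≟ b ⌋ ∧ (R (toℕ a) (toℕ b) ∨ R (toℕ b) (toℕ a))

private
  neq-sym : ∀ {n} (a b : Fin n) → ⌊ a ≟ b ⌋ ≡ ⌊ b ≟ a ⌋
  neq-sym a b with a ≟ b | b ≟ a
  ... | yes _ | yes _ = refl
  ... | no _  | no _  = refl
  ... | yes p | no q  with q (sym p)
  ... | ()
  neq-sym a b | no p | yes q with p (sym q)
  ... | ()

  symAdj-sym : ∀ {n} R (a b : Fin n) → symAdj R a b ≡ symAdj R b a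
  symAdj-sym R a b rewrite neq-sym a b | ∨-comm (R (toℕ a) (toℕ b)) (R (toℕ b) (toℕ a)) = refl

  symAdj-irr : ∀ {n} R (a : Fin n) → symAdj R a a ≡ false
  symAdj-irr R a with a ≟ a
  ... | yes _ = refl
  ... | no p with p refl
  ... | ()

fromRel : ∀ n → (ℕ → ℕ → Bool) → Graph n
fromRel n R = record { adj = symAdj R ; symm = symAdj-sym R ; irrefl = symAdj-irr R }

P2 : (k : ℕ) → Graph k
P2 k = fromRel k (λ a b → (suc a ≡ᵇ b) ∨ (suc (suc a) ≡ᵇ b))

-- Vertices 0..i-1 form X, vertices i..n-1 form Y.

crossR : ℕ → ℕ → ℕ → Bool
crossR i a b = (a <ᵇ i) ∧ not (b <ᵇ i)

-- F^{i,j}_n: triangles {0,1,2},{3,4,5},... on 0..i-j-1, and a star on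
-- i-j..i-1 with centre i-j.
F : (n i j : ℕ) → Graph n
F n i j = fromRel n (λ a b →
     ((a <ᵇ (i ∸ j)) ∧ (b <ᵇ (i ∸ j)) ∧ ((a / 3) ≡ᵇ (b / 3)))
   ∨ ((a ≡ᵇ (i ∸ j)) ∧ not (b <ᵇ (i ∸ j)) ∧ (b <ᵇ i))
   ∨ crossR i a b)

-- H^i_n: triangles {0,1,2},{3,4,5},... covering 0..i-1.
H : (n i : ℕ) → Graph n
H n i = fromRel n (λ a b →
     ((a <ᵇ i) ∧ (b <ᵇ i) ∧ ((a / 3) ≡ᵇ (b / 3)))
   ∨ crossR i a b)

IsoF : ∀ {n} → ℕ → Graph n → Set
IsoF {n} i G = ∃[ j ] (1 ≤ j × j ≤ i × 3 ∣ (i ∸ j) × G ≅ F n i j)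

-- The list of extremal graphs by residue r = n mod 6.
-- ⌈n/2⌉ = (n+1)/2, ⌊n/2⌋ = n/2.
familyByResidue : (n r : ℕ) → Graph n → Set
familyByResidue n 0 G = G ≅ H n (n / 2)
familyByResidue n 1 G = IsoF ((n + 1) / 2) G ⊎ G ≅ H n (n / 2)
familyByResidue n 2 G = IsoF (n / 2) G ⊎ IsoF (n / 2 + 1) G
familyByResidue n 3 G = IsoF ((n + 1) / 2) G ⊎ G ≅ H n ((n + 1) / 2 + 1)
familyByResidue n 4 G = G ≅ H n (n / 2 + 1)
familyByResidue n 5 G = G ≅ H n ((n + 1) / 2)
familyByResidue n _ G = ⊥

ExtremalFamily : ∀ {n} → Graph n → Set
ExtremalFamily {n} G = familyByResidue n (n % 6) G

{-# OPTIONS --safe #-}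
module Submission where

-- All bounds are proved for vertex sets S of a fixed P²₆-free graph, by induction on |S|.
--
-- If S contains a K₅, every other vertex sends at most one edge to it, so S is far from optimal.
-- If S contains a K₄ but no K₅, then either each triangle of the K₄ has at most two common neighbours,
-- in which case removing the K₄ (or a K₅ minus an edge) leaves too few edges, or some triangle T has
-- three common neighbours; removing T and these three costs 12 + 3 (|S| − 6) edges, exactly the
-- increment of the extremal function.  In the case of equality the common neighbours of T form an
-- independent class completely joined to the rest, and two of them turn any P₄ of the rest into a P²₆.
-- If S is K₄-free, one finds successively an edge, a triangle, a diamond and a wheel W₄ (each time
-- removing the configuration if the next one is missing); removing the rim of the wheel shows
-- e(S) < ⌊(|S|+1)²/4⌋, with e(S) + 1 equal to it only if a vertex is joined to a complete bipartite graph.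
--
-- Hence an extremal graph is an independent class Y joined to a P₄-free class X.  The components of X
-- are triangles and stars, so the graph has |X| (|Y| + 1) − s edges, s being the number of stars.
-- The product |X| (|Y| + 1) with fixed sum n + 1 falls short of ⌊(n+1)²/4⌋ by ⌊δ²/4⌋ where
-- δ = ||X| − |Y| − 1|, and the residue of n mod 6 decides which δ ≤ 2 and s ≤ 1 are possible.

open import Defs
open import Data.Bool using (Bool; true; false; _∧_; _∨_; _xor_; not; if_then_else_)
open import Data.Bool.Properties using (¬-not; ∧-zeroʳ; ∨-comm; ∧-conicalˡ; ∧-conicalʳ) renaming (_≟_ to _≟ᵇ_)
open import Data.Empty using (⊥; ⊥-elim)
open import Data.Fin as Fin using (Fin; zero; suc; toℕ; cast; _≟_; _<?_)
open import Data.Fin.Properties using (toℕ-injective; toℕ-cast; toℕ-fromℕ<; cast-involutive; pigeonhole)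
open import Data.List using (List; []; _∷_; _++_; map; length; lookup; filter; upTo; allFin; tabulate; applyUpTo)
open import Data.List.Membership.Propositional using (_∈_; find; lose)
open import Data.List.Membership.Propositional.Properties using (∈-∃++; ∈-allFin; ∈-++⁺ˡ; ∈-++⁺ʳ; ∈-++⁻; ∈-filter⁺; ∈-filter⁻; ∈-lookup)
open import Data.List.Properties using (map-++; map-∘; map-tabulate; map-upTo; length-++; length-map; length-tabulate; length-upTo; ++-assoc; ++-identityʳ)
open import Data.List.Relation.Binary.Permutation.Propositional using (_↭_; refl; prep; swap; trans; ↭-sym; ↭-trans; ↭-reflexive)
open import Data.List.Relation.Binary.Permutation.Propositional.Properties using (∈-resp-↭; All-resp-↭; shift; ↭-length; map⁺; ++⁺ʳ; ++⁺ˡ; ++-comm)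
open import Data.List.Relation.Unary.All as All using (All; []; _∷_)
open import Data.List.Relation.Unary.AllPairs as AllPairs using (AllPairs; []; _∷_)
open import Data.List.Relation.Unary.AllPairs.Properties using (tabulate⁺-<)
open import Data.List.Relation.Unary.Any using (here; there; any?; index)
open import Data.List.Relation.Unary.Any.Properties using (lookup-index)
open import Data.List.Relation.Unary.Unique.Propositional using (Unique)
open import Data.List.Relation.Unary.Unique.Propositional.Properties using (allFin⁺) renaming (map⁺ to unique-map⁺)
open import Data.Nat using (ℕ; zero; suc; _+_; _*_; _∸_; _/_; _%_; _≤_; _<_; z≤n; s≤s; _≤?_; _≡ᵇ_; _<ᵇ_)
open import Data.Nat.DivMod using (_mod_; n/n≡1; m*n/n≡m; m*n%n≡0; [m+kn]%n≡m%n; m≡m%n+[m/n]*n; m%n<n; +-distrib-/-∣ˡ; +-distrib-/-∣ʳ)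
open import Data.Nat.Divisibility using (_∣_; divides; ∣-refl; _∣0)
open import Data.Nat.ListAction using (sum)
open import Data.Nat.ListAction.Properties using (sum-↭; sum-++)
open import Data.Nat.Properties hiding (_≟_; _<?_)
open import Data.Nat.Tactic.RingSolver using (solve-∀)
open import Data.Product using (_×_; _,_; ∃; ∃₂; proj₁; proj₂)
open import Data.Sum using (_⊎_; inj₁; inj₂)
open import Data.Vec using (Vec; []; _∷_; toList)
open import Function.Bundles using (_⇔_; mk⇔)
open import Relation.Binary.PropositionalEquality as ≡ using (_≡_; _≢_; refl; sym; cong; cong₂; subst; subst₂)
open import Relation.Nullary using (¬_; Dec; yes; no)
open import Relation.Nullary.Decidable using (⌊_⌋; _×-dec_; ¬?; from-yes)

-- The value `turán 5` is 9 although K₅ itself is P²₆-free with 10 edges; 9 is right for K₅-free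
-- sets. Hence the K₅-free bound is proved first and for all sizes, the general bound afterwards and
-- without size five, and a remainder of five vertices is counted by hand. K₄-free sets are compared
-- with ⌊(|S|+1)²/4⌋ instead of `turán`, because its increments on deleting two or four vertices
-- have no dependence on residues modulo 6. It exceeds `turán` by at most one, so the strict
-- inequality for K₄-free sets gives the required bound, and reaching `turán` forces that inequality
-- to be as tight as possible. In a join, every star in X costs one edge and the imbalance δ costs
-- ⌊δ²/4⌋. The final case analysis spends a budget: these losses must add up to `ε n`, which is 0 or
-- 1.

-- q N = ⌊N²/4⌋
q : ℕ → ℕ
q 0 = 0
q 1 = 0
q (suc (suc N)) = q N + suc N

-- turán n is the claimed value of ex(n, P²₆) for n ≠ 5.
turán : ℕ → ℕ
turán 0 = 0
turán 1 = 0
turán 2 = 1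
turán 3 = 3
turán 4 = 6
turán 5 = 9
turán (suc (suc (suc (suc (suc (suc n)))))) = 12 + (3 * n + turán n)

-- The loss forced by divisibility. It is 1 exactly for n ≡ 1, 2, 3 modulo 6, where no most balanced
-- choice of |X| and |Y| + 1 makes |X| a multiple of 3, so that a star or a larger imbalance is
-- unavoidable.
ε : ℕ → ℕ
ε 0 = 0
ε 1 = 1
ε 2 = 1
ε 3 = 1
ε 4 = 0
ε 5 = 0
ε (suc (suc (suc (suc (suc (suc n)))))) = ε n

-- Since `turán` has a recurrence of step six, each inequality below consists of six numerical
-- checks and a step in which both sides split into an explicit linear part and the inductive part.
-- This recombines the two.
rearrange : ∀ {a b c d x y} → a ≡ c + x → d + y ≡ b → c ≤ d → x ≤ y → a ≤ b
rearrange refl refl c≤d x≤y = +-mono-≤ c≤d x≤y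

turán+ε : ∀ n → turán n + ε n ≡ q (suc n)
turán+ε 0 = refl
turán+ε 1 = refl
turán+ε 2 = refl
turán+ε 3 = refl
turán+ε 4 = refl
turán+ε 5 = refl
turán+ε (suc (suc (suc (suc (suc (suc n)))))) =
  ≡.trans (lhs n (turán n) (ε n)) (≡.trans (cong (12 + 3 * n +_) (turán+ε n)) (rhs n (q (suc n))))
  where
  lhs : ∀ n t e → 12 + (3 * n + t) + e ≡ 12 + 3 * n + (t + e)
  lhs = solve-∀
  rhs : ∀ n x → 12 + 3 * n + x ≡ x + (2 + n) + (4 + n) + (6 + n)
  rhs = solve-∀

ε≤1 : ∀ n → ε n ≤ 1
ε≤1 0 = z≤n
ε≤1 1 = s≤s z≤n
ε≤1 2 = s≤s z≤n
ε≤1 3 = s≤s z≤n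
ε≤1 4 = z≤n
ε≤1 5 = z≤n
ε≤1 (suc (suc (suc (suc (suc (suc n)))))) = ε≤1 n

q≤1+turán : ∀ n → q (suc n) ≤ suc (turán n)
q≤1+turán n = begin
  q (suc n)      ≡⟨ sym (turán+ε n) ⟩
  turán n + ε n  ≤⟨ +-monoʳ-≤ (turán n) (ε≤1 n) ⟩
  turán n + 1    ≡⟨ +-comm (turán n) 1 ⟩
  suc (turán n)  ∎
  where open ≤-Reasoning

-- Deleting a K₄ that has at most two edges to each of m other vertices gives the estimate 6 + 2m +
-- `turán m`. It can exceed `turán (4 + m)` by at most one, and this single unit of slack drives the
-- K₄ case.
turán-4 : ∀ m → 2 * m + 5 + turán m ≤ turán (4 + m)
turán-4 0 = from-yes (5 ≤? 6)
turán-4 1 = from-yes (7 ≤? 9)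
turán-4 2 = from-yes (10 ≤? 12)
turán-4 3 = from-yes (14 ≤? 15)
turán-4 4 = from-yes (19 ≤? 19)
turán-4 5 = from-yes (24 ≤? 24)
turán-4 (suc (suc (suc (suc (suc (suc m)))))) =
  rearrange (lhs m (turán m)) (rhs m (turán (4 + m))) (≤-refl {24 + 3 * m}) (turán-4 m)
  where
  lhs : ∀ m t → 2 * (6 + m) + 5 + (12 + (3 * m + t)) ≡ 24 + 3 * m + (2 * m + 5 + t)
  lhs = solve-∀
  rhs : ∀ m t → 24 + 3 * m + t ≡ 12 + (3 * (4 + m) + t)
  rhs = solve-∀

turán-4-linear : ∀ m → 3 * m + 12 ≤ turán (6 + m)
turán-4-linear m = rearrange (lhs m) refl (≤-refl {12}) (m≤m+n (3 * m) (turán m))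
  where
  lhs : ∀ m → 3 * m + 12 ≡ 12 + 3 * m
  lhs = solve-∀

-- Nine edges inside five deleted vertices and at most two to each of the `suc m` others fall one
-- short of `turán (6 + m)`. The form `suc m` excludes an empty remainder, where nine edges equal
-- `turán 5`.
turán-5 : ∀ m → 12 + (2 * m + turán (suc m)) ≤ turán (6 + m)
turán-5 0 = from-yes (12 ≤? 12)
turán-5 1 = from-yes (15 ≤? 15)
turán-5 2 = from-yes (19 ≤? 19)
turán-5 3 = from-yes (24 ≤? 24)
turán-5 4 = from-yes (29 ≤? 30)
turán-5 5 = from-yes (34 ≤? 36)
turán-5 (suc (suc (suc (suc (suc (suc m)))))) =
  rearrange (lhs m (turán (suc m))) (rhs m (turán (6 + m))) bound (turán-5 m)
  where
  lhs : ∀ m t → 12 + (2 * (6 + m) + (12 + (3 * suc m + t))) ≡ 27 + 3 * m + (12 + (2 * m + t))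
  lhs = solve-∀
  rhs : ∀ m t → 30 + 3 * m + t ≡ 12 + (3 * (6 + m) + t)
  rhs = solve-∀
  bound : 27 + 3 * m ≤ 30 + 3 * m
  bound = +-monoˡ-≤ (3 * m) (from-yes (27 ≤? 30))

-- Counting edges over lists of vertices

ι : Bool → ℕ
ι true  = 1
ι false = 0

ι≤1 : ∀ b → ι b ≤ 1
ι≤1 true  = ≤-refl
ι≤1 false = z≤n

module _ {A : Set} where

  sum-map-+ : ∀ (φ ψ : A → ℕ) xs →
    sum (map (λ x → φ x + ψ x) xs) ≡ sum (map φ xs) + sum (map ψ xs)
  sum-map-+ φ ψ []       = refl
  sum-map-+ φ ψ (x ∷ xs) =
    ≡.trans (cong (φ x + ψ x +_) (sum-map-+ φ ψ xs)) (interchange (φ x) (ψ x) _ _)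
    where
    interchange : ∀ a b c d → a + b + (c + d) ≡ a + c + (b + d)
    interchange = solve-∀

  sum-map-≤ : ∀ (φ : A → ℕ) k xs → (∀ {x} → x ∈ xs → φ x ≤ k) →
    sum (map φ xs) ≤ k * length xs
  sum-map-≤ φ k []       bound = z≤n
  sum-map-≤ φ k (x ∷ xs) bound = ≤-trans
    (+-mono-≤ (bound (here refl)) (sum-map-≤ φ k xs (λ m → bound (there m))))
    (≤-reflexive (sym (*-suc k (length xs))))

  sum-map-tight : ∀ (φ : A → ℕ) k xs → (∀ {x} → x ∈ xs → φ x ≤ k) →
    k * length xs ≤ sum (map φ xs) → ∀ {x} → x ∈ xs → k ≤ φ x
  sum-map-tight φ k (x ∷ xs) bound tight (here refl) =
    +-cancelʳ-≤ (k * length xs) k (φ x) (begin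
      k + k * length xs        ≡⟨ sym (*-suc k (length xs)) ⟩
      k * suc (length xs)      ≤⟨ tight ⟩
      φ x + sum (map φ xs)     ≤⟨ +-monoʳ-≤ (φ x) (sum-map-≤ φ k xs (λ m → bound (there m))) ⟩
      φ x + k * length xs      ∎)
    where open ≤-Reasoning
  sum-map-tight φ k (x ∷ xs) bound tight (there m) =
    sum-map-tight φ k xs (λ m → bound (there m)) (+-cancelˡ-≤ k _ _ (begin
      k + k * length xs        ≡⟨ sym (*-suc k (length xs)) ⟩
      k * suc (length xs)      ≤⟨ tight ⟩
      φ x + sum (map φ xs)     ≤⟨ +-monoˡ-≤ _ (bound (here refl)) ⟩
      k + sum (map φ xs)       ∎)) m
    where open ≤-Reasoning

  sum-map-cong : ∀ (φ ψ : A → ℕ) xs → (∀ {x} → x ∈ xs → φ x ≡ ψ x) →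
    sum (map φ xs) ≡ sum (map ψ xs)
  sum-map-cong φ ψ []       eq = refl
  sum-map-cong φ ψ (x ∷ xs) eq =
    cong₂ _+_ (eq (here refl)) (sum-map-cong φ ψ xs (λ m → eq (there m)))

  sum-map-const : ∀ (φ : A → ℕ) k xs → (∀ {x} → x ∈ xs → φ x ≡ k) →
    sum (map φ xs) ≡ k * length xs
  sum-map-const φ k []       eq = sym (*-zeroʳ k)
  sum-map-const φ k (x ∷ xs) eq = ≡.trans
    (cong₂ _+_ (eq (here refl)) (sum-map-const φ k xs (λ m → eq (there m))))
    (sym (*-suc k (length xs)))

  unique-head : ∀ {x : A} {xs} → Unique (x ∷ xs) → ∀ {y} → y ∈ xs → x ≢ y
  unique-head (x∉ ∷ _) = All.lookup x∉

  unique-tail : ∀ {x : A} {xs} → Unique (x ∷ xs) → Unique xs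
  unique-tail (_ ∷ u) = u

  AllPairs-↭ : ∀ {R : A → A → Set} → (∀ {x y} → R x y → R y x) →
    ∀ {xs ys} → xs ↭ ys → AllPairs R xs → AllPairs R ys
  AllPairs-↭ s refl        ps                   = ps
  AllPairs-↭ s (prep x p)  (a ∷ ps)             = All-resp-↭ p a ∷ AllPairs-↭ s p ps
  AllPairs-↭ s (swap x y p) ((r ∷ a) ∷ b ∷ ps)  =
    (s r ∷ All-resp-↭ p b) ∷ All-resp-↭ p a ∷ AllPairs-↭ s p ps
  AllPairs-↭ s (trans p q) ps                   = AllPairs-↭ s q (AllPairs-↭ s p ps)

  unique-↭ : ∀ {xs ys : List A} → xs ↭ ys → Unique xs → Unique ys
  unique-↭ = AllPairs-↭ (λ x≢y y≡x → x≢y (sym y≡x))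

  unique-++ʳ : ∀ (K : List A) {R} → Unique (K ++ R) → Unique R
  unique-++ʳ []      u       = u
  unique-++ʳ (x ∷ K) (_ ∷ u) = unique-++ʳ K u

  unique-++ˡ : ∀ (K : List A) {R} → Unique (K ++ R) → Unique K
  unique-++ˡ []      u       = []
  unique-++ˡ (x ∷ K) (a ∷ u) =
    All.tabulate (λ m → All.lookup a (∈-++⁺ˡ m)) ∷ unique-++ˡ K u

  unique-++-≢ : ∀ (K : List A) {R} → Unique (K ++ R) → ∀ {x y} → x ∈ K → y ∈ R → x ≢ y
  unique-++-≢ (x ∷ K) (a ∷ u) (here refl) y∈ = All.lookup a (∈-++⁺ʳ K y∈)
  unique-++-≢ (x ∷ K) (a ∷ u) (there x∈)  y∈ = unique-++-≢ K u x∈ y∈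

  extract₁ : ∀ {x : A} {S} → x ∈ S → ∃ λ R → S ↭ x ∷ R
  extract₁ x∈S with ∈-∃++ x∈S
  ... | as , bs , refl = as ++ bs , shift _ as bs

  extract : ∀ {K S : List A} → Unique K → All (_∈ S) K → ∃ λ R → S ↭ K ++ R
  extract {[]}    {S} _        _          = S , refl
  extract {x ∷ K} {S} (a ∷ u) (x∈S ∷ K⊆S) with extract₁ x∈S
  ... | S′ , S↭ with extract u (All.tabulate K⊆S′)
    where
    K⊆S′ : ∀ {y} → y ∈ K → y ∈ S′
    K⊆S′ y∈K with ∈-resp-↭ S↭ (All.lookup K⊆S y∈K)
    ... | here refl = ⊥-elim (All.lookup a y∈K refl)
    ... | there m   = m
  ... | R , S′↭ = R , ↭-trans S↭ (prep x S′↭)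

  ∈-suffix : ∀ {S : List A} K {R} → S ↭ K ++ R → ∀ {x} → x ∈ R → x ∈ S
  ∈-suffix K S↭ x∈R = ∈-resp-↭ (↭-sym S↭) (∈-++⁺ʳ K x∈R)

  ∈-prefix : ∀ {S : List A} K {R} → S ↭ K ++ R → ∀ {x} → x ∈ K → x ∈ S
  ∈-prefix K S↭ x∈K = ∈-resp-↭ (↭-sym S↭) (∈-++⁺ˡ x∈K)

module Counting {A : Set} (adj : A → A → Bool) where

  deg : A → List A → ℕ
  deg x ys = sum (map (λ y → ι (adj x y)) ys)

  -- List order replaces the guard a < b: each pair is counted once, and symmetry of `adj` is needed
  -- only to reorder the list.
  e : List A → ℕ
  e []       = 0
  e (x ∷ xs) = deg x xs + e xs

  cross : List A → List A → ℕ
  cross K R = sum (map (λ w → deg w K) R)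

  deg-↭ : ∀ x {ys zs} → ys ↭ zs → deg x ys ≡ deg x zs
  deg-↭ x p = sum-↭ (map⁺ _ p)

  deg-++ : ∀ x ys zs → deg x (ys ++ zs) ≡ deg x ys + deg x zs
  deg-++ x ys zs = ≡.trans (cong sum (map-++ _ ys zs)) (sum-++ (map _ ys) _)

  deg≤length : ∀ x ys → deg x ys ≤ length ys
  deg≤length x ys = ≤-trans (sum-map-≤ _ 1 ys (λ {y} _ → ι≤1 (adj x y))) (≤-reflexive (*-identityˡ _))

  tri : ℕ → ℕ
  tri zero    = 0
  tri (suc m) = m + tri m

  e≤tri : ∀ xs → e xs ≤ tri (length xs)
  e≤tri []       = z≤n
  e≤tri (x ∷ xs) = +-mono-≤ (deg≤length x xs) (e≤tri xs)

  edgeless : ∀ xs → (∀ {x y} → x ∈ xs → y ∈ xs → adj x y ≡ false) → e xs ≡ 0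
  edgeless []       none = refl
  edgeless (x ∷ xs) none = cong₂ _+_
    (sum-map-const _ 0 xs (λ m → cong ι (none (here refl) (there m))))
    (edgeless xs (λ m m′ → none (there m) (there m′)))

  -- Moving k neighbours to the front lets later proofs name them by pattern matching instead of
  -- handling positions in K.
  neighbours-first : ∀ x k K → k ≤ deg x K →
    ∃₂ λ as R → length as ≡ k × All (λ a → adj x a ≡ true) as × K ↭ as ++ R
  neighbours-first x zero    K       _ = [] , K , refl , [] , refl
  neighbours-first x (suc k) (y ∷ K) k<deg with adj x y in eq
  ... | true  = let as , R , len , all , p = neighbours-first x k K (≤-pred k<deg)
                in y ∷ as , R , cong suc len , eq ∷ all , prep y p
  ... | false = let as , R , len , all , p = neighbours-first x (suc k) K k<deg
                in as , y ∷ R , len , all , ↭-trans (prep y p) (↭-sym (shift y as R))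

  module Symmetric (adj-sym : ∀ x y → adj x y ≡ adj y x) where

    e-↭ : ∀ {xs ys} → xs ↭ ys → e xs ≡ e ys
    e-↭ refl       = refl
    e-↭ (prep x p) = cong₂ _+_ (deg-↭ x p) (e-↭ p)
    e-↭ (swap {xs} {ys} x y p)
      rewrite adj-sym x y | deg-↭ x p | deg-↭ y p | e-↭ p =
      rotate (ι (adj y x)) (deg x ys) (deg y ys) (e ys)
      where
      rotate : ∀ i a b c → i + a + (b + c) ≡ i + b + (a + c)
      rotate = solve-∀
    e-↭ (trans p q) = ≡.trans (e-↭ p) (e-↭ q)

    cross-∷ : ∀ x K R → cross (x ∷ K) R ≡ deg x R + cross K R
    cross-∷ x K R = ≡.trans (sum-map-+ (λ w → ι (adj w x)) (λ w → deg w K) R)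
      (cong (_+ cross K R) (sum-map-cong _ _ R (λ {w} _ → cong ι (adj-sym w x))))

    e-++ : ∀ K R → e (K ++ R) ≡ e K + (cross K R + e R)
    e-++ []      R = cong (_+ e R) (sym (sum-map-const _ 0 R (λ _ → refl)))
    e-++ (x ∷ K) R = begin
      deg x (K ++ R) + e (K ++ R)
        ≡⟨ cong₂ _+_ (deg-++ x K R) (e-++ K R) ⟩
      deg x K + deg x R + (e K + (cross K R + e R))
        ≡⟨ regroup (deg x K) (deg x R) (e K) (cross K R) (e R) ⟩
      deg x K + e K + (deg x R + cross K R + e R)
        ≡⟨ cong (λ c → deg x K + e K + (c + e R)) (sym (cross-∷ x K R)) ⟩
      deg x K + e K + (cross (x ∷ K) R + e R) ∎
      where
      open ≡.≡-Reasoning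
      regroup : ∀ a b c d f → a + b + (c + (d + f)) ≡ a + c + (b + d + f)
      regroup = solve-∀

    e-split : ∀ {S} K R → S ↭ K ++ R → e S ≡ e K + (cross K R + e R)
    e-split K R p = ≡.trans (e-↭ p) (e-++ K R)

not-both : ∀ {b} → b ≡ true → b ≡ false → ⊥
not-both refl ()

as-vec : ∀ {A : Set} (xs : List A) {m} → length xs ≡ m → ∃ λ (v : Vec A m) → toList v ≡ xs
as-vec []       refl = [] , refl
as-vec (x ∷ xs) refl = let v , eq = as-vec xs refl in x ∷ v , cong (x ∷_) eq

lookup-injective : ∀ {A : Set} {xs : List A} → Unique xs → ∀ i j → lookup xs i ≡ lookup xs j → i ≡ j
lookup-injective (a ∷ u) zero    zero    eq = refl
lookup-injective (a ∷ u) zero    (suc j) eq = ⊥-elim (All.lookup a (∈-lookup j) eq)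
lookup-injective (a ∷ u) (suc i) zero    eq = ⊥-elim (All.lookup a (∈-lookup i) (sym eq))
lookup-injective (a ∷ u) (suc i) (suc j) eq = cong suc (lookup-injective u i j eq)

two-of-four : ∀ p q r s → 2 ≤ ι p + (ι q + (ι r + (ι s + 0))) →
  (p ≡ true × q ≡ true) ⊎ (p ≡ true × r ≡ true) ⊎ (p ≡ true × s ≡ true) ⊎
  (q ≡ true × r ≡ true) ⊎ (q ≡ true × s ≡ true) ⊎ (r ≡ true × s ≡ true)
two-of-four true  true  _     _     _ = inj₁ (refl , refl)
two-of-four true  false true  _     _ = inj₂ (inj₁ (refl , refl))
two-of-four true  false false true  _ = inj₂ (inj₂ (inj₁ (refl , refl)))
two-of-four false true  true  _     _ = inj₂ (inj₂ (inj₂ (inj₁ (refl , refl))))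
two-of-four false true  false true  _ = inj₂ (inj₂ (inj₂ (inj₂ (inj₁ (refl , refl)))))
two-of-four false false true  true  _ = inj₂ (inj₂ (inj₂ (inj₂ (inj₂ (refl , refl)))))
two-of-four true  false false false (s≤s ())
two-of-four false true  false false (s≤s ())
two-of-four false false true  false (s≤s ())
two-of-four false false false true  (s≤s ())

q-mono : ∀ k → q k ≤ q (suc k)
q-mono 0             = z≤n
q-mono 1             = z≤n
q-mono (suc (suc k)) = +-mono-≤ (q-mono k) (n≤1+n (suc k))

three-of-four : ∀ p q r s → 3 ≤ ι p + (ι q + (ι r + (ι s + 0))) →
  (p ≡ true × q ≡ true × r ≡ true) ⊎ (p ≡ true × q ≡ true × s ≡ true) ⊎
  (p ≡ true × r ≡ true × s ≡ true) ⊎ (q ≡ true × r ≡ true × s ≡ true)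
three-of-four true  true  true  _     _ = inj₁ (refl , refl , refl)
three-of-four true  true  false true  _ = inj₂ (inj₁ (refl , refl , refl))
three-of-four true  false true  true  _ = inj₂ (inj₂ (inj₁ (refl , refl , refl)))
three-of-four false true  true  true  _ = inj₂ (inj₂ (inj₂ (refl , refl , refl)))
three-of-four true  true  false false (s≤s (s≤s ()))
three-of-four true  false true  false (s≤s (s≤s ()))
three-of-four true  false false true  (s≤s (s≤s ()))
three-of-four true  false false false (s≤s ())
three-of-four false true  true  false (s≤s (s≤s ()))
three-of-four false true  false true  (s≤s (s≤s ()))
three-of-four false true  false false (s≤s ())
three-of-four false false true  true  (s≤s (s≤s ()))
three-of-four false false true  false (s≤s ())
three-of-four false false false true  (s≤s ())

-- For a vertex and a 4-cycle read in cyclic order: the vertex sees one diagonal pair and misses the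
-- other.
Opposite : Bool → Bool → Bool → Bool → Set
Opposite p q r s = (p ≡ true × q ≡ false × r ≡ true × s ≡ false) ⊎ (p ≡ false × q ≡ true × r ≡ false × s ≡ true)

no-consecutive : ∀ p q r s → ¬ (p ≡ true × q ≡ true) → ¬ (q ≡ true × r ≡ true) →
  ¬ (r ≡ true × s ≡ true) → ¬ (s ≡ true × p ≡ true) →
  ι p + (ι q + (ι r + (ι s + 0))) ≤ 1 ⊎ Opposite p q r s
no-consecutive true  true  _     _     pq _ _ _ = ⊥-elim (pq (refl , refl))
no-consecutive _     true  true  _     _ qr _ _ = ⊥-elim (qr (refl , refl))
no-consecutive _     _     true  true  _ _ rs _ = ⊥-elim (rs (refl , refl))
no-consecutive true  _     _     true  _ _ _ sp = ⊥-elim (sp (refl , refl))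
no-consecutive true  false true  false _ _ _ _ = inj₂ (inj₁ (refl , refl , refl , refl))
no-consecutive false true  false true  _ _ _ _ = inj₂ (inj₂ (refl , refl , refl , refl))
no-consecutive true  false false false _ _ _ _ = inj₁ ≤-refl
no-consecutive false true  false false _ _ _ _ = inj₁ ≤-refl
no-consecutive false false true  false _ _ _ _ = inj₁ ≤-refl
no-consecutive false false false true  _ _ _ _ = inj₁ ≤-refl
no-consecutive false false false false _ _ _ _ = inj₁ z≤n

-- Colour argument in a complete bipartite graph: an edge puts the first two vertices on opposite
-- sides, a non-edge puts the last two on the same side, so the outer two are adjacent.
xor-shift : ∀ {s t u} a b c → s ≡ true → s ≡ a xor b → t ≡ false → t ≡ b xor c → u ≡ a xor c → u ≡ true
xor-shift true  false false refl _ refl _ eq = eq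
xor-shift false true  true  refl _ refl _ eq = eq
xor-shift true  true  _     refl () refl _ _
xor-shift false false _     refl () refl _ _
xor-shift true  false true  refl _ refl () _
xor-shift false true  false refl _ refl () _

-- The graphs F and H on natural numbers

-- F n i j is fromRel n (block (i ∸ j) i).
block : ℕ → ℕ → ℕ → ℕ → Bool
block s i a b =
    ((a <ᵇ s) ∧ (b <ᵇ s) ∧ ((a / 3) ≡ᵇ (b / 3)))
  ∨ ((a ≡ᵇ s) ∧ not (b <ᵇ s) ∧ (b <ᵇ i))
  ∨ crossR i a b

-- Adjacency on ℕ without the bound n, so that stripping the first triangle or the star centre is a
-- plain shift of indices.
blockAdj : ℕ → ℕ → ℕ → ℕ → Bool
blockAdj s i a b = not (a ≡ᵇ b) ∧ (block s i a b ∨ block s i b a)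

[3+a]/3 : ∀ a → (3 + a) / 3 ≡ suc (a / 3)
[3+a]/3 a = ≡.trans (+-distrib-/-∣ˡ a (∣-refl {3})) (cong (_+ a / 3) (n/n≡1 3))

block-shift : ∀ s i a b → block (3 + s) (3 + i) (3 + a) (3 + b) ≡ block s i a b
block-shift s i a b rewrite [3+a]/3 a | [3+a]/3 b = refl

blockAdj-shift : ∀ s i a b → blockAdj (3 + s) (3 + i) (3 + a) (3 + b) ≡ blockAdj s i a b
blockAdj-shift s i a b rewrite block-shift s i a b | block-shift s i b a = refl

≡ᵇ-sym : ∀ a b → (a ≡ᵇ b) ≡ (b ≡ᵇ a)
≡ᵇ-sym zero    zero    = refl
≡ᵇ-sym zero    (suc b) = refl
≡ᵇ-sym (suc a) zero    = refl
≡ᵇ-sym (suc a) (suc b) = ≡ᵇ-sym a b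

blockAdj-sym : ∀ s i a b → blockAdj s i a b ≡ blockAdj s i b a
blockAdj-sym s i a b = cong₂ _∧_ (cong not (≡ᵇ-sym a b)) (∨-comm (block s i a b) (block s i b a))

triangle-rows : ∀ s i b →
  blockAdj (3 + s) (3 + i) 0 (3 + b) ≡ not (b <ᵇ i) ×
  blockAdj (3 + s) (3 + i) 1 (3 + b) ≡ not (b <ᵇ i) ×
  blockAdj (3 + s) (3 + i) 2 (3 + b) ≡ not (b <ᵇ i)
triangle-rows s i b rewrite [3+a]/3 b with b <ᵇ s | b <ᵇ i | b ≡ᵇ s
... | true  | true  | true  = refl , refl , refl
... | true  | true  | false = refl , refl , refl
... | true  | false | true  = refl , refl , refl
... | true  | false | false = refl , refl , refl
... | false | true  | true  = refl , refl , refl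
... | false | true  | false = refl , refl , refl
... | false | false | true  = refl , refl , refl
... | false | false | false = refl , refl , refl

star-row : ∀ m b → blockAdj 0 (suc m) 0 (suc b) ≡ true
star-row m b with b <ᵇ m
... | true  = refl
... | false = refl

≢ᵇ-separated : ∀ m a b → (a <ᵇ m) ≡ true → (b <ᵇ m) ≡ false → (a ≡ᵇ b) ≡ false
≢ᵇ-separated (suc m) zero    (suc b) _ _ = refl
≢ᵇ-separated (suc m) (suc a) (suc b) p q = ≢ᵇ-separated m a b p q

-- With the centre gone, the leaves and Y span a complete bipartite graph.
star-rest : ∀ m a b → blockAdj 0 (suc m) (suc a) (suc b) ≡ (a <ᵇ m) xor (b <ᵇ m)
star-rest m a b with a <ᵇ m in a<m | b <ᵇ m in b<m
... | true  | true  = ∧-zeroʳ (not (a ≡ᵇ b))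
... | false | false = ∧-zeroʳ (not (a ≡ᵇ b))
... | true  | false rewrite ≢ᵇ-separated m a b a<m b<m = refl
... | false | true  rewrite ≡ᵇ-sym a b | ≢ᵇ-separated m b a b<m a<m = refl

empty-block : ∀ a b → blockAdj 0 0 a b ≡ false
empty-block a b rewrite ∧-zeroʳ (a ≡ᵇ 0) | ∧-zeroʳ (b ≡ᵇ 0) = ∧-zeroʳ (not (a ≡ᵇ b))

split-by : ∀ {A : Set} (p : A → Bool) xs →
  ∃₂ λ N R → xs ↭ N ++ R × All (λ x → p x ≡ true) N × All (λ x → p x ≡ false) R
split-by p []       = [] , [] , refl , [] , []
split-by p (x ∷ xs) with split-by p xs | p x in px
... | N , R , xs↭ , pN , pR | true  = x ∷ N , R , prep x xs↭ , px ∷ pN , pR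
... | N , R , xs↭ , pN , pR | false = N , x ∷ R , ↭-trans (prep x xs↭) (↭-sym (shift x N R)) , pN , px ∷ pR

-- A relational lookup: matching on it advances along the list and in the numerical index at once,
-- as the comparison of `adj` with `blockAdj` requires.
data At {A : Set} : List A → ℕ → A → Set where
  here  : ∀ {x xs} → At (x ∷ xs) 0 x
  there : ∀ {x xs k y} → At xs k y → At (x ∷ xs) (suc k) y

At-++ : ∀ {A : Set} (P : List A) {Y k v} → At (P ++ Y) k v →
  ((k <ᵇ length P) ≡ true × v ∈ P) ⊎ ((k <ᵇ length P) ≡ false × v ∈ Y)
At-++ []      at         = inj₂ (refl , At⇒∈ at)
  where
  At⇒∈ : ∀ {A : Set} {xs : List A} {k v} → At xs k v → v ∈ xs
  At⇒∈ here       = here refl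
  At⇒∈ (there at) = there (At⇒∈ at)
At-++ (x ∷ P) here       = inj₁ (refl , here refl)
At-++ (x ∷ P) (there at) with At-++ P at
... | inj₁ (lt , v∈) = inj₁ (lt , there v∈)
... | inj₂ (ge , v∈) = inj₂ (ge , v∈)

-- The number of stars when the star block has the given number of vertices; argument 0 stands for
-- the graphs H.
σ : ℕ → ℕ
σ zero    = 0
σ (suc _) = 1

-- Graphs without a squared path

module Free {n : ℕ} (G : Graph n) (free : ¬ Contains (P2 6) G) where

  V : Set
  V = Fin n

  open Counting (adj G) public
  open Symmetric (symm G) public

  infix 4 _~_
  _~_ : V → V → Set
  x ~ y = adj G x y ≡ true

  ~-sym : ∀ {x y} → x ~ y → y ~ x
  ~-sym {x} {y} xy = ≡.trans (symm G y x) xy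

  ~⇒≢ : ∀ {x y} → x ~ y → x ≢ y
  ~⇒≢ {x} xx refl with ≡.trans (sym xx) (irrefl G x)
  ... | ()

  -- The nine edges already separate nine of the fifteen pairs. Only the six pairs at distance at
  -- least three along the path need an explicit inequality.
  square : ∀ {a b c d e f : V} →
    a ≢ d → a ≢ e → a ≢ f → b ≢ e → b ≢ f → c ≢ f →
    a ~ b → a ~ c → b ~ c → b ~ d → c ~ d → c ~ e → d ~ e → d ~ f → e ~ f → ⊥
  square {a} {b} {c} {d} {e} {f} ad ae af be bf cf ab ac bc bd cd ce de df ef =
    free (lookup vs , (λ {i} {j} → lookup-injective distinct i j) , edges)
    where
    vs = a ∷ b ∷ c ∷ d ∷ e ∷ f ∷ []
    distinct : Unique vs
    distinct =
      (~⇒≢ ab ∷ ~⇒≢ ac ∷ ad ∷ ae ∷ af ∷ []) ∷ (~⇒≢ bc ∷ ~⇒≢ bd ∷ be ∷ bf ∷ []) ∷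
      (~⇒≢ cd ∷ ~⇒≢ ce ∷ cf ∷ []) ∷ (~⇒≢ de ∷ ~⇒≢ df ∷ []) ∷ (~⇒≢ ef ∷ []) ∷ [] ∷ []
    edges : ∀ i j → adj (P2 6) i j ≡ true → lookup vs i ~ lookup vs j
    edges zero zero ()
    edges zero (suc zero) _ = ab
    edges zero (suc (suc zero)) _ = ac
    edges zero (suc (suc (suc _))) ()
    edges (suc zero) zero _ = ~-sym ab
    edges (suc zero) (suc zero) ()
    edges (suc zero) (suc (suc zero)) _ = bc
    edges (suc zero) (suc (suc (suc zero))) _ = bd
    edges (suc zero) (suc (suc (suc (suc _)))) ()
    edges (suc (suc zero)) zero _ = ~-sym ac
    edges (suc (suc zero)) (suc zero) _ = ~-sym bc
    edges (suc (suc zero)) (suc (suc zero)) ()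
    edges (suc (suc zero)) (suc (suc (suc zero))) _ = cd
    edges (suc (suc zero)) (suc (suc (suc (suc zero)))) _ = ce
    edges (suc (suc zero)) (suc (suc (suc (suc (suc zero))))) ()
    edges (suc (suc (suc zero))) zero ()
    edges (suc (suc (suc zero))) (suc zero) _ = ~-sym bd
    edges (suc (suc (suc zero))) (suc (suc zero)) _ = ~-sym cd
    edges (suc (suc (suc zero))) (suc (suc (suc zero))) ()
    edges (suc (suc (suc zero))) (suc (suc (suc (suc zero)))) _ = de
    edges (suc (suc (suc zero))) (suc (suc (suc (suc (suc zero))))) _ = df
    edges (suc (suc (suc (suc zero)))) zero ()
    edges (suc (suc (suc (suc zero)))) (suc zero) ()
    edges (suc (suc (suc (suc zero)))) (suc (suc zero)) _ = ~-sym ce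
    edges (suc (suc (suc (suc zero)))) (suc (suc (suc zero))) _ = ~-sym de
    edges (suc (suc (suc (suc zero)))) (suc (suc (suc (suc zero)))) ()
    edges (suc (suc (suc (suc zero)))) (suc (suc (suc (suc (suc zero))))) _ = ef
    edges (suc (suc (suc (suc (suc zero))))) zero ()
    edges (suc (suc (suc (suc (suc zero))))) (suc zero) ()
    edges (suc (suc (suc (suc (suc zero))))) (suc (suc zero)) ()
    edges (suc (suc (suc (suc (suc zero))))) (suc (suc (suc zero))) _ = ~-sym df
    edges (suc (suc (suc (suc (suc zero))))) (suc (suc (suc (suc zero)))) _ = ~-sym ef
    edges (suc (suc (suc (suc (suc zero))))) (suc (suc (suc (suc (suc zero))))) ()

  Clique : List V → Set
  Clique = AllPairs _~_

  clique-↭ : ∀ {K L} → K ↭ L → Clique K → Clique L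
  clique-↭ = AllPairs-↭ ~-sym

  clique-unique : ∀ {K} → Clique K → Unique K
  clique-unique = AllPairs.map ~⇒≢

  CliqueIn : ℕ → List V → Set
  CliqueIn k S = ∃ λ K → length K ≡ k × Clique K × All (_∈ S) K

  clique? : ∀ k S → Dec (CliqueIn k S)
  clique? zero    S = yes ([] , refl , [] , [])
  clique? (suc k) S with any? (λ x → clique? k (filter (λ y → adj G x y ≟ᵇ true) S)) S
  ... | yes found with find found
  ...   | x , x∈S , K , len , cl , K⊆ = yes (x ∷ K , cong suc len ,
          All.map (λ m → proj₂ (∈-filter⁻ _ {xs = S} m)) K⊆ ∷ cl ,
          x∈S ∷ All.map (λ m → proj₁ (∈-filter⁻ _ {xs = S} m)) K⊆)
  clique? (suc k) S | no none = no λ where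
    (x ∷ K , len , xK ∷ cl , x∈S ∷ K⊆S) → none (lose x∈S
      (K , suc-injective len , cl ,
       All.zipWith (λ (m , xy) → ∈-filter⁺ _ m xy) (K⊆S , xK)))

  front : ∀ x k m K → length K ≡ k + m → k ≤ deg x K →
    ∃₂ λ (as : Vec V k) (bs : Vec V m) → All (x ~_) (toList as) × K ↭ toList as ++ toList bs
  front x k m K len k≤ with neighbours-first x k K k≤
  ... | as , bs , len-as , all , K↭ with as-vec as len-as
  ...   | as′ , refl with as-vec bs {m} (+-cancelˡ-≡ k _ _ (≡.trans (≡.trans
            (cong (_+ length bs) (sym len-as)) (≡.trans (sym (Data.List.Properties.length-++ (toList as′))) (sym (↭-length K↭)))) len))
  ...     | bs′ , refl = as′ , bs′ , all , K↭

  -- If w had two neighbours in the clique, then w, these two and the other three would be a squared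
  -- path in this order.
  K₅-attachment : ∀ {K R} → Clique K → length K ≡ 5 → Unique (K ++ R) →
    ∀ {w} → w ∈ R → deg w K ≤ 1
  K₅-attachment {K} cl len u {w} w∈R with deg w K ≤? 1
  ... | yes ok = ok
  ... | no  ¬ok with front w 2 3 K len (≰⇒> ¬ok)
  ...   | a ∷ b ∷ [] , c ∷ d ∷ e₁ ∷ [] , wa ∷ wb ∷ [] , K↭ with clique-↭ K↭ cl
  ...     | (ab ∷ ac ∷ ad ∷ ae ∷ []) ∷ (bc ∷ bd ∷ be ∷ []) ∷ (cd ∷ ce ∷ []) ∷ (de ∷ []) ∷ [] ∷ [] =
    ⊥-elim (square (w≢ (there (there (here refl)))) (w≢ (there (there (there (here refl)))))
      (w≢ (there (there (there (there (here refl)))))) (~⇒≢ ad) (~⇒≢ ae) (~⇒≢ be)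
      wa wb ab ac bc bd cd ce de)
    where
    w≢ : ∀ {x} → x ∈ a ∷ b ∷ c ∷ d ∷ e₁ ∷ [] → w ≢ x
    w≢ x∈ w≡x = unique-++-≢ K u (∈-resp-↭ (↭-sym K↭) x∈) w∈R (sym w≡x)

  -- Y = {p = true} and X = {p = false}.
  record Join (S : List V) : Set where
    field
      p         : V → Bool
      Y-indep   : ∀ {x y} → x ∈ S → y ∈ S → p x ≡ true → p y ≡ true → adj G x y ≡ false
      XY-joined : ∀ {x y} → x ∈ S → y ∈ S → p x ≡ true → p y ≡ false → x ~ y
      X-P₄-free : ∀ {a b c d} → a ∈ S → b ∈ S → c ∈ S → d ∈ S →
        p a ≡ false → p b ≡ false → p c ≡ false → p d ≡ false →
        a ≢ c → a ≢ d → b ≢ d → a ~ b → b ~ c → c ~ d → ⊥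

  -- The second component is the equality case. Sets with fewer than six vertices occur only as
  -- remainders of the induction, where the inequality alone is used.
  Bound : List V → Set
  Bound S = e S ≤ turán (length S) × (6 ≤ length S → turán (length S) ≤ e S → Join S)

  Common : List V → V → Set
  Common T y = All (y ~_) T

  -- Sets with a K₄ but no K₅: triangles with common neighbours

  -- If w met both the triangle and its common neighbour y, then y′ c b y a w would be a P²₆.
  triangle-or-apex : ∀ {T Ys} → Clique T → length T ≡ 3 → ∀ {k} → length Ys ≡ 2 + k →
    All (Common T) Ys → Unique Ys → ∀ {w} → (∀ {x} → x ∈ T ++ Ys → x ≢ w) →
    deg w T ≡ 0 ⊎ deg w Ys ≡ 0
  triangle-or-apex {T} {Ys} clT lenT {k} lenY common uY {w} w∉ with deg w T in dT | deg w Ys in dY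
  ... | zero  | _    = inj₁ refl
  ... | suc _ | zero = inj₂ refl
  ... | suc _ | suc _ with front w 1 2 T lenT (≤-trans (s≤s z≤n) (≤-reflexive (sym dT)))
                         | front w 1 (suc k) Ys lenY (≤-trans (s≤s z≤n) (≤-reflexive (sym dY)))
  ...   | a ∷ [] , b ∷ c ∷ [] , wa ∷ [] , T↭ | y ∷ [] , y′ ∷ _ , wy ∷ [] , Y↭
      with clique-↭ T↭ clT | unique-↭ Y↭ uY | All-resp-↭ Y↭ common
  ...     | (ab ∷ ac ∷ []) ∷ (bc ∷ []) ∷ _ | (y≢y′ ∷ _) ∷ _ | cy ∷ cy′ ∷ _
      with All-resp-↭ T↭ cy | All-resp-↭ T↭ cy′
  ...       | ya ∷ yb ∷ yc ∷ [] | y′a ∷ y′b ∷ y′c ∷ [] =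
    ⊥-elim (square (λ eq → y≢y′ (sym eq)) (~⇒≢ y′a)
      (w∉ (∈-++⁺ʳ T (∈-resp-↭ (↭-sym Y↭) (there (here refl)))))
      (λ eq → ~⇒≢ ac (sym eq))
      (w∉ (∈-++⁺ˡ (∈-resp-↭ (↭-sym T↭) (there (there (here refl))))))
      (w∉ (∈-++⁺ˡ (∈-resp-↭ (↭-sym T↭) (there (here refl)))))
      y′c y′b (~-sym bc) (~-sym yc) (~-sym yb) (~-sym ab) ya (~-sym wy) (~-sym wa))

  adj-false : ∀ {x y} → ¬ x ~ y → adj G x y ≡ false
  adj-false ¬xy = ¬-not ¬xy

  NoClique : ℕ → List V → Set
  NoClique k S = ¬ CliqueIn k S

  all-neighbours : ∀ x Ys → length Ys ≤ deg x Ys → All (x ~_) Ys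
  all-neighbours x Ys le with front x (length Ys) 0 Ys (sym (+-identityʳ _)) le
  ... | as , [] , all , Y↭ = All-resp-↭ (↭-sym Y↭)
        (subst (All (x ~_)) (sym (++-identityʳ (toList as))) all)

  length-split : ∀ {S : List V} K {R} → S ↭ K ++ R → length S ≡ length K + length R
  length-split K {R} S↭ = ≡.trans (↭-length S↭) (length-++ K)

  -- Two adjacent common neighbours would complete the triangle to a K₅.
  common-apart : ∀ {T S} → Clique T → length T ≡ 3 → NoClique 5 S → All (_∈ S) T →
    ∀ {x y} → x ∈ S → y ∈ S → Common T x → Common T y → adj G x y ≡ false
  common-apart clT lenT no5 T⊆S x∈ y∈ cx cy = adj-false λ xy →
    no5 (_ ∷ _ ∷ _ , cong (2 +_) lenT , (xy ∷ cx) ∷ cy ∷ clT , x∈ ∷ y∈ ∷ T⊆S)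

  -- Only the inequality is inherited. It includes remainders of size five: it is assumed for
  -- K₅-free S, whose subsets are K₅-free as well.
  SmallerBound : List V → Set
  SmallerBound S = ∀ {R} → Unique R → (∀ {x} → x ∈ R → x ∈ S) → length R < length S → e R ≤ turán (length R)

  module Apexes {T S : List V} (clT : Clique T) (lenT : length T ≡ 3) (uS : Unique S)
    (no5 : NoClique 5 S) (T⊆S : All (_∈ S) T)
    (ih : SmallerBound S) where

    -- The three common neighbours stay variable because `joined` repeats the same count with a
    -- triple through a prescribed vertex.
    Triple : List V → List V → Set
    Triple Ys R = length Ys ≡ 3 × All (Common T) Ys × S ↭ T ++ (Ys ++ R)

    module _ {Ys R : List V} (triple : Triple Ys R) where

      private
        lenY = proj₁ triple
        common = proj₁ (proj₂ triple)
        S↭ = proj₂ (proj₂ triple)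
        K = T ++ Ys

        S↭K : S ↭ K ++ R
        S↭K = ↭-trans S↭ (↭-reflexive (sym (++-assoc T Ys R)))

        uK : Unique (K ++ R)
        uK = unique-↭ S↭K uS

        lenK : length K ≡ 6
        lenK = ≡.trans (length-++ T) (cong₂ _+_ lenT lenY)

        alternative : ∀ {w} → w ∈ R → deg w T ≡ 0 ⊎ deg w Ys ≡ 0
        alternative w∈R = triangle-or-apex clT lenT lenY common
          (unique-++ʳ T (unique-++ˡ K uK)) (λ x∈K → unique-++-≢ K uK x∈K w∈R)

        deg-K : ∀ w → deg w K ≡ deg w T + deg w Ys
        deg-K w = deg-++ w T Ys

        deg-K≤3 : ∀ {w} → w ∈ R → deg w K ≤ 3
        deg-K≤3 {w} w∈R rewrite deg-K w with alternative w∈R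
        ... | inj₁ z rewrite z = ≤-trans (deg≤length w Ys) (≤-reflexive lenY)
        ... | inj₂ z rewrite z | +-identityʳ (deg w T) = ≤-trans (deg≤length w T) (≤-reflexive lenT)

        ∈S : ∀ {x} → x ∈ K → x ∈ S
        ∈S = ∈-prefix K S↭K

        e-K : e K ≤ 12
        e-K = begin
          e K                          ≡⟨ e-++ T Ys ⟩
          e T + (cross T Ys + e Ys)    ≤⟨ +-mono-≤ (e≤tri T) (+-mono-≤ (sum-map-≤ _ 3 Ys λ {w} _ →
                                            ≤-trans (deg≤length w T) (≤-reflexive lenT)) (≤-reflexive independent)) ⟩
          tri (length T) + (3 * length Ys + 0)  ≡⟨ cong₂ (λ a b → tri a + (3 * b + 0)) lenT lenY ⟩
          12                           ∎
          where
          open ≤-Reasoning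
          independent : e Ys ≡ 0
          independent = edgeless Ys λ x∈ y∈ → common-apart clT lenT no5 T⊆S
            (∈S (∈-++⁺ʳ T x∈)) (∈S (∈-++⁺ʳ T y∈)) (All.lookup common x∈) (All.lookup common y∈)

        length-S : length S ≡ 6 + length R
        length-S = ≡.trans (length-split K S↭K) (cong (_+ length R) lenK)

        e-R : e R ≤ turán (length R)
        e-R = ih (unique-++ʳ K uK) (∈-suffix K S↭K) (≤-trans (m<n+m _ (s≤s {n = 5} z≤n)) (≤-reflexive (sym length-S)))

      apexes-bound : e S ≤ turán (length S)
      apexes-bound rewrite length-S | e-split K R S↭K =
        +-mono-≤ e-K (+-mono-≤ (sum-map-≤ _ 3 R deg-K≤3) e-R)

      -- Equality leaves no slack in 12 + 3 |R| + `turán |R|`, so w has three edges into the six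
      -- deleted vertices. As it misses `T` or `Ys` altogether, it sees all of the other.
      apexes-tight : turán (length S) ≤ e S → ∀ {w} → w ∈ R →
        Common T w ⊎ All (w ~_) Ys
      apexes-tight tight {w} w∈R with alternative w∈R | sum-map-tight _ 3 R deg-K≤3 3m≤ w∈R
        where
        3m≤ : 3 * length R ≤ cross K R
        3m≤ = +-cancelʳ-≤ (turán (length R)) _ _ (+-cancelˡ-≤ 12 _ _ (begin
          12 + (3 * length R + turán (length R))  ≡⟨ cong turán (sym length-S) ⟩
          turán (length S)                        ≤⟨ tight ⟩
          e S                                     ≡⟨ e-split K R S↭K ⟩
          e K + (cross K R + e R)                 ≤⟨ +-mono-≤ e-K (+-monoʳ-≤ (cross K R) e-R) ⟩
          12 + (cross K R + turán (length R))     ∎))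
          where open ≤-Reasoning
      ... | inj₁ z | three = inj₂ (all-neighbours w Ys (≤-trans (≤-reflexive lenY)
            (≤-trans three (≤-reflexive (≡.trans (deg-K w) (cong (_+ deg w Ys) z))))))
      ... | inj₂ z | three = inj₁ (all-neighbours w T (≤-trans (≤-reflexive lenT)
            (≤-trans three (≤-reflexive (≡.trans (deg-K w) (≡.trans (cong (deg w T +_) z) (+-identityʳ _)))))))

  three-apexes : ∀ {a b c y₁ y₂ y₃ S R} → Clique (a ∷ b ∷ c ∷ []) → Unique S → NoClique 5 S → SmallerBound S →
    All (Common (a ∷ b ∷ c ∷ [])) (y₁ ∷ y₂ ∷ y₃ ∷ []) → S ↭ a ∷ b ∷ c ∷ y₁ ∷ y₂ ∷ y₃ ∷ R → Bound S
  three-apexes {a} {b} {c} {y₁} {y₂} {y₃} {S} {R} clT uS no5 ih common@(cy₁ ∷ cy₂ ∷ cy₃ ∷ []) S↭ =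
    apexes-bound triple₀ , λ _ tight → record
      { p         = p
      ; Y-indep   = λ x∈ y∈ px py → common-apart clT refl no5 T⊆S x∈ y∈ (p⇒common px) (p⇒common py)
      ; XY-joined = joined tight
      ; X-P₄-free = λ a∈ b∈ c∈ d∈ pa pb pc pd a≢c a≢d b≢d ab bc cd →
          -- The squared path is y₁ a b y₂ c d.
          square y₁≢y₂ (apart py₁ pc) (apart py₁ pd) a≢c a≢d b≢d
            (joined tight y₁∈ a∈ py₁ pa) (joined tight y₁∈ b∈ py₁ pb) ab
            (~-sym (joined tight y₂∈ a∈ py₂ pa)) (~-sym (joined tight y₂∈ b∈ py₂ pb)) bc
            (joined tight y₂∈ c∈ py₂ pc) (joined tight y₂∈ d∈ py₂ pd) cd
      }
    where
    T = a ∷ b ∷ c ∷ []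

    T⊆S : All (_∈ S) T
    T⊆S = All.tabulate (∈-prefix T S↭)

    open Apexes clT refl uS no5 T⊆S ih

    triple₀ : Triple (y₁ ∷ y₂ ∷ y₃ ∷ []) R
    triple₀ = refl , common , S↭

    p : V → Bool
    p x = adj G x a ∧ (adj G x b ∧ adj G x c)

    p⇒common : ∀ {x} → p x ≡ true → Common T x
    p⇒common {x} px with adj G x a in xa | adj G x b in xb | adj G x c in xc
    p⇒common refl | true | true | true = xa ∷ xb ∷ xc ∷ []

    common⇒p : ∀ {x} → Common T x → p x ≡ true
    common⇒p (xa ∷ xb ∷ xc ∷ []) rewrite xa | xb | xc = refl

    py₁ = common⇒p cy₁
    py₂ = common⇒p cy₂

    apart : ∀ {x y} → p x ≡ true → p y ≡ false → x ≢ y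
    apart px py refl = not-both px py

    y₁∈ : y₁ ∈ S
    y₁∈ = ∈-suffix T S↭ (here refl)
    y₂∈ : y₂ ∈ S
    y₂∈ = ∈-suffix T S↭ (there (here refl))

    y₁≢y₂ : y₁ ≢ y₂
    y₁≢y₂ = unique-head (unique-++ʳ T (unique-↭ S↭ uS)) (here refl)

    triple-through : ∀ {x} → x ∈ S → Common T x → ∃₂ λ Ys R → Triple Ys R × x ∈ Ys
    triple-through x∈S cx with ∈-++⁻ T (∈-resp-↭ S↭ x∈S)
    ... | inj₁ x∈T = ⊥-elim (~⇒≢ (All.lookup cx x∈T) refl)
    ... | inj₂ x∈YR with ∈-++⁻ (y₁ ∷ y₂ ∷ y₃ ∷ []) x∈YR
    ...   | inj₁ x∈Y = _ , _ , triple₀ , x∈Y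
    ...   | inj₂ x∈R with extract₁ x∈R
    ...     | R′ , R↭ = _ ∷ y₁ ∷ y₂ ∷ [] , y₃ ∷ R′ ,
      (refl , cx ∷ cy₁ ∷ cy₂ ∷ [] , ↭-trans S↭ (++⁺ˡ T
        (↭-trans (++⁺ˡ (y₁ ∷ y₂ ∷ y₃ ∷ []) R↭) (shift _ (y₁ ∷ y₂ ∷ y₃ ∷ []) R′)))) , here refl

    -- Every common neighbour x of `T` belongs to some triple, replacing y₃ if necessary. Tightness
    -- for that triple shows that y, not being a common neighbour, sees the whole triple, in
    -- particular x.
    joined : turán (length S) ≤ e S → ∀ {x y} → x ∈ S → y ∈ S → p x ≡ true → p y ≡ false → x ~ y
    joined tight x∈ y∈ px py with triple-through x∈ (p⇒common px)
    ... | Ys , R′ , t@(_ , cY , S↭′) , x∈Y with ∈-++⁻ T (∈-resp-↭ S↭′ y∈)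
    ...   | inj₁ y∈T = All.lookup (p⇒common px) y∈T
    ...   | inj₂ y∈YR with ∈-++⁻ Ys y∈YR
    ...     | inj₁ y∈Y = ⊥-elim (not-both (common⇒p (All.lookup cY y∈Y)) py)
    ...     | inj₂ y∈R with apexes-tight t tight y∈R
    ...       | inj₁ cy = ⊥-elim (not-both (common⇒p cy) py)
    ...       | inj₂ yY = ~-sym (All.lookup yY x∈Y)

  too-few : ∀ {S} → e S < turán (length S) → Bound S
  too-few lt = <⇒≤ lt , λ _ tight → ⊥-elim (<⇒≱ lt tight)

  -- Without a third common neighbour, an outside vertex sends at most two edges to the K₅ minus an
  -- edge: it misses the triangle or both apexes, and it cannot see the whole triangle.
  two-apexes : ∀ {a b c y₁ y₂ S R} → Clique (a ∷ b ∷ c ∷ []) → Unique S → NoClique 5 S → SmallerBound S →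
    Common (a ∷ b ∷ c ∷ []) y₁ → Common (a ∷ b ∷ c ∷ []) y₂ → S ↭ a ∷ b ∷ c ∷ y₁ ∷ y₂ ∷ R → Bound S
  two-apexes {a} {b} {c} {y₁} {y₂} {S} {R} clT uS no5 ih cy₁ cy₂ S↭
    with any? (λ w → All.all? (λ t → adj G w t ≟ᵇ true) (a ∷ b ∷ c ∷ [])) R
  ... | yes found =
    let y₃ , y₃∈R , cy₃ = find found
        R′ , R↭ = extract₁ y₃∈R
    in three-apexes clT uS no5 ih (cy₁ ∷ cy₂ ∷ cy₃ ∷ []) (↭-trans S↭ (++⁺ˡ (a ∷ b ∷ c ∷ y₁ ∷ y₂ ∷ []) R↭))
  ... | no none = bound
    where
    T = a ∷ b ∷ c ∷ []
    Ys = y₁ ∷ y₂ ∷ []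
    K = T ++ Ys

    uK : Unique (K ++ R)
    uK = unique-↭ S↭ uS

    deg-K≤2 : ∀ {w} → w ∈ R → deg w K ≤ 2
    deg-K≤2 {w} w∈R rewrite deg-++ w T Ys with triangle-or-apex clT refl {0} refl (cy₁ ∷ cy₂ ∷ [])
      (unique-++ʳ T (unique-++ˡ K uK)) (λ x∈K → unique-++-≢ K uK x∈K w∈R)
    ... | inj₁ z rewrite z = deg≤length w Ys
    ... | inj₂ z rewrite z | +-identityʳ (deg w T) with deg w T ≤? 2
    ...   | yes ok = ok
    ...   | no ¬ok = ⊥-elim (none (lose w∈R (all-neighbours w T (≰⇒> ¬ok))))

    y₁≁y₂ : adj G y₁ y₂ ≡ false
    y₁≁y₂ = common-apart clT refl no5 (All.tabulate (∈-prefix T S↭))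
      (∈-suffix T S↭ (here refl)) (∈-suffix T S↭ (there (here refl))) cy₁ cy₂

    e-K : e K ≤ 9
    e-K rewrite e-++ T Ys | y₁≁y₂ = +-mono-≤ (e≤tri T)
      (+-monoˡ-≤ 0 (sum-map-≤ _ 3 Ys λ {w} _ → deg≤length w T))

    length-S : length S ≡ 5 + length R
    length-S = length-split K S↭

    e-R : e R ≤ turán (length R)
    e-R = ih (unique-++ʳ K uK) (∈-suffix K S↭) (≤-trans (m<n+m _ (s≤s {n = 4} z≤n)) (≤-reflexive (sym length-S)))

    e-S : e S ≤ 9 + (2 * length R + turán (length R))
    e-S = ≤-trans (≤-reflexive (e-split K R S↭)) (+-mono-≤ e-K (+-mono-≤ (sum-map-≤ _ 2 R deg-K≤2) e-R))

    bound : Bound S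
    bound with length R | length-S | e-S
    -- Nine edges meet `turán 5` exactly; the equality clause holds because five vertices are below
    -- its threshold.
    ... | zero  | len | le rewrite len = le , λ 6≤5 → ⊥-elim (<⇒≱ 6≤5 ≤-refl)
    ... | suc m | len | le = too-few (begin-strict
        e S                                         ≤⟨ le ⟩
        9 + (2 * suc m + turán (suc m))             ≡⟨ shuffle m (turán (suc m)) ⟩
        11 + (2 * m + turán (suc m))                <⟨ turán-5 m ⟩
        turán (6 + m)                               ≡⟨ cong turán (sym len) ⟩
        turán (length S)                            ∎)
      where
      open ≤-Reasoning
      shuffle : ∀ m t → 9 + (2 * suc m + t) ≡ 11 + (2 * m + t)
      shuffle = solve-∀

  -- The squared path is c d a b w w′ if both vertices attach to a and b; w w′ x z y t if they share
  -- the neighbour x and w′ also sees z; and w a b c d w′ if their neighbour pairs are disjoint,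
  -- where the edge w w′ serves to make the ends distinct.
  two-attached-apart : ∀ {a b c d w w′} → Clique (a ∷ b ∷ c ∷ d ∷ []) →
    (∀ {x} → x ∈ a ∷ b ∷ c ∷ d ∷ [] → w ≢ x × w′ ≢ x) →
    w ~ a → w ~ b → 2 ≤ deg w′ (a ∷ b ∷ c ∷ d ∷ []) → ¬ w ~ w′
  two-attached-apart {a} {b} {c} {d} {w} {w′}
    ((ab ∷ ac ∷ ad ∷ []) ∷ (bc ∷ bd ∷ []) ∷ (cd ∷ []) ∷ [] ∷ []) apart wa wb two ww′ =
    case (two-of-four _ _ _ _ two)
    where
    K = a ∷ b ∷ c ∷ d ∷ []
    a∈ : a ∈ K
    a∈ = here refl
    b∈ : b ∈ K
    b∈ = there (here refl)
    c∈ : c ∈ K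
    c∈ = there (there (here refl))
    d∈ : d ∈ K
    d∈ = there (there (there (here refl)))

    share : ∀ {x y z t} → y ∈ K → z ∈ K → t ∈ K → x ~ y → x ~ z → x ~ t → y ~ z → y ~ t → z ~ t →
      w ~ x → w′ ~ x → w′ ~ z → ⊥
    share y∈ z∈ t∈ xy xz xt yz yt zt wx w′x w′z = square
      (proj₁ (apart z∈)) (proj₁ (apart y∈)) (proj₁ (apart t∈)) (proj₂ (apart y∈)) (proj₂ (apart t∈)) (~⇒≢ xt)
      ww′ wx w′x w′z xz xy (~-sym yz) zt yt

    case : _ → ⊥
    case (inj₁ (w′a , w′b)) = square
      (λ eq → ~⇒≢ bc (sym eq)) (λ eq → proj₁ (apart c∈) (sym eq)) (λ eq → proj₂ (apart c∈) (sym eq))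
      (λ eq → proj₁ (apart d∈) (sym eq)) (λ eq → proj₂ (apart d∈) (sym eq)) (λ eq → proj₂ (apart a∈) (sym eq))
      cd (~-sym ac) (~-sym ad) (~-sym bd) ab (~-sym wa) (~-sym wb) (~-sym w′b) ww′
    case (inj₂ (inj₁ (w′a , w′c))) = share b∈ c∈ d∈ ab ac ad bc bd cd wa w′a w′c
    case (inj₂ (inj₂ (inj₁ (w′a , w′d)))) = share b∈ d∈ c∈ ab ad ac bd bc (~-sym cd) wa w′a w′d
    case (inj₂ (inj₂ (inj₂ (inj₁ (w′b , w′c))))) = share a∈ c∈ d∈ (~-sym ab) bc bd ac ad cd wb w′b w′c
    case (inj₂ (inj₂ (inj₂ (inj₂ (inj₁ (w′b , w′d)))))) = share a∈ d∈ c∈ (~-sym ab) bd bc ad ac (~-sym cd) wb w′b w′d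
    case (inj₂ (inj₂ (inj₂ (inj₂ (inj₂ (w′c , w′d)))))) = square
      (proj₁ (apart c∈)) (proj₁ (apart d∈)) (~⇒≢ ww′) (~⇒≢ ad) (λ eq → proj₂ (apart a∈) (sym eq))
      (λ eq → proj₂ (apart b∈) (sym eq)) wa wb ab ac bc bd cd (~-sym w′c) (~-sym w′d)

  two-attached-indep : ∀ {K R} → Clique K → length K ≡ 4 → Unique (K ++ R) →
    ∀ {w w′} → w ∈ R → w′ ∈ R → 2 ≤ deg w K → 2 ≤ deg w′ K → adj G w w′ ≡ false
  two-attached-indep {K} clK lenK uK {w} {w′} w∈ w′∈ two two′ with front w 2 2 K lenK two
  ... | a ∷ b ∷ [] , c ∷ d ∷ [] , wa ∷ wb ∷ [] , K↭ = adj-false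
    (two-attached-apart (clique-↭ K↭ clK) apart wa wb (≤-trans two′ (≤-reflexive (deg-↭ w′ K↭))))
    where
    apart : ∀ {x} → x ∈ a ∷ b ∷ c ∷ d ∷ [] → w ≢ x × w′ ≢ x
    apart x∈ = let x∈K = ∈-resp-↭ (↭-sym K↭) x∈ in
      (λ eq → unique-++-≢ K uK x∈K w∈ (sym eq)) , (λ eq → unique-++-≢ K uK x∈K w′∈ (sym eq))

  -- A vertex w with three neighbours in K is a second common neighbour of that triangle, beside the
  -- fourth clique vertex. Otherwise the count runs twice. With the inductive bound for R, tightness
  -- allows at most one missing edge between K and R, which makes R almost independent. Then `e R`
  -- is linear in |R|, and the total computed anew is too small.
  K₄-bound : ∀ {K S R} → Clique K → length K ≡ 4 → Unique S → NoClique 5 S → SmallerBound S →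
    S ↭ K ++ R → Bound S
  K₄-bound {K} {S} {R} clK lenK uS no5 ih S↭ with any? (λ w → 3 ≤? deg w K) R
  ... | yes found with find found
  ...   | w , w∈R , three with front w 3 1 K lenK three | extract₁ w∈R
  ...     | a ∷ b ∷ c ∷ [] , d ∷ [] , wT , K↭ | R′ , R↭ with clique-↭ K↭ clK
  ...       | (ab ∷ ac ∷ ad ∷ []) ∷ (bc ∷ bd ∷ []) ∷ (cd ∷ []) ∷ [] ∷ [] =
    two-apexes ((ab ∷ ac ∷ []) ∷ (bc ∷ []) ∷ [] ∷ []) uS no5 ih
      (~-sym ad ∷ ~-sym bd ∷ ~-sym cd ∷ []) wT
      (↭-trans S↭ (↭-trans (++⁺ʳ R K↭) (++⁺ˡ (a ∷ b ∷ c ∷ d ∷ []) R↭)))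
  K₄-bound {K} {S} {R} clK lenK uS no5 ih S↭ | no none = bound (length R) refl
    where
    uK : Unique (K ++ R)
    uK = unique-↭ S↭ uS

    length-S : length S ≡ 4 + length R
    length-S = ≡.trans (length-split K S↭) (cong (_+ length R) lenK)

    deg-K≤2 : ∀ {w} → w ∈ R → deg w K ≤ 2
    deg-K≤2 w∈R = ≤-pred (≰⇒> (λ three → none (lose w∈R three)))

    e-K : e K ≤ 6
    e-K = ≤-trans (e≤tri K) (≤-reflexive (cong tri lenK))

    e-S : e S ≤ 6 + (cross K R + e R)
    e-S = ≤-trans (≤-reflexive (e-split K R S↭)) (+-monoˡ-≤ _ e-K)

    e-R : e R ≤ turán (length R)
    e-R = ih (unique-++ʳ K uK) (∈-suffix K S↭) (≤-trans (m<n+m _ (s≤s {n = 3} z≤n)) (≤-reflexive (sym length-S)))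

    indep : ∀ {w w′} → w ∈ R → w′ ∈ R → 2 ≤ deg w K → 2 ≤ deg w′ K → adj G w w′ ≡ false
    indep = two-attached-indep clK lenK uK

    cross≤ : cross K R ≤ 2 * length R
    cross≤ = sum-map-≤ _ 2 R deg-K≤2

    -- At most one vertex of R sends fewer than two edges to K, so the edges in R form a star.
    star : ∀ m → length R ≡ suc m → turán (length S) ≤ e S → e R ≤ m
    star m lenR tight with any? (λ w → deg w K ≤? 1) R
    ... | no all-two = ≤-trans (≤-reflexive (edgeless R λ x∈ y∈ → indep x∈ y∈
            (≰⇒> λ le → all-two (lose x∈ le)) (≰⇒> λ le → all-two (lose y∈ le)))) z≤n
    ... | yes found = begin
        e R                   ≡⟨ e-↭ R↭ ⟩
        deg x R′ + e R′       ≤⟨ +-monoˡ-≤ (e R′) (deg≤length x R′) ⟩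
        length R′ + e R′      ≡⟨ cong₂ _+_ lenR′ (edgeless R′ λ y∈ z∈ → indep (in-R y∈) (in-R z∈) (two y∈) (two z∈)) ⟩
        m + 0                 ≡⟨ +-identityʳ m ⟩
        m                     ∎
      where
      open ≤-Reasoning
      x = proj₁ (find found)
      x≤1 = proj₂ (proj₂ (find found))
      R′ = proj₁ (extract₁ (proj₁ (proj₂ (find found))))
      R↭ : R ↭ x ∷ R′
      R↭ = proj₂ (extract₁ (proj₁ (proj₂ (find found))))
      lenR′ : length R′ ≡ m
      lenR′ = suc-injective (≡.trans (sym (↭-length R↭)) lenR)
      in-R : ∀ {y} → y ∈ R′ → y ∈ R
      in-R = ∈-suffix (x ∷ []) R↭
      slack : 2 * suc m ≤ suc (cross K R)
      slack = +-cancelʳ-≤ (turán (length R)) _ _ (+-cancelˡ-≤ 5 _ _ (begin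
        5 + (2 * suc m + turán (length R))   ≡⟨ shuffle (2 * suc m) (turán (length R)) ⟩
        2 * suc m + 5 + turán (length R)     ≡⟨ cong (λ k → 2 * k + 5 + turán (length R)) (sym lenR) ⟩
        2 * length R + 5 + turán (length R)  ≤⟨ turán-4 (length R) ⟩
        turán (4 + length R)                 ≡⟨ cong turán (sym length-S) ⟩
        turán (length S)                     ≤⟨ tight ⟩
        e S                                  ≤⟨ e-S ⟩
        6 + (cross K R + e R)                ≤⟨ +-monoʳ-≤ 6 (+-monoʳ-≤ (cross K R) e-R) ⟩
        6 + (cross K R + turán (length R))   ∎))
        where
        shuffle : ∀ a t → 5 + (a + t) ≡ a + 5 + t
        shuffle = solve-∀
      two : ∀ {y} → y ∈ R′ → 2 ≤ deg y K
      two = sum-map-tight _ 2 R′ (λ y∈ → deg-K≤2 (in-R y∈)) (+-cancelˡ-≤ 2 _ _ (begin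
        2 + 2 * length R′         ≡⟨ cong (λ k → 2 + 2 * k) lenR′ ⟩
        2 + 2 * m                 ≡⟨ sym (*-suc 2 m) ⟩
        2 * suc m                 ≤⟨ slack ⟩
        suc (cross K R)           ≡⟨ cong suc (sum-↭ (map⁺ _ R↭)) ⟩
        suc (deg x K + cross K R′) ≤⟨ s≤s (+-monoˡ-≤ _ x≤1) ⟩
        2 + cross K R′            ∎))

    bound : ∀ m → length R ≡ m → Bound S
    bound 0 lenR = small , λ six → ⊥-elim (<⇒≱ (s≤s (s≤s (s≤s (s≤s (s≤s z≤n))))) (subst (6 ≤_) len six))
      where
      len : length S ≡ 4
      len = ≡.trans length-S (cong (4 +_) lenR)
      small : e S ≤ turán (length S)
      small = ≤-trans (e≤tri S) (≤-reflexive (≡.trans (cong tri len) (cong turán (sym len))))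
    bound 1 lenR = small , λ six → ⊥-elim (<⇒≱ (n<1+n 5) (subst (6 ≤_) len six))
      where
      len : length S ≡ 5
      len = ≡.trans length-S (cong (4 +_) lenR)
      open ≤-Reasoning
      small : e S ≤ turán (length S)
      small = begin
        e S                                  ≤⟨ e-S ⟩
        6 + (cross K R + e R)                ≤⟨ +-monoʳ-≤ 6 (+-mono-≤ cross≤ e-R) ⟩
        6 + (2 * length R + turán (length R)) ≡⟨ cong (λ k → 6 + (2 * k + turán k)) lenR ⟩
        8                                    ≤⟨ n≤1+n 8 ⟩
        turán 5                              ≡⟨ cong turán (sym len) ⟩
        turán (length S)                     ∎
    bound (suc (suc m)) lenR with turán (length S) ≤? e S
    ... | no loose = too-few (≰⇒> loose)
    ... | yes tight = ⊥-elim (<⇒≱ (begin-strict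
        e S                                  ≤⟨ e-S ⟩
        6 + (cross K R + e R)                ≤⟨ +-monoʳ-≤ 6 (+-mono-≤ cross≤ (star (suc m) lenR tight)) ⟩
        6 + (2 * length R + suc m)           ≡⟨ cong (λ k → 6 + (2 * k + suc m)) lenR ⟩
        6 + (2 * suc (suc m) + suc m)        ≡⟨ collect m ⟩
        11 + 3 * m                           <⟨ ≤-reflexive (+-comm 12 (3 * m)) ⟩
        3 * m + 12                           ≤⟨ turán-4-linear m ⟩
        turán (6 + m)                        ≡⟨ cong turán (sym (≡.trans length-S (cong (4 +_) lenR))) ⟩
        turán (length S)                     ∎) tight)
      where
      open ≤-Reasoning
      collect : ∀ m → 6 + (2 * suc (suc m) + suc m) ≡ 11 + 3 * m
      collect = solve-∀

  -- K₄-free vertex sets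

  record Hub (S : List V) : Set where
    field
      c         : V
      c∈S       : c ∈ S
      p         : V → Bool
      universal : ∀ {x} → x ∈ S → x ≢ c → c ~ x
      bipartite : ∀ {x y} → x ∈ S → y ∈ S → x ≢ c → y ≢ c → adj G x y ≡ p x xor p y

  -- Strictness fails for the empty set because `q 1` is 0, whence the nonemptiness hypotheses.
  -- Unlike in `Bound`, the equality case takes part in the induction: `hub-adjacent` applies it to
  -- a smaller set.
  HubBound : List V → Set
  HubBound S = e S < q (suc (length S)) × (q (suc (length S)) ≤ suc (e S) → Hub S)

  SmallerHubBound : List V → Set
  SmallerHubBound S = ∀ {R} → Unique R → (∀ {x} → x ∈ R → x ∈ S) → length R < length S → 1 ≤ length R → HubBound R

  far-below : ∀ {S} → suc (e S) < q (suc (length S)) → HubBound S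
  far-below lt = <-trans (n<1+n _) lt , λ tight → ⊥-elim (<⇒≱ lt tight)

  no-K₄ : ∀ {S a b c d} → NoClique 4 S → a ∈ S → b ∈ S → c ∈ S → d ∈ S →
    a ~ b → a ~ c → a ~ d → b ~ c → b ~ d → c ~ d → ⊥
  no-K₄ no4 a∈ b∈ c∈ d∈ ab ac ad bc bd cd = no4 (_ , refl ,
    (ab ∷ ac ∷ ad ∷ []) ∷ (bc ∷ bd ∷ []) ∷ (cd ∷ []) ∷ [] ∷ [] , a∈ ∷ b∈ ∷ c∈ ∷ d∈ ∷ [])

  -- Wheels in K₄-free sets

  record Wheel (h r₁ r₂ r₃ r₄ : V) : Set where
    constructor wheel
    field
      h₁ : h ~ r₁
      h₂ : h ~ r₂
      h₃ : h ~ r₃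
      h₄ : h ~ r₄
      e₁₂ : r₁ ~ r₂
      e₂₃ : r₂ ~ r₃
      e₃₄ : r₃ ~ r₄
      e₄₁ : r₄ ~ r₁

  rotate : ∀ {h r₁ r₂ r₃ r₄} → Wheel h r₁ r₂ r₃ r₄ → Wheel h r₂ r₃ r₄ r₁
  rotate (wheel h₁ h₂ h₃ h₄ e₁₂ e₂₃ e₃₄ e₄₁) = wheel h₂ h₃ h₄ h₁ e₂₃ e₃₄ e₄₁ e₁₂

  rotate-↭ : ∀ {S R : List V} {h r₁ r₂ r₃ r₄} → S ↭ h ∷ r₁ ∷ r₂ ∷ r₃ ∷ r₄ ∷ R → S ↭ h ∷ r₂ ∷ r₃ ∷ r₄ ∷ r₁ ∷ R
  rotate-↭ {R = R} {r₁ = r₁} {r₂} {r₃} {r₄} S↭ =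
    ↭-trans S↭ (prep _ (↭-sym (shift r₁ (r₂ ∷ r₃ ∷ r₄ ∷ []) R)))

  -- The squared path would be w r₁ r₂ h r₃ r₄.
  no-chord : ∀ {w h r₁ r₂ r₃ r₄} → Wheel h r₁ r₂ r₃ r₄ → r₁ ≢ r₃ → r₂ ≢ r₄ →
    w ≢ h → w ≢ r₃ → w ≢ r₄ → ¬ (w ~ r₁ × w ~ r₂)
  no-chord (wheel h₁ h₂ h₃ h₄ e₁₂ e₂₃ e₃₄ e₄₁) r₁≢r₃ r₂≢r₄ w≢h w≢r₃ w≢r₄ (w₁ , w₂) =
    square w≢h w≢r₃ w≢r₄ r₁≢r₃ (λ eq → ~⇒≢ e₄₁ (sym eq)) r₂≢r₄
      w₁ w₂ e₁₂ (~-sym h₁) (~-sym h₂) e₂₃ h₃ h₄ e₃₄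

  module InWheel {S : List V} {h : V} (uS : Unique S) (no4 : NoClique 4 S) (ih : SmallerHubBound S) where

    module _ {r₁ r₂ r₃ r₄ : V} {R : List V} (S↭ : S ↭ h ∷ r₁ ∷ r₂ ∷ r₃ ∷ r₄ ∷ R) (W : Wheel h r₁ r₂ r₃ r₄) where
      open Wheel W
      private
        K hK : List V
        K = r₁ ∷ r₂ ∷ r₃ ∷ r₄ ∷ []
        hK = h ∷ K

        uhK : Unique (hK ++ R)
        uhK = unique-↭ S↭ uS

        S↭K : S ↭ K ++ (h ∷ R)
        S↭K = ↭-trans S↭ (↭-sym (shift h K R))

        uhR : Unique (h ∷ R)
        uhR = unique-++ʳ K (unique-↭ S↭K uS)

        h∈ : h ∈ S
        h∈ = ∈-prefix hK S↭ (here refl)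
        r₁∈ : r₁ ∈ S
        r₁∈ = ∈-prefix hK S↭ (there (here refl))
        r₂∈ : r₂ ∈ S
        r₂∈ = ∈-prefix hK S↭ (there (there (here refl)))
        r₃∈ : r₃ ∈ S
        r₃∈ = ∈-prefix hK S↭ (there (there (there (here refl))))
        r₄∈ : r₄ ∈ S
        r₄∈ = ∈-prefix hK S↭ (there (there (there (there (here refl)))))

        r₁≢r₃ : r₁ ≢ r₃
        r₁≢r₃ = unique-head (unique-tail uhK) (there (here refl))
        r₂≢r₄ : r₂ ≢ r₄
        r₂≢r₄ = unique-head (unique-tail (unique-tail uhK)) (there (here refl))

        length-S : length S ≡ 5 + length R
        length-S = ↭-length S↭

      r₁≁r₃ : adj G r₁ r₃ ≡ false
      r₁≁r₃ = adj-false λ r₁r₃ → no-K₄ no4 h∈ r₁∈ r₂∈ r₃∈ h₁ h₂ h₃ e₁₂ r₁r₃ e₂₃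

      r₂≁r₄ : adj G r₂ r₄ ≡ false
      r₂≁r₄ = adj-false λ r₂r₄ → no-K₄ no4 h∈ r₂∈ r₃∈ r₄∈ h₂ h₃ h₄ e₂₃ r₂r₄ e₃₄

      private
        e-K : e K ≡ 4
        e-K rewrite e₁₂ | r₁≁r₃ | ~-sym e₄₁ | e₂₃ | r₂≁r₄ | e₃₄ = refl

        rim : ∀ {w} → w ∈ R → deg w K ≤ 1 ⊎ Opposite (adj G w r₁) (adj G w r₂) (adj G w r₃) (adj G w r₄)
        rim {w} w∈R = no-consecutive _ _ _ _
          (no-chord W r₁≢r₃ r₂≢r₄ w≢h w≢r₃ w≢r₄)
          (no-chord (rotate W) r₂≢r₄ (λ eq → r₁≢r₃ (sym eq)) w≢h w≢r₄ w≢r₁)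
          (no-chord (rotate (rotate W)) (λ eq → r₁≢r₃ (sym eq)) (λ eq → r₂≢r₄ (sym eq)) w≢h w≢r₁ w≢r₂)
          (no-chord (rotate (rotate (rotate W))) (λ eq → r₂≢r₄ (sym eq)) r₁≢r₃ w≢h w≢r₂ w≢r₃)
          where
          w≢ : ∀ {x} → x ∈ hK → w ≢ x
          w≢ x∈ eq = unique-++-≢ hK uhK x∈ w∈R (sym eq)
          w≢h = w≢ (here refl)
          w≢r₁ = w≢ (there (here refl))
          w≢r₂ = w≢ (there (there (here refl)))
          w≢r₃ = w≢ (there (there (there (here refl))))
          w≢r₄ = w≢ (there (there (there (there (here refl)))))

        deg-K≤2 : ∀ {w} → w ∈ R → deg w K ≤ 2
        deg-K≤2 w∈R with rim w∈R
        ... | inj₁ le = ≤-trans le (n≤1+n 1)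
        ... | inj₂ (inj₁ (a , b , c , d)) rewrite a | b | c | d = ≤-refl
        ... | inj₂ (inj₂ (a , b , c , d)) rewrite a | b | c | d = ≤-refl

        e-hR : e (h ∷ R) < q (2 + length R)
        e-hR = proj₁ (ih uhR (∈-suffix K S↭K)
          (≤-trans (m<n+m (suc (length R)) (s≤s {n = 3} z≤n)) (≤-reflexive (sym length-S))) (s≤s z≤n))

        e-S : e S ≤ 4 + (4 + cross K R + e (h ∷ R))
        e-S = begin
          e S                                        ≡⟨ e-split K (h ∷ R) S↭K ⟩
          e K + (deg h K + cross K R + e (h ∷ R))    ≤⟨ +-mono-≤ (≤-reflexive e-K) (+-monoˡ-≤ (e (h ∷ R))
                                                          (+-monoˡ-≤ (cross K R) (deg≤length h K))) ⟩
          4 + (4 + cross K R + e (h ∷ R))            ∎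
          where open ≤-Reasoning

      -- Only the rim is deleted; the hub h stays in the remainder. The rim then accounts for at
      -- most 4 + 4 + 2 |R| edges, which is exactly q (6 + |R|) - q (2 + |R|), so strictness passes
      -- from `h ∷ R` to S.
      wheel-bound : e S < q (suc (length S))
      wheel-bound = begin-strict
        e S                                  ≤⟨ e-S ⟩
        4 + (4 + cross K R + e (h ∷ R))      ≤⟨ +-monoʳ-≤ 4 (+-monoˡ-≤ _ (+-monoʳ-≤ 4 (sum-map-≤ _ 2 R deg-K≤2))) ⟩
        4 + (4 + 2 * length R + e (h ∷ R))   <⟨ +-monoʳ-< 4 (+-monoʳ-< (4 + 2 * length R) e-hR) ⟩
        4 + (4 + 2 * length R + q (2 + length R)) ≡⟨ shuffle (length R) (q (2 + length R)) ⟩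
        q (6 + length R)                     ≡⟨ cong (λ k → q (suc k)) (sym length-S) ⟩
        q (suc (length S))                   ∎
        where
        open ≤-Reasoning
        shuffle : ∀ m x → 4 + (4 + 2 * m + x) ≡ x + (3 + m) + (5 + m)
        shuffle = solve-∀

      wheel-opposite : q (suc (length S)) ≤ suc (e S) → ∀ {w} → w ∈ R →
        Opposite (adj G w r₁) (adj G w r₂) (adj G w r₃) (adj G w r₄)
      wheel-opposite tight {w} w∈R with rim w∈R
      ... | inj₂ opp = opp
      ... | inj₁ le  = ⊥-elim (<⇒≱ (s≤s le) (sum-map-tight _ 2 R deg-K≤2 2m≤ w∈R))
        where
        open ≤-Reasoning
        shuffle : ∀ m x → 2 * m + (8 + x) ≡ x + (3 + m) + (5 + m)
        shuffle = solve-∀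
        unshuffle : ∀ c x → suc (4 + (4 + c + x)) ≡ c + (8 + suc x)
        unshuffle = solve-∀
        2m≤ : 2 * length R ≤ cross K R
        2m≤ = +-cancelʳ-≤ (8 + q (2 + length R)) _ _ (begin
          2 * length R + (8 + q (2 + length R))    ≡⟨ shuffle (length R) _ ⟩
          q (6 + length R)                         ≡⟨ cong (λ k → q (suc k)) (sym length-S) ⟩
          q (suc (length S))                       ≤⟨ tight ⟩
          suc (e S)                                ≤⟨ s≤s e-S ⟩
          suc (4 + (4 + cross K R + e (h ∷ R)))    ≡⟨ unshuffle (cross K R) (e (h ∷ R)) ⟩
          cross K R + (8 + suc (e (h ∷ R)))        ≤⟨ +-monoʳ-≤ (cross K R) (+-monoʳ-≤ 8 e-hR) ⟩
          cross K R + (8 + q (2 + length R))       ∎)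

      -- In the tight case adjacency to r₂ two-colours everything except h: r₄ is a twin of r₂ and
      -- r₁ is its complement. Changing the wheel transports this to all other vertices.
      wheel-rows : q (suc (length S)) ≤ suc (e S) → ∀ {y} → y ∈ S → y ≢ h →
        adj G r₄ y ≡ adj G r₂ y × adj G r₁ y ≡ not (adj G r₂ y)
      wheel-rows tight {y} y∈S y≢h with ∈-++⁻ hK (∈-resp-↭ S↭ y∈S)
      ... | inj₁ (here eq) = ⊥-elim (y≢h eq)
      ... | inj₁ (there (here refl)) rewrite e₄₁ | ~-sym e₁₂ | irrefl G r₁ = refl , refl
      ... | inj₁ (there (there (here refl))) rewrite symm G r₄ r₂ | r₂≁r₄ | e₁₂ | irrefl G r₂ = refl , refl
      ... | inj₁ (there (there (there (here refl)))) rewrite ~-sym e₃₄ | e₂₃ | r₁≁r₃ = refl , refl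
      ... | inj₁ (there (there (there (there (here refl))))) rewrite irrefl G r₄ | r₂≁r₄ | ~-sym e₄₁ = refl , refl
      ... | inj₂ y∈R rewrite symm G r₄ y | symm G r₂ y | symm G r₁ y with wheel-opposite tight y∈R
      ...   | inj₁ (a , b , _ , d) rewrite a | b | d = refl , refl
      ...   | inj₂ (a , b , _ , d) rewrite a | b | d = refl , refl

      -- S ∖ {r₁ , r₂} is again tight, so it has a hub: h itself or, in degenerate cases, r₃ or r₄.
      hub-adjacent : q (suc (length S)) ≤ suc (e S) → ∀ {w} → w ∈ R → h ~ w
      hub-adjacent tight {w} w∈R = through (p hub) (universal hub) (bipartite hub) (c∈S hub)
        where
        open ≤-Reasoning
        open Hub
        E S′ : List V
        E = r₁ ∷ r₂ ∷ []
        S′ = h ∷ r₃ ∷ r₄ ∷ R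

        S↭E : S ↭ E ++ S′
        S↭E = ↭-trans S↭ (↭-sym (shift h E (r₃ ∷ r₄ ∷ R)))

        shuffle : ∀ m x → x + (5 + m) ≡ 5 + (m + x)
        shuffle = solve-∀

        regroup : ∀ m x → 1 + (2 + (1 + (1 + m)) + x) ≡ 5 + m + x
        regroup = solve-∀

        deg-E : ∀ {x} → x ∈ R → deg x E ≤ 1
        deg-E x∈R with wheel-opposite tight x∈R
        ... | inj₁ (a , b , _) rewrite a | b = ≤-refl
        ... | inj₂ (a , b , _) rewrite a | b = ≤-refl

        deg-r₃ : deg r₃ E ≤ 1
        deg-r₃ rewrite symm G r₃ r₁ | r₁≁r₃ | ~-sym e₂₃ = ≤-refl

        deg-r₄ : deg r₄ E ≤ 1
        deg-r₄ rewrite symm G r₄ r₂ | r₂≁r₄ | e₄₁ = ≤-refl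

        -- The deleted edge r₁ r₂ accounts for at most 1 + 2 + 1 + 1 + |R| edges, which is q (6 +
        -- |R|) - q (4 + |R|). This is why tightness is inherited.
        e-S′ : e S ≤ 5 + length R + e S′
        e-S′ = begin
          e S                                        ≡⟨ e-split E S′ S↭E ⟩
          e E + (deg h E + (deg r₃ E + (deg r₄ E + cross E R)) + e S′)
            ≤⟨ +-mono-≤ (e≤tri E) (+-monoˡ-≤ (e S′) (+-mono-≤ (deg≤length h E)
                 (+-mono-≤ deg-r₃ (+-mono-≤ deg-r₄
                   (≤-trans (sum-map-≤ _ 1 R deg-E) (≤-reflexive (*-identityˡ _))))))) ⟩
          1 + (2 + (1 + (1 + length R)) + e S′)      ≡⟨ regroup (length R) (e S′) ⟩
          5 + length R + e S′                        ∎

        tight′ : q (suc (length S′)) ≤ suc (e S′)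
        tight′ = +-cancelʳ-≤ (5 + length R) _ _ (begin
          q (6 + length R)                  ≡⟨ cong (λ k → q (suc k)) (sym length-S) ⟩
          q (suc (length S))                ≤⟨ tight ⟩
          suc (e S)                         ≤⟨ s≤s e-S′ ⟩
          suc (5 + length R + e S′)         ≡⟨ cong suc (+-comm (5 + length R) (e S′)) ⟩
          suc (e S′) + (5 + length R)       ∎)

        hub : Hub S′
        hub = proj₂ (ih (unique-++ʳ E (unique-↭ S↭E uS)) (∈-suffix E S↭E)
          (≤-trans (m<n+m _ (s≤s {n = 1} z≤n)) (≤-reflexive (sym length-S))) (s≤s z≤n)) tight′

        u′ : Unique S′
        u′ = unique-++ʳ E (unique-↭ S↭E uS)

        h∈′ : h ∈ S′
        h∈′ = here refl
        r₃∈′ : r₃ ∈ S′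
        r₃∈′ = there (here refl)
        r₄∈′ : r₄ ∈ S′
        r₄∈′ = there (there (here refl))
        w∈′ : w ∈ S′
        w∈′ = there (there (there w∈R))

        w≢r₃ : w ≢ r₃
        w≢r₃ eq = unique-head (unique-tail u′) (there w∈R) (sym eq)
        w≢r₄ : w ≢ r₄
        w≢r₄ eq = unique-head (unique-tail (unique-tail u′)) w∈R (sym eq)

        -- If the hub of the smaller set is r₃, then w sees r₃ and misses r₄, so it lies on the side
        -- of r₄, opposite to h. The case r₄ is symmetric. A hub in R is impossible, since it would
        -- miss r₃ or r₄.
        through : ∀ {c} (p : V → Bool) → (∀ {x} → x ∈ S′ → x ≢ c → c ~ x) →
          (∀ {x y} → x ∈ S′ → y ∈ S′ → x ≢ c → y ≢ c → adj G x y ≡ p x xor p y) → c ∈ S′ → h ~ w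
        through p univ bip (here refl) = univ w∈′ (λ eq → unique-head u′ (there (there w∈R)) (sym eq))
        through p univ bip (there (here refl)) with wheel-opposite tight w∈R
        ... | inj₁ (_ , _ , _ , w≁r₄) = xor-shift (p h) (p r₄) (p w)
                h₄ (bip h∈′ r₄∈′ (~⇒≢ h₃) (~⇒≢ (~-sym e₃₄)))
                (≡.trans (symm G r₄ w) w≁r₄) (bip r₄∈′ w∈′ (~⇒≢ (~-sym e₃₄)) w≢r₃)
                (bip h∈′ w∈′ (~⇒≢ h₃) w≢r₃)
        ... | inj₂ (_ , _ , w≁r₃ , _) = ⊥-elim (not-both (~-sym (univ w∈′ w≢r₃)) w≁r₃)
        through p univ bip (there (there (here refl))) with wheel-opposite tight w∈R
        ... | inj₂ (_ , _ , w≁r₃ , _) = xor-shift (p h) (p r₃) (p w)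
                h₃ (bip h∈′ r₃∈′ (~⇒≢ h₄) (~⇒≢ e₃₄))
                (≡.trans (symm G r₃ w) w≁r₃) (bip r₃∈′ w∈′ (~⇒≢ e₃₄) w≢r₄)
                (bip h∈′ w∈′ (~⇒≢ h₄) w≢r₄)
        ... | inj₁ (_ , _ , _ , w≁r₄) = ⊥-elim (not-both (~-sym (univ w∈′ w≢r₄)) w≁r₄)
        through p univ bip (there (there (there c∈R))) with wheel-opposite tight c∈R
        ... | inj₁ (_ , _ , _ , c≁r₄) = ⊥-elim (not-both (univ r₄∈′ (unique-head (unique-tail (unique-tail u′)) c∈R)) c≁r₄)
        ... | inj₂ (_ , _ , c≁r₃ , _) = ⊥-elim (not-both (univ r₃∈′ (unique-head (unique-tail u′) (there c∈R))) c≁r₃)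

    wheel-hub : ∀ {r₁ r₂ r₃ r₄ R} → S ↭ h ∷ r₁ ∷ r₂ ∷ r₃ ∷ r₄ ∷ R → Wheel h r₁ r₂ r₃ r₄ → HubBound S
    wheel-hub {r₁} {r₂} {r₃} {r₄} {R} S↭ W = wheel-bound S↭ W , λ tight → record
      { c = h ; c∈S = ∈-prefix hK S↭ (here refl) ; p = adj G r₂
      ; universal = λ x∈ x≢h → hub-row tight x∈ x≢h
      ; bipartite = λ x∈ y∈ x≢h y≢h → row tight x∈ x≢h y∈ y≢h }
      where
      open Wheel W
      hK = h ∷ r₁ ∷ r₂ ∷ r₃ ∷ r₄ ∷ []

      hub-row : q (suc (length S)) ≤ suc (e S) → ∀ {x} → x ∈ S → x ≢ h → h ~ x
      hub-row tight x∈ x≢h with ∈-++⁻ hK (∈-resp-↭ S↭ x∈)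
      ... | inj₁ (here eq) = ⊥-elim (x≢h eq)
      ... | inj₁ (there (here refl)) = h₁
      ... | inj₁ (there (there (here refl))) = h₂
      ... | inj₁ (there (there (there (here refl)))) = h₃
      ... | inj₁ (there (there (there (there (here refl))))) = h₄
      ... | inj₂ x∈R = hub-adjacent S↭ W tight x∈R

      -- A vertex x of R sees h and one diagonal pair of the rim, hence can replace r₄ or r₁ there.
      -- `wheel-rows` for the new wheel is then the row of x.
      row : q (suc (length S)) ≤ suc (e S) → ∀ {x y} → x ∈ S → x ≢ h → y ∈ S → y ≢ h →
        adj G x y ≡ adj G r₂ x xor adj G r₂ y
      row tight {x} {y} x∈ x≢h y∈ y≢h with ∈-++⁻ hK (∈-resp-↭ S↭ x∈)
      ... | inj₁ (here eq) = ⊥-elim (x≢h eq)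
      ... | inj₁ (there (here refl)) rewrite ~-sym e₁₂ = proj₂ (wheel-rows S↭ W tight y∈ y≢h)
      ... | inj₁ (there (there (here refl))) rewrite irrefl G r₂ = refl
      ... | inj₁ (there (there (there (here refl)))) rewrite e₂₃ = ≡.trans
              (sym (proj₁ (wheel-rows (rotate-↭ S↭) (rotate W) tight y∈ y≢h)))
              (proj₂ (wheel-rows S↭ W tight y∈ y≢h))
      ... | inj₁ (there (there (there (there (here refl))))) rewrite r₂≁r₄ S↭ W =
              proj₁ (wheel-rows S↭ W tight y∈ y≢h)
      ... | inj₂ x∈R with wheel-opposite S↭ W tight x∈R | extract₁ x∈R
      ...   | inj₁ (x₁ , x≁r₂ , x₃ , _) | R′ , R↭ rewrite ≡.trans (symm G r₂ x) x≁r₂ = proj₁ (wheel-rows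
                (↭-trans S↭ (++⁺ˡ (h ∷ r₁ ∷ r₂ ∷ r₃ ∷ []) (↭-trans (prep r₄ R↭) (swap r₄ x refl))))
                (wheel h₁ h₂ h₃ (hub-adjacent S↭ W tight x∈R) e₁₂ e₂₃ (~-sym x₃) x₁) tight y∈ y≢h)
      ...   | inj₂ (_ , x₂ , _ , x₄) | R′ , R↭ rewrite ~-sym x₂ = proj₂ (wheel-rows
                (↭-trans S↭ (↭-trans (++⁺ˡ hK R↭) (prep h (↭-trans (shift x (r₁ ∷ r₂ ∷ r₃ ∷ r₄ ∷ []) R′)
                  (prep x (↭-sym (shift r₁ (r₂ ∷ r₃ ∷ r₄ ∷ []) R′)))))))
                (wheel (hub-adjacent S↭ W tight x∈R) h₂ h₃ h₄ x₂ e₂₃ e₃₄ (~-sym x₄)) tight y∈ y≢h)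

  ∈-pair : ∀ {S : List V} {a b} → S ↭ a ∷ b ∷ [] → ∀ {x} → x ∈ S → x ≢ a → x ≡ b
  ∈-pair S↭ x∈ x≢a with ∈-resp-↭ S↭ x∈
  ... | here eq         = ⊥-elim (x≢a eq)
  ... | there (here eq) = eq

  -- Deletion needs a nonempty remainder, since the inductive bound fails for the empty set. A
  -- vertex, an edge, a triangle or a diamond standing alone is therefore a base case; each of them
  -- is tight and has a hub.
  K₄-free-step : ∀ {S} → Unique S → 1 ≤ length S → NoClique 4 S → SmallerHubBound S → HubBound S
  K₄-free-step {S} uS nonempty no4 ih = edge?
    where
    -- The remainder already stays one below q, and `room` asks for one more, so sets treated by
    -- this deletion are never tight.
    below : ∀ K {R k} m → 1 ≤ length K → S ↭ K ++ R → length R ≡ suc m → (∀ {w} → w ∈ R → deg w K ≤ k) →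
      e K + (k * suc m + q (2 + m)) < q (suc (length K + suc m)) → HubBound S
    below K {R} {k} m K≥1 S↭ lenR deg≤ room = far-below (begin-strict
        suc (e S)                            ≡⟨ cong suc (e-split K R S↭) ⟩
        suc (e K + (cross K R + e R))        ≡⟨ bump (e K) (cross K R) (e R) ⟩
        e K + (cross K R + suc (e R))        ≤⟨ +-monoʳ-≤ (e K) (+-mono-≤ (sum-map-≤ _ k R deg≤) e-R) ⟩
        e K + (k * length R + q (suc (length R))) ≡⟨ cong (λ l → e K + (k * l + q (suc l))) lenR ⟩
        e K + (k * suc m + q (2 + m))        <⟨ room ⟩
        q (suc (length K + suc m))           ≡⟨ cong (λ l → q (suc l)) (sym (≡.trans (length-split K S↭) (cong (length K +_) lenR))) ⟩
        q (suc (length S))                   ∎)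
      where
      open ≤-Reasoning
      bump : ∀ a b c → suc (a + (b + c)) ≡ a + (b + suc c)
      bump = solve-∀
      e-R : e R < q (suc (length R))
      e-R = proj₁ (ih (unique-++ʳ K (unique-↭ S↭ uS)) (∈-suffix K S↭)
        (≤-trans (+-monoˡ-≤ (length R) K≥1) (≤-reflexive (sym (length-split K S↭))))
        (≤-trans (s≤s z≤n) (≤-reflexive (sym lenR))))

    diamond : ∀ {a b c d R} → S ↭ a ∷ b ∷ c ∷ d ∷ R → a ~ b → a ~ c → a ~ d → b ~ c → b ~ d → HubBound S
    diamond {a} {b} {c} {d} {R} S↭ ab ac ad bc bd with any? (λ w → 3 ≤? deg w (a ∷ b ∷ c ∷ d ∷ [])) R
    ... | yes found with find found
    ...   | w , w∈R , three with three-of-four _ _ _ _ three | extract₁ w∈R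
    ...     | inj₁ (wa , wb , wc) | _ = ⊥-elim (no-K₄ no4 (∈-suffix K S↭ w∈R)
              (∈-prefix K S↭ (here refl)) (∈-prefix K S↭ (there (here refl)))
              (∈-prefix K S↭ (there (there (here refl)))) wa wb wc ab ac bc)
              where K = a ∷ b ∷ c ∷ d ∷ []
    ...     | inj₂ (inj₁ (wa , wb , wd)) | _ = ⊥-elim (no-K₄ no4 (∈-suffix K S↭ w∈R)
              (∈-prefix K S↭ (here refl)) (∈-prefix K S↭ (there (here refl)))
              (∈-prefix K S↭ (there (there (there (here refl))))) wa wb wd ab ad bd)
              where K = a ∷ b ∷ c ∷ d ∷ []
    -- The rim is b c w d around a, and in the next case a c w d around b.
    ...     | inj₂ (inj₂ (inj₁ (wa , wc , wd))) | R′ , R↭ = InWheel.wheel-hub uS no4 ih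
              (↭-trans S↭ (↭-trans (++⁺ˡ (a ∷ b ∷ c ∷ d ∷ []) R↭) (++⁺ˡ (a ∷ b ∷ c ∷ []) (swap d w refl))))
              (wheel ab ac (~-sym wa) ad bc (~-sym wc) wd (~-sym bd))
    ...     | inj₂ (inj₂ (inj₂ (wb , wc , wd))) | R′ , R↭ = InWheel.wheel-hub uS no4 ih
              (↭-trans S↭ (↭-trans (swap a b refl) (↭-trans (++⁺ˡ (b ∷ a ∷ c ∷ d ∷ []) R↭) (++⁺ˡ (b ∷ a ∷ c ∷ []) (swap d w refl)))))
              (wheel (~-sym ab) bc (~-sym wb) bd ac (~-sym wc) wd (~-sym ad))
    diamond {a} {b} {c} {d} {R} S↭ ab ac ad bc bd | no none = count R refl
      where
      K : List V
      K = a ∷ b ∷ c ∷ d ∷ []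

      c≁d : adj G c d ≡ false
      c≁d = adj-false (no-K₄ no4 (∈-prefix K S↭ (here refl)) (∈-prefix K S↭ (there (here refl)))
        (∈-prefix K S↭ (there (there (here refl)))) (∈-prefix K S↭ (there (there (there (here refl)))))
        ab ac ad bc bd)

      e-K : e K ≡ 5
      e-K rewrite ab | ac | ad | bc | bd | c≁d = refl

      deg≤2 : ∀ {w} → w ∈ R → deg w K ≤ 2
      deg≤2 w∈R = ≤-pred (≰⇒> (λ three → none (lose w∈R three)))

      count : ∀ R′ → R ≡ R′ → HubBound S
      count (_ ∷ R′) refl = below K m (s≤s z≤n) S↭ refl deg≤2 (begin-strict
        e K + (2 * suc m + q (2 + m))    ≡⟨ cong (_+ (2 * suc m + q (2 + m))) e-K ⟩
        5 + (2 * suc m + q (2 + m))      <⟨ ≤-reflexive (shuffle m (q (2 + m))) ⟩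
        q (6 + m)                        ∎)
        where
        open ≤-Reasoning
        m = length R′
        shuffle : ∀ m x → 6 + (2 * suc m + x) ≡ x + (3 + m) + (5 + m)
        shuffle = solve-∀
      count [] refl = subst₂ _<_ (sym e-S) (sym size) (n<1+n 5) , λ _ → record
        { c = a ; c∈S = ∈-prefix K S↭ (here refl) ; p = adj G b
        ; universal = λ x∈ x≢a → universal (∈-resp-↭ S↭ x∈) x≢a
        ; bipartite = λ x∈ y∈ x≢a y≢a → bipartite (∈-resp-↭ S↭ x∈) (∈-resp-↭ S↭ y∈) x≢a y≢a }
        where
        e-S : e S ≡ 5
        e-S = ≡.trans (e-↭ S↭) e-K
        size : q (suc (length S)) ≡ 6
        size = cong (λ l → q (suc l)) (↭-length S↭)
        universal : ∀ {x} → x ∈ K → x ≢ a → a ~ x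
        universal (here eq) x≢a = ⊥-elim (x≢a eq)
        universal (there (here refl)) _ = ab
        universal (there (there (here refl))) _ = ac
        universal (there (there (there (here refl)))) _ = ad
        bipartite : ∀ {x y} → x ∈ K → y ∈ K → x ≢ a → y ≢ a → adj G x y ≡ adj G b x xor adj G b y
        bipartite (here eq) _ x≢a _ = ⊥-elim (x≢a eq)
        bipartite (there _) (here eq) _ y≢a = ⊥-elim (y≢a eq)
        bipartite (there (here refl)) (there (here refl)) _ _ rewrite irrefl G b = refl
        bipartite (there (here refl)) (there (there (here refl))) _ _ rewrite irrefl G b = refl
        bipartite (there (here refl)) (there (there (there (here refl)))) _ _ rewrite irrefl G b = refl
        bipartite (there (there (here refl))) (there (here refl)) _ _ rewrite ~-sym bc | bc | irrefl G b = refl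
        bipartite (there (there (here refl))) (there (there (here refl))) _ _ rewrite bc | irrefl G c = refl
        bipartite (there (there (here refl))) (there (there (there (here refl)))) _ _ rewrite c≁d | bc | bd = refl
        bipartite (there (there (there (here refl)))) (there (here refl)) _ _ rewrite ~-sym bd | bd | irrefl G b = refl
        bipartite (there (there (there (here refl)))) (there (there (here refl))) _ _ rewrite symm G d c | c≁d | bc | bd = refl
        bipartite (there (there (there (here refl)))) (there (there (there (here refl)))) _ _ rewrite irrefl G d | bd = refl

    triangle : ∀ {a b c R} → S ↭ a ∷ b ∷ c ∷ R → a ~ b → a ~ c → b ~ c → HubBound S
    triangle {a} {b} {c} {R} S↭ ab ac bc with any? (λ w → 2 ≤? deg w (a ∷ b ∷ c ∷ [])) R
    ... | yes found with find found
    ...   | w , w∈R , two with front w 2 1 (a ∷ b ∷ c ∷ []) refl two | extract₁ w∈R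
    ...     | x ∷ y ∷ [] , z ∷ [] , wx ∷ wy ∷ [] , T↭ | R′ , R↭
        with clique-↭ T↭ ((ab ∷ ac ∷ []) ∷ (bc ∷ []) ∷ [] ∷ [])
    ...       | (xy ∷ xz ∷ []) ∷ (yz ∷ []) ∷ [] ∷ [] = diamond
              (↭-trans S↭ (↭-trans (++⁺ʳ R T↭) (++⁺ˡ (x ∷ y ∷ z ∷ []) R↭)))
              xy xz (~-sym wx) yz (~-sym wy)
    triangle {a} {b} {c} {R} S↭ ab ac bc | no none = count R refl
      where
      T : List V
      T = a ∷ b ∷ c ∷ []
      e-T : e T ≡ 3
      e-T rewrite ab | ac | bc = refl
      count : ∀ R′ → R ≡ R′ → HubBound S
      count (_ ∷ R′) refl = below T m (s≤s z≤n) S↭ refl (λ w∈R → ≤-pred (≰⇒> (λ two → none (lose w∈R two)))) (begin-strict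
        e T + (1 * suc m + q (2 + m))    ≡⟨ cong (_+ (1 * suc m + q (2 + m))) e-T ⟩
        3 + (1 * suc m + q (2 + m))      ≡⟨ shuffle m (q (2 + m)) ⟩
        q (2 + m) + (4 + m)              <⟨ +-monoˡ-< (4 + m) (q-increasing m) ⟩
        q (5 + m)                        ∎)
        where
        open ≤-Reasoning
        m = length R′
        shuffle : ∀ m x → 3 + (1 * suc m + x) ≡ x + (4 + m)
        shuffle = solve-∀
        q-increasing : ∀ m → q (2 + m) < q (3 + m)
        q-increasing m = +-mono-≤-< (q-mono m) (n<1+n (suc m))
      count [] refl = subst₂ _<_ (sym (≡.trans (e-↭ S↭) e-T)) (sym size) (n<1+n 3) , λ _ → record
        { c = a ; c∈S = ∈-prefix T S↭ (here refl) ; p = adj G b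
        ; universal = λ x∈ x≢a → universal (∈-resp-↭ S↭ x∈) x≢a
        ; bipartite = λ x∈ y∈ x≢a y≢a → bipartite (∈-resp-↭ S↭ x∈) (∈-resp-↭ S↭ y∈) x≢a y≢a }
        where
        size : q (suc (length S)) ≡ 4
        size = cong (λ l → q (suc l)) (↭-length S↭)
        universal : ∀ {x} → x ∈ T → x ≢ a → a ~ x
        universal (here eq) x≢a = ⊥-elim (x≢a eq)
        universal (there (here refl)) _ = ab
        universal (there (there (here refl))) _ = ac
        bipartite : ∀ {x y} → x ∈ T → y ∈ T → x ≢ a → y ≢ a → adj G x y ≡ adj G b x xor adj G b y
        bipartite (here eq) _ x≢a _ = ⊥-elim (x≢a eq)
        bipartite (there _) (here eq) _ y≢a = ⊥-elim (y≢a eq)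
        bipartite (there (here refl)) (there (here refl)) _ _ rewrite irrefl G b = refl
        bipartite (there (here refl)) (there (there (here refl))) _ _ rewrite irrefl G b = refl
        bipartite (there (there (here refl))) (there (here refl)) _ _ rewrite ~-sym bc | bc | irrefl G b = refl
        bipartite (there (there (here refl))) (there (there (here refl))) _ _ rewrite bc | irrefl G c = refl

    triangle? : ∀ {a b R} → S ↭ a ∷ b ∷ R → a ~ b → HubBound S
    triangle? {a} {b} {R} S↭ ab with any? (λ w → 2 ≤? deg w (a ∷ b ∷ [])) R
    ... | yes found with find found
    ...   | w , w∈R , two with all-neighbours w (a ∷ b ∷ []) two | extract₁ w∈R
    ...     | wa ∷ wb ∷ [] | R′ , R↭ = triangle (↭-trans S↭ (++⁺ˡ (a ∷ b ∷ []) R↭)) ab (~-sym wa) (~-sym wb)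
    triangle? {a} {b} {R} S↭ ab | no none = count R refl
      where
      E : List V
      E = a ∷ b ∷ []
      e-E : e E ≡ 1
      e-E rewrite ab = refl
      count : ∀ R′ → R ≡ R′ → HubBound S
      count (_ ∷ R′) refl = below E m (s≤s z≤n) S↭ refl (λ w∈R → ≤-pred (≰⇒> (λ two → none (lose w∈R two)))) (begin-strict
        e E + (1 * suc m + q (2 + m))    ≡⟨ cong (_+ (1 * suc m + q (2 + m))) e-E ⟩
        1 + (1 * suc m + q (2 + m))      <⟨ ≤-reflexive (shuffle m (q (2 + m))) ⟩
        q (4 + m)                        ∎)
        where
        open ≤-Reasoning
        m = length R′
        shuffle : ∀ m x → 2 + (1 * suc m + x) ≡ x + (3 + m)
        shuffle = solve-∀
      count [] refl = subst₂ _<_ (sym (≡.trans (e-↭ S↭) e-E)) (sym size) (n<1+n 1) , λ _ → record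
        { c = a ; c∈S = ∈-prefix E S↭ (here refl) ; p = λ _ → false
        ; universal = λ x∈ x≢a → subst (a ~_) (sym (∈-pair S↭ x∈ x≢a)) ab
        ; bipartite = λ x∈ y∈ x≢a y≢a → ≡.trans
            (cong₂ (adj G) (∈-pair S↭ x∈ x≢a) (∈-pair S↭ y∈ y≢a)) (irrefl G b) }
        where
        size : q (suc (length S)) ≡ 2
        size = cong (λ l → q (suc l)) (↭-length S↭)

    edge? : HubBound S
    edge? with clique? 2 S
    ... | yes (a ∷ b ∷ [] , refl , cl@((ab ∷ []) ∷ [] ∷ []) , E⊆S) =
      let R , S↭ = extract (clique-unique cl) E⊆S in triangle? S↭ ab
    ... | no none = count S nonempty refl
      where
      e-S : e S ≡ 0
      e-S = edgeless S λ x∈ y∈ → adj-false λ xy →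
        none (_ ∷ _ ∷ [] , refl , (xy ∷ []) ∷ [] ∷ [] , x∈ ∷ y∈ ∷ [])
      count : ∀ S′ → 1 ≤ length S′ → S ≡ S′ → HubBound S
      count (a ∷ []) _ refl = s≤s z≤n , λ _ → record
        { c = a ; c∈S = here refl ; p = λ _ → false
        ; universal = λ { (here eq) x≢a → ⊥-elim (x≢a eq) }
        ; bipartite = λ { (here eq) _ x≢a _ → ⊥-elim (x≢a eq) } }
      count (a ∷ b ∷ S′) _ refl = far-below (≤-trans (s≤s (s≤s (≤-reflexive e-S)))
        (≤-trans (s≤s (s≤s z≤n)) (m≤n+m _ (q (suc (length S′))))))

  K₄-free-bound : ∀ k {S} → length S ≤ k → Unique S → 1 ≤ length S → NoClique 4 S → HubBound S
  K₄-free-bound zero    len≤ uS nonempty no4 = ⊥-elim (<⇒≱ nonempty len≤)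
  K₄-free-bound (suc k) len≤ uS nonempty no4 = K₄-free-step uS nonempty no4
    λ uR R⊆S lt nonempty′ → K₄-free-bound k (≤-pred (≤-trans lt len≤)) uR nonempty′
      λ (K , len , cl , K⊆R) → no4 (K , len , cl , All.map R⊆S K⊆R)

  -- The hub c is put into X together with one colour class, so every edge inside X contains c. A P₄
  -- has two disjoint edges.
  hub⇒join : ∀ {S} → Hub S → Join S
  hub⇒join {S} hub = record
    { p = side ; Y-indep = indep ; XY-joined = joined ; X-P₄-free = P₄-free }
    where
    open Hub hub
    side : V → Bool
    side x with x ≟ c
    ... | yes _ = false
    ... | no  _ = p x

    indep : ∀ {x y} → x ∈ S → y ∈ S → side x ≡ true → side y ≡ true → adj G x y ≡ false
    indep {x} {y} x∈ y∈ px py with x ≟ c | y ≟ c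
    indep x∈ y∈ () py | yes _ | _
    indep x∈ y∈ px () | no _  | yes _
    indep x∈ y∈ px py | no x≢c | no y≢c rewrite bipartite x∈ y∈ x≢c y≢c | px | py = refl

    joined : ∀ {x y} → x ∈ S → y ∈ S → side x ≡ true → side y ≡ false → x ~ y
    joined {x} {y} x∈ y∈ px py with x ≟ c | y ≟ c
    joined x∈ y∈ () py | yes _ | _
    joined x∈ y∈ px py | no x≢c | yes refl = ~-sym (universal x∈ x≢c)
    joined x∈ y∈ px py | no x≢c | no y≢c rewrite bipartite x∈ y∈ x≢c y≢c | px | py = refl

    touches-c : ∀ {x y} → x ∈ S → y ∈ S → side x ≡ false → side y ≡ false → x ~ y → x ≡ c ⊎ y ≡ c
    touches-c {x} {y} x∈ y∈ px py xy with x ≟ c | y ≟ c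
    ... | yes x≡c | _ = inj₁ x≡c
    ... | no _ | yes y≡c = inj₂ y≡c
    ... | no x≢c | no y≢c = ⊥-elim (not-both xy (≡.trans (bipartite x∈ y∈ x≢c y≢c) (cong₂ _xor_ px py)))

    P₄-free : ∀ {x y z t} → x ∈ S → y ∈ S → z ∈ S → t ∈ S →
      side x ≡ false → side y ≡ false → side z ≡ false → side t ≡ false →
      x ≢ z → x ≢ t → y ≢ t → x ~ y → y ~ z → z ~ t → ⊥
    P₄-free x∈ y∈ z∈ t∈ px py pz pt x≢z x≢t y≢t xy yz zt
      with touches-c x∈ y∈ px py xy | touches-c z∈ t∈ pz pt zt
    ... | inj₁ refl | inj₁ refl = x≢z refl
    ... | inj₁ refl | inj₂ refl = x≢t refl
    ... | inj₂ refl | inj₁ refl = ~⇒≢ yz refl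
    ... | inj₂ refl | inj₂ refl = y≢t refl

  -- The upper bound and its equality case for all vertex sets

  K₅-free-bound : ∀ k {S} → length S ≤ k → Unique S → NoClique 5 S → Bound S
  K₅-free-bound k {[]} len≤ uS no5 = z≤n , λ ()
  K₅-free-bound (suc k) {S@(_ ∷ _)} len≤ uS no5 with clique? 4 S
  ... | yes (K , lenK , clK , K⊆S) = let R , S↭ = extract (clique-unique clK) K⊆S in
    K₄-bound clK lenK uS no5 (λ uR R⊆S lt → proj₁ (K₅-free-bound k (≤-pred (≤-trans lt len≤)) uR
      λ (L , len , cl , L⊆R) → no5 (L , len , cl , All.map R⊆S L⊆R))) S↭
  ... | no no4 = let lt , tight = K₄-free-bound (length S) ≤-refl uS (s≤s z≤n) no4 in
    ≤-pred (≤-trans lt (q≤1+turán (length S))) ,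
    λ _ le → hub⇒join (tight (≤-trans (q≤1+turán (length S)) (s≤s le)))

  K₅-bound : ∀ {K S R} → Clique K → length K ≡ 5 → Unique S → 6 ≤ length S → S ↭ K ++ R →
    (∀ {R} → Unique R → length R < length S → length R ≢ 5 → e R ≤ turán (length R)) →
    e S < turán (length S)
  K₅-bound {K} {S} {R} clK lenK uS six S↭ ih = count (length R) refl
    where
    uK : Unique (K ++ R)
    uK = unique-↭ S↭ uS
    length-S : length S ≡ 5 + length R
    length-S = ≡.trans (length-split K S↭) (cong (_+ length R) lenK)

    e-S : e S ≤ 10 + (1 * length R + e R)
    e-S = ≤-trans (≤-reflexive (e-split K R S↭)) (+-mono-≤ (≤-trans (e≤tri K) (≤-reflexive (cong tri lenK)))
      (+-monoˡ-≤ (e R) (sum-map-≤ _ 1 R (K₅-attachment clK lenK uK))))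

    open ≤-Reasoning
    count : ∀ m → length R ≡ m → e S < turán (length S)
    count zero lenR = ⊥-elim (<⇒≱ six (≤-reflexive (≡.trans length-S (cong (5 +_) lenR))))
    count (suc m) lenR with length R Data.Nat.≟ 5
    -- The remainder may be another K₅, whose 10 edges exceed `turán 5`. The trivial count 10 + 5 +
    -- 10 still lies below `turán 10`, which is 30.
    ... | yes five = begin-strict
        e S                           ≤⟨ e-S ⟩
        10 + (1 * length R + e R)     ≤⟨ +-monoʳ-≤ 10 (+-monoʳ-≤ (1 * length R) (e≤tri R)) ⟩
        10 + (1 * length R + tri (length R)) ≡⟨ cong (λ k → 10 + (1 * k + tri k)) five ⟩
        25                            <⟨ m≤m+n 26 4 ⟩
        turán 10                      ≡⟨ cong turán (sym (≡.trans length-S (cong (5 +_) five))) ⟩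
        turán (length S)              ∎
    ... | no ¬five = begin-strict
        e S                           ≤⟨ e-S ⟩
        10 + (1 * length R + e R)     ≤⟨ +-monoʳ-≤ 10 (+-monoʳ-≤ (1 * length R) (ih (unique-++ʳ K uK)
                                           (≤-trans (m<n+m _ (s≤s {n = 4} z≤n)) (≤-reflexive (sym length-S))) ¬five)) ⟩
        10 + (1 * length R + turán (length R)) ≡⟨ cong (λ k → 10 + (1 * k + turán k)) lenR ⟩
        10 + (1 * suc m + turán (suc m))       ≡⟨ shuffle m (turán (suc m)) ⟩
        11 + (m + turán (suc m))      <⟨ s≤s (+-monoʳ-≤ 11 (+-monoˡ-≤ (turán (suc m)) (m≤m+n m (m + 0)))) ⟩
        12 + (2 * m + turán (suc m))  ≤⟨ turán-5 m ⟩
        turán (6 + m)                 ≡⟨ cong turán (sym (≡.trans length-S (cong (5 +_) lenR))) ⟩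
        turán (length S)              ∎
      where
      shuffle : ∀ m t → 10 + (1 * suc m + t) ≡ 11 + (m + t)
      shuffle = solve-∀

  turán-bound : ∀ k {S} → length S ≤ k → Unique S → length S ≢ 5 → Bound S
  turán-bound k {[]} len≤ uS _ = z≤n , λ ()
  turán-bound (suc k) {S@(_ ∷ _)} len≤ uS ≢5 with clique? 5 S
  ... | no no5 = K₅-free-bound (length S) ≤-refl uS no5
  ... | yes (K , lenK , clK , K⊆S) = let R , S↭ = extract (clique-unique clK) K⊆S in
    too-few (K₅-bound clK lenK uS
      (≤∧≢⇒< (≤-trans (≤-reflexive (sym lenK)) (≤-trans (m≤m+n _ _) (≤-reflexive (sym (length-split K S↭))))) λ eq → ≢5 (sym eq))
      S↭ (λ uR lt ≢5′ → proj₁ (turán-bound k (≤-pred (≤-trans lt len≤)) uR ≢5′)))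

  -- Joins of an independent class and a P₄-free class

  P₄-Free : List V → Set
  P₄-Free X = ∀ {a b c d} → a ∈ X → b ∈ X → c ∈ X → d ∈ X →
    a ≢ c → a ≢ d → b ≢ d → a ~ b → b ~ c → c ~ d → ⊥

  -- A component of X that is a star with centre c and leaves `N`; an isolated vertex is the case
  -- without leaves.
  record Star (X : List V) : Set where
    field
      c      : V
      N R    : List V
      X↭     : X ↭ c ∷ N ++ R
      c~N    : ∀ {x} → x ∈ N → c ~ x
      c≁R    : ∀ {x} → x ∈ R → adj G c x ≡ false
      N-apart : ∀ {x y} → x ∈ N → y ∈ N ++ R → adj G x y ≡ false

  star-component : ∀ {X} → P₄-Free X → NoClique 3 X → Unique X → 1 ≤ length X → Star X
  star-component {X@(v ∷ _)} P4 no3 uX _ = record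
    { c = c ; N = N ; R = R ; X↭ = ↭-trans X↭ (prep c X′↭)
    ; c~N = All.lookup cN ; c≁R = All.lookup cR
    ; N-apart = λ x∈ y∈ → adj-false λ xy → c∉ y∈
        (only-c (in-X (∈-++⁺ˡ x∈)) (All.lookup cN x∈) (in-X y∈) (~-sym xy)) }
    where
    no-triangle : ∀ {x y z} → x ∈ X → y ∈ X → z ∈ X → x ~ y → x ~ z → y ~ z → ⊥
    no-triangle x∈ y∈ z∈ xy xz yz =
      no3 (_ , refl , (xy ∷ xz ∷ []) ∷ (yz ∷ []) ∷ [] ∷ [] , x∈ ∷ y∈ ∷ z∈ ∷ [])

    centre : ∃ λ c → c ∈ X × (∀ {u} → u ∈ X → c ~ u → ∀ {w} → w ∈ X → w ~ u → w ≡ c)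
    -- If a neighbour u of v has a neighbour w other than v, then u is the centre, otherwise v is. A
    -- further edge at a leaf would give a triangle or a P₄.
    centre with any? (λ u → any? (λ w → (adj G v u ≟ᵇ true) ×-dec (adj G w u ≟ᵇ true) ×-dec ¬? (w ≟ v)) X) X
    ... | no none = v , here refl , λ {u} u∈ vu {w} w∈ wu → decided u∈ vu w∈ wu
      where
      decided : ∀ {u} → u ∈ X → v ~ u → ∀ {w} → w ∈ X → w ~ u → w ≡ v
      decided u∈ vu {w} w∈ wu with w ≟ v
      ... | yes eq = eq
      ... | no  ≢v = ⊥-elim (none (lose u∈ (lose w∈ (vu , wu , ≢v))))
    ... | yes found with find found
    ...   | u , u∈ , found′ with find found′
    ...     | w , w∈ , vu , wu , w≢v = u , u∈ , λ u′∈ uu′ w′∈ w′u′ → decided u′∈ uu′ w′∈ w′u′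
      where
      decided : ∀ {u′} → u′ ∈ X → u ~ u′ → ∀ {w′} → w′ ∈ X → w′ ~ u′ → w′ ≡ u
      decided {u′} u′∈ uu′ {w′} w′∈ w′u′ with w′ ≟ u | u′ ≟ v | w′ ≟ w | w′ ≟ v
      ... | yes eq | _ | _ | _ = eq
      ... | no ≢u | yes refl | yes refl | _ = ⊥-elim (no-triangle u′∈ u∈ w∈ vu (~-sym w′u′) (~-sym wu))
      ... | no ≢u | yes refl | no ≢w | _ = ⊥-elim (P4 w′∈ u′∈ u∈ w∈ ≢u ≢w (λ eq → w≢v (sym eq)) w′u′ vu (~-sym wu))
      ... | no ≢u | no ≢v | _ | yes refl = ⊥-elim (no-triangle w′∈ u∈ u′∈ vu w′u′ uu′)
      ... | no ≢u | no ≢v | _ | no w′≢v = ⊥-elim (P4 w′∈ u′∈ u∈ (here refl) ≢u w′≢v ≢v w′u′ (~-sym uu′) (~-sym vu))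

    c = proj₁ centre
    only-c = proj₂ (proj₂ centre)
    X′ = proj₁ (extract₁ (proj₁ (proj₂ centre)))
    X↭ : X ↭ c ∷ X′
    X↭ = proj₂ (extract₁ (proj₁ (proj₂ centre)))
    parts = split-by (adj G c) X′
    N = proj₁ parts
    R = proj₁ (proj₂ parts)
    X′↭ : X′ ↭ N ++ R
    X′↭ = proj₁ (proj₂ (proj₂ parts))
    cN = proj₁ (proj₂ (proj₂ (proj₂ parts)))
    cR = proj₂ (proj₂ (proj₂ (proj₂ parts)))

    in-X : ∀ {y} → y ∈ N ++ R → y ∈ X
    in-X = ∈-suffix (c ∷ []) (↭-trans X↭ (prep c X′↭))

    c∉ : ∀ {y} → y ∈ N ++ R → y ≢ c
    c∉ y∈ eq = unique-head (unique-↭ (↭-trans X↭ (prep c X′↭)) uX) y∈ (sym eq)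

  module _ {X : List V} (star : Star X) where
    open Star star

    star-count : e X ≡ length N + e R
    star-count = begin
      e X                                              ≡⟨ e-↭ X↭ ⟩
      deg c (N ++ R) + e (N ++ R)                      ≡⟨ cong₂ _+_ (deg-++ c N R) (e-++ N R) ⟩
      deg c N + deg c R + (e N + (cross N R + e R))    ≡⟨ cong₂ _+_ (cong₂ _+_
                                                            (≡.trans (sum-map-const _ 1 N (λ x∈ → cong ι (c~N x∈))) (*-identityˡ (length N)))
                                                            (sum-map-const _ 0 R (λ x∈ → cong ι (c≁R x∈))))
                                                            (cong₂ _+_ (edgeless N λ x∈ y∈ → N-apart x∈ (∈-++⁺ˡ y∈))
                                                            (cong (_+ e R) (sum-map-const _ 0 R λ {w} w∈ → sum-map-const _ 0 N λ {x} x∈ →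
                                                              cong ι (≡.trans (symm G w x) (N-apart x∈ (∈-++⁺ʳ N w∈)))))) ⟩
      length N + 0 + e R                               ≡⟨ cong (_+ e R) (+-identityʳ (length N)) ⟩
      length N + e R                                   ∎
      where open ≡.≡-Reasoning

    star-size : length X ≡ suc (length N + length R)
    star-size = ≡.trans (↭-length X↭) (cong suc (length-++ N))

  P₄-free-⊆ : ∀ {X R} → P₄-Free X → (∀ {x} → x ∈ R → x ∈ X) → P₄-Free R
  P₄-free-⊆ P4 R⊆X a∈ b∈ c∈ d∈ = P4 (R⊆X a∈) (R⊆X b∈) (R⊆X c∈) (R⊆X d∈)

  noClique-⊆ : ∀ {k X R} → NoClique k X → (∀ {x} → x ∈ R → x ∈ X) → NoClique k R
  noClique-⊆ none R⊆X (K , len , cl , K⊆R) = none (K , len , cl , All.map R⊆X K⊆R)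

  -- Each star has one vertex more than it has edges, and there is at least one star.
  star-forest : ∀ k {X} → length X ≤ k → P₄-Free X → NoClique 3 X → Unique X → 1 ≤ length X → e X < length X
  star-forest zero    len≤ _ _ _ nonempty = ⊥-elim (<⇒≱ nonempty len≤)
  star-forest (suc k) {X} len≤ P4 no3 uX nonempty with star-component P4 no3 uX nonempty
  ... | star = subst₂ _<_ (sym (star-count star)) (sym (star-size star)) (s≤s (+-monoʳ-≤ (length N) (rest R refl)))
    where
    open Star star
    rest : ∀ R′ → R ≡ R′ → e R ≤ length R
    rest []      eq rewrite eq = z≤n
    rest (_ ∷ _) eq = <⇒≤ (star-forest k
      (≤-pred (≤-trans (s≤s (m≤n+m (length R) (length N))) (≤-trans (≤-reflexive (sym (star-size star))) len≤)))
      (P₄-free-⊆ P4 R⊆X) (noClique-⊆ no3 R⊆X)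
      (unique-++ʳ (c ∷ N) (unique-↭ X↭ uX)) (≤-trans (s≤s z≤n) (≤-reflexive (cong length (sym eq)))))
      where
      R⊆X : ∀ {x} → x ∈ R → x ∈ X
      R⊆X = ∈-suffix (c ∷ N) X↭

  Matches : ℕ → ℕ → List V → Set
  Matches s i L = ∀ {k l u v} → At L k u → At L l v → adj G u v ≡ blockAdj s i k l

  -- An ordering of X in the numbering of `block`: t triangles first, then one star on j vertices,
  -- absent if j is 0.
  record Layout (X Y : List V) : Set where
    field
      j t     : ℕ
      P       : List V
      P↭X     : P ↭ X
      size    : length X ≡ t * 3 + j
      count   : e X + σ j ≡ length X
      matches : Matches (t * 3) (length X) (P ++ Y)

  module _ {Y : List V} (Y-indep : ∀ {x y} → x ∈ Y → y ∈ Y → adj G x y ≡ false) where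

    -- A triangle of a P₄-free graph is a whole component, so triangles are peeled off first. The
    -- rest is empty, a single star, or at least two stars; the last alternative costs two edges and
    -- is reported on the right.
    layout : ∀ k {X} → length X ≤ k → P₄-Free X → Unique X →
      (∀ {x y} → x ∈ X → y ∈ Y → x ~ y) → Layout X Y ⊎ 2 + e X ≤ length X
    layout k {[]} _ _ _ _ = inj₁ record
      { j = 0 ; t = 0 ; P = [] ; P↭X = refl ; size = refl ; count = refl
      ; matches = λ {k} {l} at at′ → ≡.trans (Y-indep (in-Y at) (in-Y at′)) (sym (empty-block k l)) }
      where
      in-Y : ∀ {k v} → At Y k v → v ∈ Y
      in-Y at with At-++ [] at
      ... | inj₂ (_ , v∈) = v∈
    layout (suc k) {X@(_ ∷ _)} len≤ P4 uX joined with clique? 3 X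
    ... | no no3 = star-layout (star-component P4 no3 uX (s≤s z≤n))
      where
      star-layout : Star X → Layout X Y ⊎ 2 + e X ≤ length X
      star-layout star = finish R refl
        where
        open Star star
        R⊆X : ∀ {x} → x ∈ R → x ∈ X
        R⊆X = ∈-suffix (c ∷ N) X↭
        finish : ∀ R′ → R ≡ R′ → Layout X Y ⊎ 2 + e X ≤ length X
        finish (_ ∷ _) eq = inj₂ (begin
          2 + e X                    ≡⟨ cong (2 +_) (star-count star) ⟩
          2 + (length N + e R)       ≡⟨ cong suc (sym (+-suc (length N) (e R))) ⟩
          suc (length N + suc (e R)) ≤⟨ s≤s (+-monoʳ-≤ (length N) (star-forest (length R) ≤-refl
                                          (P₄-free-⊆ P4 R⊆X) (noClique-⊆ no3 R⊆X) (unique-++ʳ (c ∷ N) (unique-↭ X↭ uX))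
                                          (≤-trans (s≤s z≤n) (≤-reflexive (cong length (sym eq)))))) ⟩
          suc (length N + length R)  ≡⟨ sym (star-size star) ⟩
          length X                   ∎)
          where open ≤-Reasoning
        finish [] eq = inj₁ record
          { j = length X ; t = 0 ; P = c ∷ N ; P↭X = ↭-sym X↭cN ; size = refl
          ; count = begin
              e X + 1                ≡⟨ cong (_+ 1) (star-count star) ⟩
              length N + e R + 1     ≡⟨ cong (λ R → length N + e R + 1) eq ⟩
              length N + 0 + 1       ≡⟨ +-comm (length N + 0) 1 ⟩
              suc (length N + 0)     ≡⟨ cong suc (+-identityʳ (length N)) ⟩
              suc (length N)         ≡⟨ sym lenX ⟩
              length X               ∎
          ; matches = λ {k} {l} at at′ → ≡.trans (match at at′) (cong (λ i → blockAdj 0 i k l) (sym lenX)) }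
          where
          open ≡.≡-Reasoning
          X↭cN : X ↭ c ∷ N
          X↭cN = ↭-trans X↭ (↭-reflexive (cong (c ∷_) (≡.trans (cong (N ++_) eq) (++-identityʳ N))))
          lenX : length X ≡ suc (length N)
          lenX = ↭-length X↭cN
          in-X : ∀ {x} → x ∈ c ∷ N → x ∈ X
          in-X = ∈-resp-↭ (↭-sym X↭cN)
          c-row : ∀ {l v} → At (N ++ Y) l v → c ~ v
          c-row at with At-++ N at
          ... | inj₁ (_ , v∈N) = c~N v∈N
          ... | inj₂ (_ , v∈Y) = joined (in-X (here refl)) v∈Y
          match : ∀ {k l u v} → At (c ∷ N ++ Y) k u → At (c ∷ N ++ Y) l v →
            adj G u v ≡ blockAdj 0 (suc (length N)) k l
          match here here = irrefl G c
          match here (there {k = l} at) = ≡.trans (c-row at) (sym (star-row (length N) l))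
          match (there {k = k} at) here = ≡.trans (≡.trans (symm G _ c) (c-row at))
            (sym (≡.trans (blockAdj-sym 0 (suc (length N)) (suc k) 0) (star-row (length N) k)))
          match (there {k = k} at) (there {k = l} at′)
            rewrite star-rest (length N) k l with At-++ N at | At-++ N at′
          ... | inj₁ (lt , u∈) | inj₁ (lt′ , v∈) rewrite lt | lt′ = N-apart u∈ (∈-++⁺ˡ v∈)
          ... | inj₁ (lt , u∈) | inj₂ (ge , v∈) rewrite lt | ge = joined (in-X (there u∈)) v∈
          ... | inj₂ (ge , u∈) | inj₁ (lt , v∈) rewrite lt | ge = ~-sym (joined (in-X (there v∈)) u∈)
          ... | inj₂ (ge , u∈) | inj₂ (ge′ , v∈) rewrite ge | ge′ = Y-indep u∈ v∈
    ... | yes (a ∷ b ∷ c ∷ [] , refl , clT@((ab ∷ ac ∷ []) ∷ (bc ∷ []) ∷ [] ∷ []) , T⊆X) with extract (clique-unique clT) T⊆X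
    ...   | R , X↭ = extend (layout k (≤-pred (≤-trans (m<n+m (length R) (s≤s {n = 2} z≤n)) (≤-trans (≤-reflexive (sym (↭-length X↭))) len≤)))
                       (P₄-free-⊆ P4 R⊆X) (unique-++ʳ T uTR) (λ x∈ y∈ → joined (R⊆X x∈) y∈))
      where
      T : List V
      T = a ∷ b ∷ c ∷ []
      R⊆X : ∀ {x} → x ∈ R → x ∈ X
      R⊆X = ∈-suffix T X↭
      uTR : Unique (T ++ R)
      uTR = unique-↭ X↭ uX
      T∈ : ∀ {x} → x ∈ T → x ∈ X
      T∈ = ∈-prefix T X↭
      a∈ : a ∈ T
      a∈ = here refl
      b∈ : b ∈ T
      b∈ = there (here refl)
      c∈ : c ∈ T
      c∈ = there (there (here refl))

      -- An edge from w to x would make w x y z a P₄.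
      isolated : ∀ {x y z} → x ∈ T → y ∈ T → z ∈ T → x ~ y → x ~ z → y ~ z → ∀ {w} → w ∈ R → adj G w x ≡ false
      isolated x∈ y∈ z∈ xy xz yz w∈ = adj-false λ wx → P4 (R⊆X w∈) (T∈ x∈) (T∈ y∈) (T∈ z∈)
        (λ eq → unique-++-≢ T uTR y∈ w∈ (sym eq)) (λ eq → unique-++-≢ T uTR z∈ w∈ (sym eq)) (~⇒≢ xz) wx xy yz

      wa : ∀ {w} → w ∈ R → adj G w a ≡ false
      wa = isolated a∈ b∈ c∈ ab ac bc
      wb : ∀ {w} → w ∈ R → adj G w b ≡ false
      wb = isolated b∈ a∈ c∈ (~-sym ab) bc ac
      wc : ∀ {w} → w ∈ R → adj G w c ≡ false
      wc = isolated c∈ a∈ b∈ (~-sym ac) (~-sym bc) ab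

      e-X : e X ≡ 3 + e R
      e-X = begin
        e X                           ≡⟨ e-split T R X↭ ⟩
        e T + (cross T R + e R)       ≡⟨ cong₂ (λ x y → x + (y + e R)) e-T (sum-map-const _ 0 R deg-T) ⟩
        3 + e R                       ∎
        where
        open ≡.≡-Reasoning
        e-T : e T ≡ 3
        e-T rewrite ab | ac | bc = refl
        deg-T : ∀ {w} → w ∈ R → deg w T ≡ 0
        deg-T w∈ rewrite wa w∈ | wb w∈ | wc w∈ = refl

      extend : Layout R Y ⊎ 2 + e R ≤ length R → Layout X Y ⊎ 2 + e X ≤ length X
      extend (inj₂ le) = inj₂ (begin
        2 + e X         ≡⟨ cong (2 +_) e-X ⟩
        3 + (2 + e R)   ≤⟨ +-monoʳ-≤ 3 le ⟩
        3 + length R    ≡⟨ sym (↭-length X↭) ⟩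
        length X        ∎)
        where open ≤-Reasoning
      extend (inj₁ lay) = inj₁ record
        { j = j ; t = suc t ; P = T ++ P ; P↭X = ↭-trans (++⁺ˡ T P↭X) (↭-sym X↭)
        ; size = ≡.trans (↭-length X↭) (cong (3 +_) size)
        ; count = ≡.trans (cong (_+ σ j) e-X) (≡.trans (cong (3 +_) count) (sym (↭-length X↭)))
        ; matches = λ {k} {l} at at′ → ≡.trans (match at at′) (cong (λ i → blockAdj (suc t * 3) i k l) (sym (↭-length X↭))) }
        where
        open Layout lay
        row : ∀ {x} → x ∈ T → (∀ {w} → w ∈ R → adj G w x ≡ false) →
          ∀ {l v} → At (P ++ Y) l v → adj G x v ≡ not (l <ᵇ length R)
        row {x} x∈T wx {l} {v} at rewrite sym (↭-length P↭X) with At-++ P at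
        ... | inj₁ (lt , v∈) rewrite lt = ≡.trans (symm G x v) (wx (∈-resp-↭ P↭X v∈))
        ... | inj₂ (ge , v∈) rewrite ge = joined (T∈ x∈T) v∈
        s = t * 3
        i = length R
        flip : ∀ {x v} k l → adj G x v ≡ blockAdj (3 + s) (3 + i) k l → adj G v x ≡ blockAdj (3 + s) (3 + i) l k
        flip k l eq = ≡.trans (symm G _ _) (≡.trans eq (blockAdj-sym (3 + s) (3 + i) k l))
        match : ∀ {k l u v} → At (T ++ P ++ Y) k u → At (T ++ P ++ Y) l v →
          adj G u v ≡ blockAdj (3 + s) (3 + i) k l
        match here                 here                 = irrefl G a
        match here                 (there here)         = ab
        match here                 (there (there here)) = ac
        match (there here)         here                 = ~-sym ab
        match (there here)         (there here)         = irrefl G b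
        match (there here)         (there (there here)) = bc
        match (there (there here)) here                 = ~-sym ac
        match (there (there here)) (there here)         = ~-sym bc
        match (there (there here)) (there (there here)) = irrefl G c
        match here                 (there (there (there {k = l} at))) =
          ≡.trans (row a∈ wa at) (sym (proj₁ (triangle-rows s i l)))
        match (there here)         (there (there (there {k = l} at))) =
          ≡.trans (row b∈ wb at) (sym (proj₁ (proj₂ (triangle-rows s i l))))
        match (there (there here)) (there (there (there {k = l} at))) =
          ≡.trans (row c∈ wc at) (sym (proj₂ (proj₂ (triangle-rows s i l))))
        match (there (there (there {k = k} at))) here =
          flip 0 (3 + k) (≡.trans (row a∈ wa at) (sym (proj₁ (triangle-rows s i k))))
        match (there (there (there {k = k} at))) (there here) =
          flip 1 (3 + k) (≡.trans (row b∈ wb at) (sym (proj₁ (proj₂ (triangle-rows s i k)))))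
        match (there (there (there {k = k} at))) (there (there here)) =
          flip 2 (3 + k) (≡.trans (row c∈ wc at) (sym (proj₂ (proj₂ (triangle-rows s i k)))))
        match (there (there (there {k = k} at))) (there (there (there {k = l} at′))) =
          ≡.trans (matches at at′) (sym (blockAdj-shift s i k l))

-- Edge counts and P²₆-freeness of F and H

≡ᵇ-refl : ∀ a → (a ≡ᵇ a) ≡ true
≡ᵇ-refl zero    = refl
≡ᵇ-refl (suc a) = ≡ᵇ-refl a

≡ᵇ-true : ∀ a b → (a ≡ᵇ b) ≡ true → a ≡ b
≡ᵇ-true zero    zero    _  = refl
≡ᵇ-true (suc a) (suc b) eq = cong suc (≡ᵇ-true a b eq)

<ᵇ-irrefl : ∀ a → (a <ᵇ a) ≡ false
<ᵇ-irrefl zero    = refl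
<ᵇ-irrefl (suc a) = <ᵇ-irrefl a

<ᵇ-false-≤ : ∀ a {s i} → s ≤ i → (a <ᵇ i) ≡ false → (a <ᵇ s) ≡ false
<ᵇ-false-≤ a       z≤n       _  = refl
<ᵇ-false-≤ (suc a) (s≤s s≤i) ge = <ᵇ-false-≤ a s≤i ge

symAdj-block : ∀ {n} s i (a b : Fin n) → symAdj (block s i) a b ≡ blockAdj s i (toℕ a) (toℕ b)
symAdj-block s i a b with a ≟ b
... | yes refl rewrite ≡ᵇ-refl (toℕ a) = refl
... | no a≢b with toℕ a ≡ᵇ toℕ b in eq
...   | true  = ⊥-elim (a≢b (toℕ-injective (≡ᵇ-true _ _ eq)))
...   | false = refl

module _ {A B : Set} (f : B → A) where

  sum-map-map : ∀ (φ : A → ℕ) xs → sum (map φ (map f xs)) ≡ sum (map (λ x → φ (f x)) xs)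
  sum-map-map φ xs = cong sum (sym (map-∘ xs))

  e-map : ∀ (adj : A → A → Bool) xs → Counting.e adj (map f xs) ≡ Counting.e (λ x y → adj (f x) (f y)) xs
  e-map adj []       = refl
  e-map adj (x ∷ xs) = cong₂ _+_ (sum-map-map _ xs) (e-map adj xs)

e-cong : ∀ {A : Set} {adj adj′ : A → A → Bool} → (∀ x y → adj x y ≡ adj′ x y) → ∀ xs →
  Counting.e adj xs ≡ Counting.e adj′ xs
e-cong eq []       = refl
e-cong eq (x ∷ xs) = cong₂ _+_ (sum-map-cong _ _ xs (λ {y} _ → cong ι (eq x y))) (e-cong eq xs)

-- The link between two ways of counting each pair once: a guarded sum over all ordered pairs, as in
-- `edgeCount`, and the order of the list.
double-sum : ∀ {A : Set} (adj : A → A → Bool) (ψ : A → A → ℕ) xs → (∀ x → ψ x x ≡ 0) →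
  AllPairs (λ x y → ψ x y ≡ ι (adj x y) × ψ y x ≡ 0) xs →
  sum (map (λ x → sum (map (ψ x) xs)) xs) ≡ Counting.e adj xs
double-sum adj ψ []       diag []       = refl
double-sum adj ψ (x ∷ xs) diag (p ∷ ps) = begin
  ψ x x + sum (map (ψ x) xs) + sum (map (λ y → ψ y x + sum (map (ψ y) xs)) xs)
    ≡⟨ cong₂ _+_ (cong (_+ sum (map (ψ x) xs)) (diag x)) (sum-map-+ (λ y → ψ y x) _ xs) ⟩
  sum (map (ψ x) xs) + (sum (map (λ y → ψ y x) xs) + sum (map (λ y → sum (map (ψ y) xs)) xs))
    ≡⟨ cong₂ _+_ (sum-map-cong _ _ xs (λ y∈ → proj₁ (All.lookup p y∈)))
         (cong₂ _+_ (sum-map-const _ 0 xs (λ y∈ → proj₂ (All.lookup p y∈))) (double-sum adj ψ xs diag ps)) ⟩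
  Counting.deg adj x xs + Counting.e adj xs ∎
  where open ≡.≡-Reasoning

edgeCount≡e : ∀ {n} (G : Graph n) → edgeCount G ≡ Counting.e (adj G) (allFin n)
edgeCount≡e {n} G = double-sum (adj G) ψ (allFin n) diagonal
  (tabulate⁺-< λ {i} {j} i<j → upper i<j , lower i<j)
  where
  ψ : Fin n → Fin n → ℕ
  ψ a b = if ⌊ a <? b ⌋ ∧ adj G a b then 1 else 0
  diagonal : ∀ a → ψ a a ≡ 0
  diagonal a with a <? a
  ... | yes a<a = ⊥-elim (<-irrefl refl a<a)
  ... | no  _   = refl
  upper : ∀ {a b} → a Fin.< b → ψ a b ≡ ι (adj G a b)
  upper {a} {b} a<b with a <? b
  ... | no ≮ = ⊥-elim (≮ a<b)
  ... | yes _ with adj G a b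
  ...   | true  = refl
  ...   | false = refl
  lower : ∀ {a b} → a Fin.< b → ψ b a ≡ 0
  lower {a} {b} a<b with b <? a
  ... | yes b<a = ⊥-elim (<-asym a<b b<a)
  ... | no  _   = refl

toℕ-allFin : ∀ n → map toℕ (allFin n) ≡ upTo n
toℕ-allFin n = ≡.trans (map-tabulate (λ x → x) toℕ) (tabulate-toℕ n (λ x → x))
  where
  tabulate-toℕ : ∀ n (f : ℕ → ℕ) → tabulate {n = n} (λ x → f (toℕ x)) ≡ applyUpTo f n
  tabulate-toℕ zero    f = refl
  tabulate-toℕ (suc n) f = cong (f 0 ∷_) (tabulate-toℕ n (λ x → f (suc x)))

upTo-suc : ∀ n → upTo (suc n) ≡ 0 ∷ map suc (upTo n)
upTo-suc n = cong (0 ∷_) (sym (map-upTo suc n))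

upTo-3+ : ∀ n → upTo (3 + n) ≡ 0 ∷ 1 ∷ 2 ∷ map (3 +_) (upTo n)
upTo-3+ n = cong (λ L → 0 ∷ 1 ∷ 2 ∷ L) (sym (map-upTo (3 +_) n))

outside : ∀ i y → sum (map (λ b → ι (not (b <ᵇ i))) (upTo (i + y))) ≡ y
outside zero    y = ≡.trans (sum-map-const _ 1 (upTo y) (λ _ → refl))
  (≡.trans (*-identityˡ _) (length-upTo y))
outside (suc i) y = ≡.trans (cong (λ L → sum (map (λ b → ι (not (b <ᵇ suc i))) L)) (sym (map-upTo suc (i + y))))
  (≡.trans (sum-map-map suc _ (upTo (i + y))) (outside i y))

bipartite-count : ∀ m y → Counting.e (λ a b → (a <ᵇ m) xor (b <ᵇ m)) (upTo (m + y)) ≡ m * y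
bipartite-count zero    y = Counting.edgeless _ (upTo y) (λ _ _ → refl)
bipartite-count (suc m) y = ≡.trans (cong (Counting.e _) (upTo-suc (m + y))) (cong₂ _+_
  (≡.trans (sum-map-map suc _ (upTo (m + y))) (outside m y))
  (≡.trans (e-map suc _ (upTo (m + y))) (bipartite-count m y)))

-- A triangle has as many edges as vertices and a star one fewer, so adding `σ j` turns the number
-- of edges inside X into |X|. The induction strips the first triangle.
block-count : ∀ t j y → let i = t * 3 + j in
  Counting.e (blockAdj (t * 3) i) (upTo (i + y)) + σ j ≡ i * y + i
block-count zero zero y = cong (_+ 0) (Counting.edgeless _ (upTo y) (λ {a} {b} _ _ → empty-block a b))
block-count zero (suc m) y = begin
  Counting.e (blockAdj 0 (suc m)) (upTo (suc m + y)) + 1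
    ≡⟨ cong (λ L → Counting.e (blockAdj 0 (suc m)) L + 1) (upTo-suc (m + y)) ⟩
  sum (map (λ b → ι (blockAdj 0 (suc m) 0 b)) (map suc U)) + Counting.e (blockAdj 0 (suc m)) (map suc U) + 1
    ≡⟨ cong (_+ 1) (cong₂ _+_
         (≡.trans (sum-map-map suc _ U) (≡.trans (sum-map-const _ 1 U (λ {b} _ → cong ι (star-row m b)))
           (≡.trans (*-identityˡ _) (length-upTo (m + y)))))
         (≡.trans (e-map suc _ U) (≡.trans (e-cong (star-rest m) U) (bipartite-count m y)))) ⟩
  m + y + m * y + 1
    ≡⟨ collect m y ⟩
  suc m * y + suc m ∎
  where
  open ≡.≡-Reasoning
  U = upTo (m + y)
  collect : ∀ m y → m + y + m * y + 1 ≡ suc m * y + suc m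
  collect = solve-∀
block-count (suc t) j y = begin
  Counting.e (blockAdj (3 + s) (3 + i)) (upTo (3 + (i + y))) + σ j
    ≡⟨ cong (λ L → Counting.e (blockAdj (3 + s) (3 + i)) L + σ j) (upTo-3+ (i + y)) ⟩
  suc (suc (d 0)) + (suc (d 1) + (d 2 + Counting.e (blockAdj (3 + s) (3 + i)) (map (3 +_) U))) + σ j
    ≡⟨ cong (_+ σ j) (cong₂ _+_ (cong (2 +_) (row 0 λ b → proj₁ (triangle-rows s i b)))
         (cong₂ _+_ (cong suc (row 1 λ b → proj₁ (proj₂ (triangle-rows s i b))))
         (cong₂ _+_ (row 2 λ b → proj₂ (proj₂ (triangle-rows s i b)))
           (≡.trans (e-map (3 +_) _ U) (e-cong (blockAdj-shift s i) U))))) ⟩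
  suc (suc y) + (suc y + (y + Counting.e (blockAdj s i) U)) + σ j
    ≡⟨ gather y (Counting.e (blockAdj s i) U) (σ j) ⟩
  3 * y + 3 + (Counting.e (blockAdj s i) U + σ j)
    ≡⟨ cong (3 * y + 3 +_) (block-count t j y) ⟩
  3 * y + 3 + (i * y + i)
    ≡⟨ collect i y ⟩
  (3 + i) * y + (3 + i) ∎
  where
  open ≡.≡-Reasoning
  s = t * 3
  i = t * 3 + j
  U = upTo (i + y)
  d : ℕ → ℕ
  d a = sum (map (λ b → ι (blockAdj (3 + s) (3 + i) a b)) (map (3 +_) U))
  row : ∀ a → (∀ b → blockAdj (3 + s) (3 + i) a (3 + b) ≡ not (b <ᵇ i)) → d a ≡ y
  row a eq = ≡.trans (sum-map-map (3 +_) _ U) (≡.trans (sum-map-cong _ _ U (λ {b} _ → cong ι (eq b))) (outside i y))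
  gather : ∀ y x z → suc (suc y) + (suc y + (y + x)) + z ≡ 3 * y + 3 + (x + z)
  gather = solve-∀
  collect : ∀ i y → 3 * y + 3 + (i * y + i) ≡ (3 + i) * y + (3 + i)
  collect = solve-∀

blockGraph : ∀ n s i → Graph n
blockGraph n s i = fromRel n (block s i)

blockGraph-count : ∀ t j y → let i = t * 3 + j in
  edgeCount (blockGraph (i + y) (t * 3) i) + σ j ≡ i * y + i
blockGraph-count t j y = ≡.trans (cong (_+ σ j) (begin
  edgeCount (blockGraph n s i)                       ≡⟨ edgeCount≡e (blockGraph n s i) ⟩
  Counting.e (symAdj (block s i)) (allFin n)         ≡⟨ e-cong (symAdj-block s i) (allFin n) ⟩
  Counting.e (λ a b → blockAdj s i (toℕ a) (toℕ b)) (allFin n) ≡⟨ sym (e-map toℕ (blockAdj s i) (allFin n)) ⟩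
  Counting.e (blockAdj s i) (map toℕ (allFin n))     ≡⟨ cong (Counting.e (blockAdj s i)) (toℕ-allFin n) ⟩
  Counting.e (blockAdj s i) (upTo n)                 ∎)) (block-count t j y)
  where
  open ≡.≡-Reasoning
  s = t * 3
  i = t * 3 + j
  n = i + y

-- A vertex of the squared path in Y forces its neighbours into X. If v₃ is in Y, then v₁ v₂ v₄ v₅
-- is a P₄ in X; if v₄ is, then v₂ v₃ v₅ v₆. Otherwise v₃ v₄ extends inside X on both sides: to v₁,
-- or to v₂ if v₁ is in Y, and to v₅, or to v₆ if v₅ is in Y.
join-free : ∀ {n} (G : Graph n) (p : Fin n → Bool) →
  (∀ {x y} → p x ≡ true → p y ≡ true → adj G x y ≡ false) →
  (∀ {a b c d} → p a ≡ false → p b ≡ false → p c ≡ false → p d ≡ false → a ≢ c → a ≢ d → b ≢ d →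
    adj G a b ≡ true → adj G b c ≡ true → adj G c d ≡ true → ⊥) →
  ¬ Contains (P2 6) G
join-free {n} G p indep P₄-free (f , inj , edges) = cases (p (f i₁)) (p (f i₃)) (p (f i₄)) (p (f i₅)) refl refl refl refl
  where
  i₁ i₂ i₃ i₄ i₅ i₆ : Fin 6
  i₁ = zero
  i₂ = suc zero
  i₃ = suc (suc zero)
  i₄ = suc (suc (suc zero))
  i₅ = suc (suc (suc (suc zero)))
  i₆ = suc (suc (suc (suc (suc zero))))

  off : ∀ i j → adj (P2 6) i j ≡ true → p (f i) ≡ true → p (f j) ≡ false
  off i j ij pi with p (f j) in pj
  ... | false = refl
  ... | true with ≡.trans (sym (edges i j ij)) (indep pi pj)
  ...   | ()

  path : ∀ i j k l → adj (P2 6) i j ≡ true → adj (P2 6) j k ≡ true → adj (P2 6) k l ≡ true →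
    i ≢ k → i ≢ l → j ≢ l → p (f i) ≡ false → p (f j) ≡ false → p (f k) ≡ false → p (f l) ≡ false → ⊥
  path i j k l ij jk kl i≢k i≢l j≢l pi pj pk pl = P₄-free pi pj pk pl
    (λ eq → i≢k (inj eq)) (λ eq → i≢l (inj eq)) (λ eq → j≢l (inj eq)) (edges i j ij) (edges j k jk) (edges k l kl)

  cases : ∀ b₁ b₃ b₄ b₅ → p (f i₁) ≡ b₁ → p (f i₃) ≡ b₃ → p (f i₄) ≡ b₄ → p (f i₅) ≡ b₅ → ⊥
  cases _ true _ _ _ p₃ _ _ = path i₁ i₂ i₄ i₅ refl refl refl (λ ()) (λ ()) (λ ())
    (off i₃ i₁ refl p₃) (off i₃ i₂ refl p₃) (off i₃ i₄ refl p₃) (off i₃ i₅ refl p₃)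
  cases _ false true _ _ _ p₄ _ = path i₂ i₃ i₅ i₆ refl refl refl (λ ()) (λ ()) (λ ())
    (off i₄ i₂ refl p₄) (off i₄ i₃ refl p₄) (off i₄ i₅ refl p₄) (off i₄ i₆ refl p₄)
  cases true false false true p₁ p₃ p₄ p₅ = path i₂ i₃ i₄ i₆ refl refl refl (λ ()) (λ ()) (λ ())
    (off i₁ i₂ refl p₁) p₃ p₄ (off i₅ i₆ refl p₅)
  cases true false false false p₁ p₃ p₄ p₅ = path i₂ i₃ i₄ i₅ refl refl refl (λ ()) (λ ()) (λ ())
    (off i₁ i₂ refl p₁) p₃ p₄ p₅
  cases false false false true p₁ p₃ p₄ p₅ = path i₁ i₃ i₄ i₆ refl refl refl (λ ()) (λ ()) (λ ())
    p₁ p₃ p₄ (off i₅ i₆ refl p₅)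
  cases false false false false p₁ p₃ p₄ p₅ = path i₁ i₃ i₄ i₅ refl refl refl (λ ()) (λ ()) (λ ())
    p₁ p₃ p₄ p₅

∨-true : ∀ x {y} → x ∨ y ≡ true → x ≡ true ⊎ y ≡ true
∨-true true  _  = inj₁ refl
∨-true false eq = inj₂ eq

not-true : ∀ {x} → not x ≡ true → x ≡ false
not-true {false} _ = refl

InTriangle InStar : ℕ → ℕ → ℕ → Set
InTriangle s a b = (a <ᵇ s) ≡ true × (b <ᵇ s) ≡ true × a / 3 ≡ b / 3
InStar     s a b = (a <ᵇ s) ≡ false × (b <ᵇ s) ≡ false × (a ≡ s ⊎ b ≡ s)

block-inside : ∀ s i a b → (a <ᵇ i) ≡ true → (b <ᵇ i) ≡ true → block s i a b ≡ true →
  InTriangle s a b ⊎ InStar s a b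
block-inside s i a b a<i b<i eq with ∨-true ((a <ᵇ s) ∧ (b <ᵇ s) ∧ ((a / 3) ≡ᵇ (b / 3))) eq
... | inj₁ tri = inj₁ (∧-conicalˡ (a <ᵇ s) _ tri , ∧-conicalˡ (b <ᵇ s) _ rest ,
                       ≡ᵇ-true _ _ (∧-conicalʳ (b <ᵇ s) _ rest))
  where rest = ∧-conicalʳ (a <ᵇ s) _ tri
... | inj₂ eq′ with ∨-true ((a ≡ᵇ s) ∧ not (b <ᵇ s) ∧ (b <ᵇ i)) eq′
...   | inj₂ cr rewrite a<i | b<i with cr
...     | ()
block-inside s i a b a<i b<i eq | inj₂ eq′ | inj₁ st =
  inj₂ (≡.trans (cong (_<ᵇ s) a≡s) (<ᵇ-irrefl s) ,
        not-true (∧-conicalˡ (not (b <ᵇ s)) _ (∧-conicalʳ (a ≡ᵇ s) _ st)) , inj₁ a≡s)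
  where a≡s = ≡ᵇ-true a s (∧-conicalˡ (a ≡ᵇ s) _ st)

blockAdj-inside : ∀ s i a b → (a <ᵇ i) ≡ true → (b <ᵇ i) ≡ true → blockAdj s i a b ≡ true →
  InTriangle s a b ⊎ InStar s a b
blockAdj-inside s i a b a<i b<i eq with ∨-true (block s i a b) (∧-conicalʳ (not (a ≡ᵇ b)) _ eq)
... | inj₁ ab = block-inside s i a b a<i b<i ab
... | inj₂ ba with block-inside s i b a b<i a<i ba
...   | inj₁ (b<s , a<s , q)       = inj₁ (a<s , b<s , sym q)
...   | inj₂ (b≥s , a≥s , inj₁ eq) = inj₂ (a≥s , b≥s , inj₂ eq)
...   | inj₂ (b≥s , a≥s , inj₂ eq) = inj₂ (a≥s , b≥s , inj₁ eq)

blockAdj-outside : ∀ {s i} a b → s ≤ i → (a <ᵇ i) ≡ false → (b <ᵇ i) ≡ false → blockAdj s i a b ≡ false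
blockAdj-outside {s} {i} a b s≤i a≥i b≥i
  rewrite <ᵇ-false-≤ a s≤i a≥i | <ᵇ-false-≤ b s≤i b≥i | a≥i | b≥i | ∧-zeroʳ (a ≡ᵇ s) | ∧-zeroʳ (b ≡ᵇ s) =
  ∧-zeroʳ (not (a ≡ᵇ b))

-- There are only three remainders modulo 3, so two of the four numbers would agree in quotient and
-- remainder.
same-quotient : ∀ {a b c d} → Unique (a ∷ b ∷ c ∷ d ∷ []) → a / 3 ≡ b / 3 → b / 3 ≡ c / 3 → c / 3 ≡ d / 3 → ⊥
same-quotient {a} {b} {c} {d} u ab bc cd with pigeonhole (n<1+n 3) (λ k → lookup (a ∷ b ∷ c ∷ d ∷ []) k mod 3)
... | k , l , k<l , eq = <⇒≢ k<l (cong toℕ (lookup-injective u k l (begin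
    x                    ≡⟨ m≡m%n+[m/n]*n x 3 ⟩
    x % 3 + x / 3 * 3    ≡⟨ cong₂ (λ r q → r + q * 3) remainders (≡.trans (All.lookup quotients (∈-lookup k)) (sym (All.lookup quotients (∈-lookup l)))) ⟩
    y % 3 + y / 3 * 3    ≡⟨ sym (m≡m%n+[m/n]*n y 3) ⟩
    y                    ∎)))
  where
  open ≡.≡-Reasoning
  x = lookup (a ∷ b ∷ c ∷ d ∷ []) k
  y = lookup (a ∷ b ∷ c ∷ d ∷ []) l
  remainders : x % 3 ≡ y % 3
  remainders = ≡.trans (sym (toℕ-fromℕ< (m%n<n x 3))) (≡.trans (cong toℕ eq) (toℕ-fromℕ< (m%n<n y 3)))
  quotients : All (λ z → z / 3 ≡ d / 3) (a ∷ b ∷ c ∷ d ∷ [])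
  quotients = ≡.trans ab (≡.trans bc cd) ∷ ≡.trans bc cd ∷ cd ∷ refl ∷ []

-- Consecutive edges share a vertex, so all three lie among the triangles or all in the star. In the
-- first case four vertices lie in one triangle; in the second the disjoint outer edges would both
-- contain the centre.
block-P₄-free : ∀ s i {a b c d} → (a <ᵇ i) ≡ true → (b <ᵇ i) ≡ true → (c <ᵇ i) ≡ true → (d <ᵇ i) ≡ true →
  Unique (a ∷ b ∷ c ∷ d ∷ []) → blockAdj s i a b ≡ true → blockAdj s i b c ≡ true → blockAdj s i c d ≡ true → ⊥
block-P₄-free s i {a} {b} {c} {d} pa pb pc pd u@((_ ∷ ac ∷ ad ∷ []) ∷ (bc ∷ bd ∷ []) ∷ _) eab ebc ecd
  with blockAdj-inside s i a b pa pb eab | blockAdj-inside s i b c pb pc ebc | blockAdj-inside s i c d pc pd ecd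
... | inj₁ (_ , _ , q) | inj₁ (_ , _ , q′) | inj₁ (_ , _ , q″) = same-quotient u q q′ q″
... | inj₁ (_ , b<s , _) | inj₂ (b≥s , _) | _ = not-both b<s b≥s
... | inj₂ (_ , b≥s , _) | inj₁ (b<s , _) | _ = not-both b<s b≥s
... | _ | inj₁ (_ , c<s , _) | inj₂ (c≥s , _) = not-both c<s c≥s
... | _ | inj₂ (_ , c≥s , _) | inj₁ (c<s , _) = not-both c<s c≥s
... | inj₂ (_ , _ , inj₁ a≡s) | _ | inj₂ (_ , _ , inj₁ c≡s) = ac (≡.trans a≡s (sym c≡s))
... | inj₂ (_ , _ , inj₁ a≡s) | _ | inj₂ (_ , _ , inj₂ d≡s) = ad (≡.trans a≡s (sym d≡s))
... | inj₂ (_ , _ , inj₂ b≡s) | _ | inj₂ (_ , _ , inj₁ c≡s) = bc (≡.trans b≡s (sym c≡s))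
... | inj₂ (_ , _ , inj₂ b≡s) | _ | inj₂ (_ , _ , inj₂ d≡s) = bd (≡.trans b≡s (sym d≡s))

blockGraph-free : ∀ n {s i} → s ≤ i → ¬ Contains (P2 6) (blockGraph n s i)
blockGraph-free n {s} {i} s≤i = join-free (blockGraph n s i) (λ x → not (toℕ x <ᵇ i))
  (λ {x} {y} px py → ≡.trans (symAdj-block s i x y) (blockAdj-outside (toℕ x) (toℕ y) s≤i (not-true px) (not-true py)))
  λ {a} {b} {c} {d} pa pb pc pd ac ad bd ab bc cd → block-P₄-free s i (inside pa) (inside pb) (inside pc) (inside pd)
    ((apart (~⇒≢ ab) ∷ apart ac ∷ apart ad ∷ []) ∷ (apart (~⇒≢ bc) ∷ apart bd ∷ []) ∷ (apart (~⇒≢ cd) ∷ []) ∷ [] ∷ [])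
    (on-ℕ ab) (on-ℕ bc) (on-ℕ cd)
  where
  inside : ∀ {b} → not b ≡ false → b ≡ true
  inside {true} _ = refl
  on-ℕ : ∀ {x y} → symAdj (block s i) x y ≡ true → blockAdj s i (toℕ x) (toℕ y) ≡ true
  on-ℕ {x} {y} eq = ≡.trans (sym (symAdj-block s i x y)) eq
  apart : ∀ {x y : Fin n} → x ≢ y → toℕ x ≢ toℕ y
  apart x≢y eq = x≢y (toℕ-injective eq)
  ~⇒≢ : ∀ {x y} → symAdj (block s i) x y ≡ true → x ≢ y
  ~⇒≢ {x} eq refl with ≡.trans (sym eq) (irrefl (blockGraph n s i) x)
  ... | ()

-- With j = 0 there is no star, so both families become instances of `blockGraph` and are treated
-- together.
H≅F : ∀ n i → H n i ≅ F n i 0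
H≅F n i = record
  { to = λ x → x ; from = λ x → x ; from-to = λ _ → refl ; to-from = λ _ → refl
  ; pres = λ a b → cong (not ⌊ a ≟ b ⌋ ∧_) (cong₂ _∨_ (same (toℕ a) (toℕ b)) (same (toℕ b) (toℕ a))) }
  where
  same : ∀ a b → ((a <ᵇ i) ∧ (b <ᵇ i) ∧ ((a / 3) ≡ᵇ (b / 3))) ∨ crossR i a b ≡ block i i a b
  same a b with b <ᵇ i
  ... | true  rewrite ∧-zeroʳ (a ≡ᵇ i) = refl
  ... | false rewrite ∧-zeroʳ (a ≡ᵇ i) = refl

-- Invariance under isomorphism, and isomorphisms read off from listings

module _ {n : ℕ} {G G′ : Graph n} (iso : G ≅ G′) where
  open _≅_ iso

  ≅-sym : G′ ≅ G
  ≅-sym = record { to = from ; from = to ; from-to = to-from ; to-from = from-to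
    ; pres = λ a b → sym (≡.trans (pres (from a) (from b)) (cong₂ (adj G′) (to-from a) (to-from b))) }

  contains-≅ : ∀ {k} {K : Graph k} → Contains K G → Contains K G′
  contains-≅ (f , inj , edges) = (λ x → to (f x)) ,
    (λ {x} {y} eq → inj (≡.trans (sym (from-to (f x))) (≡.trans (cong from eq) (from-to (f y))))) ,
    λ a b ab → ≡.trans (sym (pres (f a) (f b))) (edges a b ab)

  edgeCount-≅ : edgeCount G ≡ edgeCount G′
  edgeCount-≅ = begin
    edgeCount G                                        ≡⟨ edgeCount≡e G ⟩
    Counting.e (adj G) (allFin n)                      ≡⟨ e-cong pres (allFin n) ⟩
    Counting.e (λ a b → adj G′ (to a) (to b)) (allFin n) ≡⟨ sym (e-map to (adj G′) (allFin n)) ⟩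
    Counting.e (adj G′) (map to (allFin n))            ≡⟨ Counting.Symmetric.e-↭ (adj G′) (symm G′) permuted ⟩
    Counting.e (adj G′) (allFin n)                     ≡⟨ sym (edgeCount≡e G′) ⟩
    edgeCount G′                                       ∎
    where
    open ≡.≡-Reasoning
    permuted : map to (allFin n) ↭ allFin n
    permuted with extract (unique-map⁺ (λ {x} {y} eq → ≡.trans (sym (from-to x)) (≡.trans (cong from eq) (from-to y))) (allFin⁺ n))
                          (All.tabulate {xs = map to (allFin n)} (λ {x} _ → ∈-allFin x))
    ... | [] , p = ↭-sym (↭-trans p (↭-reflexive (++-identityʳ _)))
    ... | x ∷ R , p = ⊥-elim (m+1+n≢m (length (allFin n)) (sym (begin
          length (allFin n)                            ≡⟨ ↭-length p ⟩
          length (map to (allFin n) ++ x ∷ R)          ≡⟨ length-++ (map to (allFin n)) ⟩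
          length (map to (allFin n)) + suc (length R)  ≡⟨ cong (_+ suc (length R)) (length-map to (allFin n)) ⟩
          length (allFin n) + suc (length R)           ∎)))

≅-trans : ∀ {n} {G₁ G₂ G₃ : Graph n} → G₁ ≅ G₂ → G₂ ≅ G₃ → G₁ ≅ G₃
≅-trans f g = record
  { to = λ x → to g (to f x) ; from = λ x → from f (from g x)
  ; from-to = λ x → ≡.trans (cong (from f) (from-to g (to f x))) (from-to f x)
  ; to-from = λ x → ≡.trans (cong (to g) (to-from f (from g x))) (to-from g x)
  ; pres = λ a b → ≡.trans (pres f a b) (pres g (to f a) (to f b)) }
  where open _≅_

At-lookup : ∀ {A : Set} (L : List A) k → At L (toℕ k) (lookup L k)
At-lookup (x ∷ L) zero    = here
At-lookup (x ∷ L) (suc k) = there (At-lookup L k)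

listing-iso : ∀ {n} (G : Graph n) s i L → allFin n ↭ L →
  (∀ {k l u v} → At L k u → At L l v → adj G u v ≡ blockAdj s i k l) → G ≅ blockGraph n s i
listing-iso {n} G s i L allFin↭ matches = record
  { to = to ; from = from ; from-to = from-to
  ; to-from = λ k → from-injective (from-to (from k))
  ; pres = λ a b → begin
      adj G a b                                   ≡⟨ cong₂ (adj G) (sym (from-to a)) (sym (from-to b)) ⟩
      adj G (from (to a)) (from (to b))           ≡⟨ matches (At-lookup L (cast (sym len) (to a))) (At-lookup L (cast (sym len) (to b))) ⟩
      blockAdj s i (toℕ (cast (sym len) (to a))) (toℕ (cast (sym len) (to b)))
                                                  ≡⟨ cong₂ (blockAdj s i) (toℕ-cast (sym len) (to a)) (toℕ-cast (sym len) (to b)) ⟩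
      blockAdj s i (toℕ (to a)) (toℕ (to b))      ≡⟨ sym (symAdj-block s i (to a) (to b)) ⟩
      symAdj (block s i) (to a) (to b)            ∎ }
  where
  open ≡.≡-Reasoning
  len : length L ≡ n
  len = ≡.trans (sym (↭-length allFin↭)) (length-tabulate (λ x → x))
  ∈L : ∀ a → a ∈ L
  ∈L a = ∈-resp-↭ allFin↭ (∈-allFin a)
  to : Fin n → Fin n
  to a = cast len (index (∈L a))
  from : Fin n → Fin n
  from k = lookup L (cast (sym len) k)
  from-to : ∀ a → from (to a) ≡ a
  from-to a = ≡.trans (cong (lookup L) (cast-involutive (sym len) len (index (∈L a)))) (sym (lookup-index (∈L a)))
  from-injective : ∀ {k l} → from k ≡ from l → k ≡ l
  from-injective {k} {l} eq = ≡.trans (sym (cast-involutive len (sym len) k))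
    (≡.trans (cong (cast len) (lookup-injective (unique-↭ allFin↭ (allFin⁺ n)) _ _ eq)) (cast-involutive len (sym len) l))

-- Residues modulo 6

-- The identity 4xy + (x - y)² = (x + y)², divided by four; the floors agree because x - y and x + y
-- have the same parity.
q-balance : ∀ m δ → m * (m + δ) + q δ ≡ q (m + m + δ)
q-balance zero    δ = refl
q-balance (suc m) δ = begin
  suc m * (suc m + δ) + q δ               ≡⟨ expand m δ (q δ) ⟩
  m * (m + δ) + q δ + suc (m + m + δ)     ≡⟨ cong (_+ suc (m + m + δ)) (q-balance m δ) ⟩
  q (2 + (m + m + δ))                     ≡⟨ cong (λ k → q (suc (k + δ))) (sym (+-suc m m)) ⟩
  q (suc m + suc m + δ)                   ∎
  where
  open ≡.≡-Reasoning
  expand : ∀ m δ x → suc m * (suc m + δ) + x ≡ m * (m + δ) + x + suc (m + m + δ)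
  expand = solve-∀

Balanced : ℕ → ℕ → ℕ → Set
Balanced i z δ = z ≡ i + δ ⊎ i ≡ z + δ

balanced : ∀ i z → ∃ (Balanced i z)
balanced i z with ≤-total i z
... | inj₁ i≤z = z ∸ i , inj₁ (sym (m+[n∸m]≡n i≤z))
... | inj₂ z≤i = i ∸ z , inj₂ (sym (m+[n∸m]≡n z≤i))

product-balance : ∀ {i z δ} → Balanced i z δ → i * z + q δ ≡ q (i + z)
product-balance {i} {z} {δ} (inj₁ refl) = ≡.trans (q-balance i δ) (cong q (+-assoc i i δ))
product-balance {i} {z} {δ} (inj₂ refl) = begin
  (z + δ) * z + q δ   ≡⟨ cong (_+ q δ) (*-comm (z + δ) z) ⟩
  z * (z + δ) + q δ   ≡⟨ q-balance z δ ⟩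
  q (z + z + δ)       ≡⟨ cong q (≡.trans (+-assoc z z δ) (+-comm z (z + δ))) ⟩
  q (z + δ + z)       ∎
  where open ≡.≡-Reasoning

-- An (i , y)-join in which all but s components of X are triangles has i * y + i − s edges.
defect : ∀ {n i y δ} → i + y ≡ n → Balanced i (suc y) δ → i * y + i + q δ ≡ turán n + ε n
defect {i = i} {y} {δ} refl bal = begin
  i * y + i + q δ            ≡⟨ cong (_+ q δ) (≡.trans (+-comm (i * y) i) (sym (*-suc i y))) ⟩
  i * suc y + q δ            ≡⟨ product-balance bal ⟩
  q (i + suc y)              ≡⟨ cong q (+-suc i y) ⟩
  q (suc (i + y))            ≡⟨ sym (turán+ε (i + y)) ⟩
  turán (i + y) + ε (i + y)  ∎
  where open ≡.≡-Reasoning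

ε-periodic : ∀ r k → ε (r + k * 6) ≡ ε r
ε-periodic r zero    = cong ε (+-identityʳ r)
ε-periodic r (suc k) = ≡.trans (cong ε (shuffle r k)) (ε-periodic r k)
  where
  shuffle : ∀ r k → r + suc k * 6 ≡ 6 + (r + k * 6)
  shuffle = solve-∀

half-unique : ∀ m M {a b} → m + m + a ≡ M + M + b → a < 2 → b < 2 → m ≡ M × a ≡ b
half-unique zero    zero    eq _   _   = refl , eq
half-unique zero    (suc M) {b = b} refl a<2 _ = ⊥-elim (<⇒≱ a<2 (s≤s (≤-trans (m≤n+m 1 M)
  (≤-trans (≤-reflexive (≡.trans (+-suc M 0) (cong suc (+-identityʳ M)))) (≤-trans (s≤s (m≤m+n M M)) (≤-trans (≤-reflexive (sym (+-suc M M))) (m≤m+n _ b)))))))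
half-unique (suc m) zero {a} refl _ b<2 = ⊥-elim (<⇒≱ b<2 (s≤s (≤-trans (s≤s z≤n)
  (≤-trans (≤-reflexive (sym (+-suc m m))) (m≤m+n (m + suc m) a)))))
half-unique (suc m) (suc M) {a} {b} eq a<2 b<2 rewrite +-suc m m | +-suc M M with
  half-unique m M (suc-injective (suc-injective eq)) a<2 b<2
... | refl , a≡b = refl , a≡b

-- An imbalance of three or more already costs two edges. Below that, the parity of i + z separates
-- δ = 1 from δ = 0 and δ = 2, and halving determines i.
locate : ∀ {i z M b} δ → i + z ≡ M + M + b → b < 2 → Balanced i z δ → q δ ≤ 1 →
  (δ ≡ 0 × b ≡ 0 × i ≡ M) ⊎ (δ ≡ 1 × b ≡ 1 × (i ≡ M ⊎ i ≡ suc M)) ⊎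
  (δ ≡ 2 × b ≡ 0 × (suc i ≡ M ⊎ i ≡ suc M))
locate {i} {M = M} 0 eq b<2 (inj₁ refl) _ with half-unique i M (≡.trans (+-assoc i i 0) eq) (s≤s z≤n) b<2
... | refl , refl = inj₁ (refl , refl , refl)
locate {z = z} {M} 0 eq b<2 (inj₂ refl) _ with half-unique z M (≡.trans (shuffle z) eq) (s≤s z≤n) b<2
  where
  shuffle : ∀ z → z + z + 0 ≡ z + 0 + z
  shuffle = solve-∀
... | refl , refl = inj₁ (refl , refl , +-identityʳ _)
locate {i} {M = M} 1 eq b<2 (inj₁ refl) _ with half-unique i M (≡.trans (+-assoc i i 1) eq) ≤-refl b<2
... | refl , refl = inj₂ (inj₁ (refl , refl , inj₁ refl))
locate {z = z} {M} 1 eq b<2 (inj₂ refl) _ with half-unique z M (≡.trans (shuffle z) eq) ≤-refl b<2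
  where
  shuffle : ∀ z → z + z + 1 ≡ z + 1 + z
  shuffle = solve-∀
... | refl , refl = inj₂ (inj₁ (refl , refl , inj₂ (+-comm z 1)))
locate {i} {M = M} 2 eq b<2 (inj₁ refl) _ with half-unique (suc i) M (≡.trans (shuffle i) eq) (s≤s z≤n) b<2
  where
  shuffle : ∀ i → suc i + suc i + 0 ≡ i + (i + 2)
  shuffle = solve-∀
... | refl , refl = inj₂ (inj₂ (refl , refl , inj₁ refl))
locate {z = z} {M} 2 eq b<2 (inj₂ refl) _ with half-unique (suc z) M (≡.trans (shuffle z) eq) (s≤s z≤n) b<2
  where
  shuffle : ∀ z → suc z + suc z + 0 ≡ z + 2 + z
  shuffle = solve-∀
... | refl , refl = inj₂ (inj₂ (refl , refl , inj₂ (+-comm z 2)))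
locate (suc (suc (suc δ))) _ _ _ q≤1 = ⊥-elim (<⇒≱ (s≤s (s≤s z≤n)) (≤-trans (m≤n+m (2 + δ) (q (suc δ))) q≤1))

half : ∀ c k → (c + k * 6) / 2 ≡ c / 2 + k * 3
half c k = begin
  (c + k * 6) / 2          ≡⟨ +-distrib-/-∣ʳ c (divides (k * 3) (six k)) ⟩
  c / 2 + k * 6 / 2        ≡⟨ cong (λ x → c / 2 + x / 2) (six k) ⟩
  c / 2 + k * 3 * 2 / 2    ≡⟨ cong (c / 2 +_) (m*n/n≡m (k * 3) 2) ⟩
  c / 2 + k * 3            ∎
  where
  open ≡.≡-Reasoning
  six : ∀ k → k * 6 ≡ k * 3 * 2
  six = solve-∀

half-up : ∀ r k → (r + k * 6 + 1) / 2 ≡ suc r / 2 + k * 3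
half-up r k = ≡.trans (cong (_/ 2) (+-comm (r + k * 6) 1)) (half (suc r) k)

multiple-of-3 : ∀ c t k → t * 3 ≡ c + k * 3 → c % 3 ≡ 0
multiple-of-3 c t k eq = ≡.trans (sym ([m+kn]%n≡m%n c k 3)) (≡.trans (cong (_% 3) (sym eq)) (m*n%n≡0 t 3))

-- Optimality of the listed graphs

Optimal : ∀ {n} → Graph n → Set
Optimal {n} G = ¬ Contains (P2 6) G × edgeCount G ≡ turán n

-- `σ j + q δ` is the whole loss against ⌊(n+1)²/4⌋, from the star and from the imbalance. If it
-- equals `ε n`, exactly `turán n` edges remain.
optimal : ∀ {n} (G : Graph n) t j y {δ} → t * 3 + j + y ≡ n → G ≅ blockGraph n (t * 3) (t * 3 + j) →
  Balanced (t * 3 + j) (suc y) δ → σ j + q δ ≡ ε n → Optimal G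
optimal {n} G t j y {δ} refl iso bal σ+q =
  (λ contains → blockGraph-free n (m≤m+n (t * 3) j) (contains-≅ iso {K = P2 6} contains)) ,
  ≡.trans (edgeCount-≅ iso) (+-cancelʳ-≡ (ε n) c (turán n) (begin
    c + ε n               ≡⟨ cong (c +_) (sym σ+q) ⟩
    c + (σ j + q δ)       ≡⟨ sym (+-assoc c (σ j) (q δ)) ⟩
    c + σ j + q δ         ≡⟨ cong (_+ q δ) (blockGraph-count t j y) ⟩
    i * y + i + q δ       ≡⟨ defect refl bal ⟩
    turán n + ε n         ∎))
  where
  open ≡.≡-Reasoning
  i = t * 3 + j
  c = edgeCount (blockGraph n (t * 3) i)

-- With |X| = a + 3k and |Y| = b + 3k, neither the imbalance nor |X| modulo 3 depends on k. Each
-- residue thus reduces to a check of small numbers.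
module _ (a b k δ : ℕ) (offset : Balanced a (suc b) δ) where

  private
    N = a + b + k * 6

    parts : a + k * 3 + (b + k * 3) ≡ N
    parts = shuffle a b k
      where
      shuffle : ∀ a b k → a + k * 3 + (b + k * 3) ≡ a + b + k * 6
      shuffle = solve-∀

    balance : Balanced (a + k * 3) (suc (b + k * 3)) δ
    balance = widen offset
      where
      swap-last : ∀ x y z → x + y + z ≡ x + z + y
      swap-last = solve-∀
      widen : Balanced a (suc b) δ → Balanced (a + k * 3) (suc (b + k * 3)) δ
      widen (inj₁ eq) = inj₁ (≡.trans (cong (_+ k * 3) eq) (swap-last a δ (k * 3)))
      widen (inj₂ eq) = inj₂ (≡.trans (cong (_+ k * 3) eq) (swap-last (suc b) δ (k * 3)))

  optimal-H : ∀ {i G} t → a ≡ t * 3 → i ≡ a + k * 3 → G ≅ H N i → q δ ≡ ε (a + b) → Optimal G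
  optimal-H {G = G} t refl refl iso qδ = optimal G (t + k) 0 (b + k * 3)
    (≡.trans (cong (_+ (b + k * 3)) i≡) parts)
    (≅-trans iso (subst₂ (λ s i → H N (t * 3 + k * 3) ≅ blockGraph N s i)
      (sym (≡.trans (sym (+-identityʳ _)) i≡)) (sym i≡) (H≅F N (t * 3 + k * 3))))
    (subst (λ i → Balanced i (suc (b + k * 3)) δ) (sym i≡) balance)
    (≡.trans qδ (sym (ε-periodic (a + b) k)))
    where
    i≡ : (t + k) * 3 + 0 ≡ t * 3 + k * 3
    i≡ = ≡.trans (+-identityʳ _) (*-distribʳ-+ 3 t k)

  optimal-F : ∀ {i G} → i ≡ a + k * 3 → IsoF i G → suc (q δ) ≡ ε (a + b) → Optimal {N} G
  optimal-F {i} {G} i≡ (zero , () , _) _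
  optimal-F {i} {G} i≡ (j@(suc _) , _ , j≤i , divides t s≡ , iso) qδ = optimal G t j (b + k * 3)
    (≡.trans (cong (_+ (b + k * 3)) sum≡) parts)
    (subst₂ (λ s i → G ≅ blockGraph N s i) s≡ (≡.trans i≡ (sym sum≡)) iso)
    (subst (λ i → Balanced i (suc (b + k * 3)) δ) (sym sum≡) balance)
    (≡.trans qδ (sym (ε-periodic (a + b) k)))
    where
    sum≡ : t * 3 + j ≡ a + k * 3
    sum≡ = ≡.trans (cong (_+ j) (sym s≡)) (≡.trans (m∸n+n≡m j≤i) i≡)

-- The numbers passed are a and b, the sizes of X and Y at k = 0, and the imbalance δ between a and
-- b + 1.
family-optimal : ∀ r k → (G : Graph (r + k * 6)) → familyByResidue (r + k * 6) r G → Optimal G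
family-optimal 0 k G iso = optimal-H 0 0 k 1 (inj₁ refl) 0 refl (half 0 k) iso refl
family-optimal 1 k G (inj₁ f) = optimal-F 1 0 k 0 (inj₁ refl) (half-up 1 k) f refl
family-optimal 1 k G (inj₂ iso) = optimal-H 0 1 k 2 (inj₁ refl) 0 refl (half 1 k) iso refl
family-optimal 2 k G (inj₁ f) = optimal-F 1 1 k 1 (inj₁ refl) (half 2 k) f refl
family-optimal 2 k G (inj₂ f) = optimal-F 2 0 k 1 (inj₂ refl) (≡.trans (+-comm _ 1) (cong suc (half 2 k))) f refl
family-optimal 3 k G (inj₁ f) = optimal-F 2 1 k 0 (inj₁ refl) (half-up 3 k) f refl
family-optimal 3 k G (inj₂ iso) = optimal-H 3 0 k 2 (inj₂ refl) 1 refl (≡.trans (+-comm _ 1) (cong suc (half-up 3 k))) iso refl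
family-optimal 4 k G iso = optimal-H 3 1 k 1 (inj₂ refl) 1 refl (≡.trans (+-comm _ 1) (cong suc (half 4 k))) iso refl
family-optimal 5 k G iso = optimal-H 3 2 k 0 (inj₁ refl) 1 refl (half-up 5 k) iso refl
family-optimal (suc (suc (suc (suc (suc (suc r)))))) k G ()

≅-refl : ∀ {n} {G : Graph n} → G ≅ G
≅-refl = record { to = λ x → x ; from = λ x → x ; from-to = λ _ → refl ; to-from = λ _ → refl ; pres = λ _ _ → refl }

-- Extremality only compares with other graphs, so a graph with `turán n` edges must be exhibited
-- before an extremal one is known to have that many.
family-inhabited : ∀ r k → r < 6 → ∃ λ (G : Graph (r + k * 6)) → familyByResidue (r + k * 6) r G
family-inhabited 0 k _ = _ , ≅-refl
family-inhabited 1 k _ = _ , inj₂ ≅-refl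
-- The witness takes j = i, so that X spans a single star.
family-inhabited 2 k _ = _ , inj₁ ((2 + k * 6) / 2 , ≤-trans (s≤s z≤n) (≤-reflexive (sym (half 2 k))) , ≤-refl ,
  subst (3 ∣_) (sym (n∸n≡0 ((2 + k * 6) / 2))) (3 ∣0) , ≅-refl)
family-inhabited 3 k _ = _ , inj₂ ≅-refl
family-inhabited 4 k _ = _ , ≅-refl
family-inhabited 5 k _ = _ , ≅-refl
family-inhabited (suc (suc (suc (suc (suc (suc r)))))) k (s≤s (s≤s (s≤s (s≤s (s≤s (s≤s ()))))))

-- Classification by residue

module Located r k (G : Graph (r + k * 6)) t j y {δ}
  (iso : G ≅ blockGraph (r + k * 6) (t * 3) (t * 3 + j)) (size : t * 3 + j + y ≡ r + k * 6)
  (bal : Balanced (t * 3 + j) (suc y) δ) (σ+q : σ j + q δ ≡ ε r) where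

  private
    n = r + k * 6
    i = t * 3 + j

  as-H : ∀ {l} → j ≡ 0 → i ≡ l → G ≅ H n l
  as-H refl refl = ≅-trans iso (subst (λ l → blockGraph n (t * 3) l ≅ H n l) (sym (+-identityʳ (t * 3)))
    (≅-sym (H≅F n (t * 3))))

  as-F : ∀ {l} → 1 ≤ j → i ≡ l → IsoF l G
  as-F 1≤j refl = j , 1≤j , m≤n+m j (t * 3) , divides t (m+n∸n≡m (t * 3) j) ,
    subst (λ s → G ≅ blockGraph n s i) (sym (m+n∸n≡m (t * 3) j)) iso

  -- Here c + 3k is ⌊(n+1)/2⌋ and b is the parity of n + 1.
  located : ∀ c b → b < 2 → suc r ≡ c + c + b →
    (δ ≡ 0 × b ≡ 0 × i ≡ c + k * 3) ⊎ (δ ≡ 1 × b ≡ 1 × (i ≡ c + k * 3 ⊎ i ≡ suc (c + k * 3))) ⊎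
    (δ ≡ 2 × b ≡ 0 × (suc i ≡ c + k * 3 ⊎ i ≡ suc (c + k * 3)))
  located c b b<2 r≡ = locate δ (begin
      i + suc y                       ≡⟨ +-suc i y ⟩
      suc (i + y)                     ≡⟨ cong suc size ⟩
      suc r + k * 6                   ≡⟨ cong (_+ k * 6) r≡ ⟩
      c + c + b + k * 6               ≡⟨ shuffle c b k ⟩
      c + k * 3 + (c + k * 3) + b     ∎) b<2 bal
      (≤-trans (m≤n+m (q δ) (σ j)) (≤-trans (≤-reflexive σ+q) (ε≤1 r)))
    where
    open ≡.≡-Reasoning
    shuffle : ∀ c b k → c + c + b + k * 6 ≡ c + k * 3 + (c + k * 3) + b
    shuffle = solve-∀

  stars : (j ≡ 0 × q δ ≡ ε r) ⊎ (1 ≤ j × suc (q δ) ≡ ε r)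
  stars = split j refl
    where
    split : ∀ j′ → j ≡ j′ → (j ≡ 0 × q δ ≡ ε r) ⊎ (1 ≤ j × suc (q δ) ≡ ε r)
    split zero    refl = inj₁ (refl , σ+q)
    split (suc _) refl = inj₂ (s≤s z≤n , σ+q)

  -- Without a star, X is a union of triangles, so |X| is a multiple of 3. This rejects one of two
  -- equally balanced sizes.
  not-multiple : ∀ c → j ≡ 0 → c % 3 ≢ 0 → ¬ i ≡ c + k * 3
  not-multiple c refl c≢0 eq = c≢0 (multiple-of-3 c t k (≡.trans (sym (+-identityʳ (t * 3))) eq))

+1 : ∀ {x y} → x ≡ y → x + 1 ≡ suc y
+1 {x} eq = ≡.trans (+-comm x 1) (cong suc eq)

-- The budget `ε r` decides between star and imbalance, the parity b fixes the possible δ, and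
-- divisibility by three picks the size in the starless cases.
classify : ∀ r k → r < 6 → (G : Graph (r + k * 6)) → ∀ t j y {δ} →
  G ≅ blockGraph (r + k * 6) (t * 3) (t * 3 + j) → t * 3 + j + y ≡ r + k * 6 →
  Balanced (t * 3 + j) (suc y) δ → σ j + q δ ≡ ε r → familyByResidue (r + k * 6) r G
classify 0 k _ G t j y iso size bal σ+q with stars | located 0 1 ≤-refl refl
  where open Located 0 k G t j y iso size bal σ+q
... | inj₁ (j≡0 , _) | inj₂ (inj₁ (_ , _ , inj₁ i≡)) = as-H j≡0 (≡.trans i≡ (sym (half 0 k)))
  where open Located 0 k G t j y iso size bal σ+q
... | inj₁ (j≡0 , _) | inj₂ (inj₁ (_ , _ , inj₂ i≡)) = ⊥-elim (not-multiple 1 j≡0 (λ ()) i≡)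
  where open Located 0 k G t j y iso size bal σ+q
... | _ | inj₁ (_ , () , _)
... | _ | inj₂ (inj₂ (_ , () , _))
classify 1 k _ G t j y iso size bal σ+q with stars | located 1 0 (s≤s z≤n) refl
  where open Located 1 k G t j y iso size bal σ+q
... | inj₁ (j≡0 , _) | inj₂ (inj₂ (_ , _ , inj₁ i≡)) = inj₂ (as-H j≡0 (≡.trans (suc-injective i≡) (sym (half 1 k))))
  where open Located 1 k G t j y iso size bal σ+q
... | inj₁ (j≡0 , _) | inj₂ (inj₂ (_ , _ , inj₂ i≡)) = ⊥-elim (not-multiple 2 j≡0 (λ ()) i≡)
  where open Located 1 k G t j y iso size bal σ+q
... | inj₁ (_ , ()) | inj₁ (refl , _ , _)
... | inj₂ (1≤j , _) | inj₁ (_ , _ , i≡) = inj₁ (as-F 1≤j (≡.trans i≡ (sym (half-up 1 k))))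
  where open Located 1 k G t j y iso size bal σ+q
... | inj₂ (_ , ()) | inj₂ (inj₂ (refl , _ , _))
... | _ | inj₂ (inj₁ (_ , () , _))
classify 2 k _ G t j y iso size bal σ+q with stars | located 1 1 ≤-refl refl
  where open Located 2 k G t j y iso size bal σ+q
... | inj₁ (_ , ()) | inj₂ (inj₁ (refl , _ , _))
... | inj₂ (1≤j , _) | inj₂ (inj₁ (_ , _ , inj₁ i≡)) = inj₁ (as-F 1≤j (≡.trans i≡ (sym (half 2 k))))
  where open Located 2 k G t j y iso size bal σ+q
... | inj₂ (1≤j , _) | inj₂ (inj₁ (_ , _ , inj₂ i≡)) = inj₂ (as-F 1≤j (≡.trans i≡ (sym (+1 (half 2 k)))))
  where open Located 2 k G t j y iso size bal σ+q
... | _ | inj₁ (_ , () , _)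
... | _ | inj₂ (inj₂ (_ , () , _))
classify 3 k _ G t j y iso size bal σ+q with stars | located 2 0 (s≤s z≤n) refl
  where open Located 3 k G t j y iso size bal σ+q
... | inj₁ (j≡0 , _) | inj₂ (inj₂ (_ , _ , inj₁ i≡)) = ⊥-elim (not-multiple 1 j≡0 (λ ()) (suc-injective i≡))
  where open Located 3 k G t j y iso size bal σ+q
... | inj₁ (j≡0 , _) | inj₂ (inj₂ (_ , _ , inj₂ i≡)) = inj₂ (as-H j≡0 (≡.trans i≡ (sym (+1 (half-up 3 k)))))
  where open Located 3 k G t j y iso size bal σ+q
... | inj₁ (_ , ()) | inj₁ (refl , _ , _)
... | inj₂ (1≤j , _) | inj₁ (_ , _ , i≡) = inj₁ (as-F 1≤j (≡.trans i≡ (sym (half-up 3 k))))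
  where open Located 3 k G t j y iso size bal σ+q
... | inj₂ (_ , ()) | inj₂ (inj₂ (refl , _ , _))
... | _ | inj₂ (inj₁ (_ , () , _))
classify 4 k _ G t j y iso size bal σ+q with stars | located 2 1 ≤-refl refl
  where open Located 4 k G t j y iso size bal σ+q
... | inj₁ (j≡0 , _) | inj₂ (inj₁ (_ , _ , inj₁ i≡)) = ⊥-elim (not-multiple 2 j≡0 (λ ()) i≡)
  where open Located 4 k G t j y iso size bal σ+q
... | inj₁ (j≡0 , _) | inj₂ (inj₁ (_ , _ , inj₂ i≡)) = as-H j≡0 (≡.trans i≡ (sym (+1 (half 4 k))))
  where open Located 4 k G t j y iso size bal σ+q
... | _ | inj₁ (_ , () , _)
... | _ | inj₂ (inj₂ (_ , () , _))
classify 5 k _ G t j y iso size bal σ+q with stars | located 3 0 (s≤s z≤n) refl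
  where open Located 5 k G t j y iso size bal σ+q
... | inj₁ (j≡0 , _) | inj₁ (_ , _ , i≡) = as-H j≡0 (≡.trans i≡ (sym (half-up 5 k)))
  where open Located 5 k G t j y iso size bal σ+q
... | inj₁ (_ , ()) | inj₂ (inj₂ (refl , _ , _))
... | _ | inj₂ (inj₁ (_ , () , _))
classify (suc (suc (suc (suc (suc (suc r)))))) k (s≤s (s≤s (s≤s (s≤s (s≤s (s≤s ()))))))

-- From joins to the listed graphs, and the theorem

join⇒family : ∀ r k → r < 6 → (G : Graph (r + k * 6)) (free : ¬ Contains (P2 6) G) →
  Free.Join G free (allFin (r + k * 6)) → edgeCount G ≡ turán (r + k * 6) → familyByResidue (r + k * 6) r G
join⇒family r k r<6 G free join count-G = build (layout Y-apart (length X) ≤-refl X-P₄ (unique-++ʳ Y uYX) λ x∈ y∈ →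
    ~-sym (XY-joined (∈-allFin _) (∈-allFin _) (All.lookup pY y∈) (All.lookup pX x∈)))
  where
  open Free G free
  open Join join

  n = r + k * 6
  parts = split-by p (allFin n)
  Y = proj₁ parts
  X = proj₁ (proj₂ parts)
  all↭ : allFin n ↭ Y ++ X
  all↭ = proj₁ (proj₂ (proj₂ parts))
  pY = proj₁ (proj₂ (proj₂ (proj₂ parts)))
  pX = proj₂ (proj₂ (proj₂ (proj₂ parts)))

  uYX : Unique (Y ++ X)
  uYX = unique-↭ all↭ (allFin⁺ n)

  Y-apart : ∀ {x y} → x ∈ Y → y ∈ Y → adj G x y ≡ false
  Y-apart x∈ y∈ = Y-indep (∈-allFin _) (∈-allFin _) (All.lookup pY x∈) (All.lookup pY y∈)

  X-P₄ : P₄-Free X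
  X-P₄ a∈ b∈ c∈ d∈ = X-P₄-free (∈-allFin _) (∈-allFin _) (∈-allFin _) (∈-allFin _)
    (All.lookup pX a∈) (All.lookup pX b∈) (All.lookup pX c∈) (All.lookup pX d∈)

  i = length X
  y = length Y

  size : i + y ≡ n
  size = ≡.trans (+-comm i y) (≡.trans (sym (length-++ Y)) (≡.trans (sym (↭-length all↭)) (length-tabulate (λ x → x))))

  e-G : turán n ≡ y * i + e X
  e-G = begin
    turán n                    ≡⟨ sym count-G ⟩
    edgeCount G                ≡⟨ edgeCount≡e G ⟩
    e (allFin n)               ≡⟨ e-split Y X all↭ ⟩
    e Y + (cross Y X + e X)    ≡⟨ cong₂ (λ a b → a + (b + e X)) (edgeless Y Y-apart)
                                    (sum-map-const _ y X λ {x} x∈ → ≡.trans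
                                      (sum-map-const _ 1 Y λ {v} v∈ → cong ι (~-sym (XY-joined (∈-allFin _) (∈-allFin _) (All.lookup pY v∈) (All.lookup pX x∈))))
                                      (*-identityˡ y)) ⟩
    y * i + e X                ∎
    where open ≡.≡-Reasoning

  δ = proj₁ (balanced i (suc y))
  bal : Balanced i (suc y) δ
  bal = proj₂ (balanced i (suc y))

  build : Layout X Y ⊎ 2 + e X ≤ i → familyByResidue n r G
  -- Two stars cost two edges, more than `ε n` permits.
  build (inj₂ sparse) = ⊥-elim (<⇒≱ (≤-trans (s≤s (+-monoʳ-≤ (turán n) (ε≤1 n))) (begin
      suc (turán n + 1)          ≡⟨ cong suc (+-comm (turán n) 1) ⟩
      2 + turán n                ≡⟨ cong (2 +_) e-G ⟩
      2 + (y * i + e X)          ≡⟨ shuffle (y * i) (e X) ⟩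
      y * i + (2 + e X)          ≤⟨ +-monoʳ-≤ (y * i) sparse ⟩
      y * i + i                  ≡⟨ cong (_+ i) (*-comm y i) ⟩
      i * y + i                  ≤⟨ m≤m+n (i * y + i) (q δ) ⟩
      i * y + i + q δ            ∎)) (≤-reflexive (defect size bal)))
    where
    open ≤-Reasoning
    shuffle : ∀ a b → 2 + (a + b) ≡ a + (2 + b)
    shuffle = solve-∀
  build (inj₁ lay) = classify r k r<6 G t j y
    (subst (λ i → G ≅ blockGraph n (t * 3) i) size-X (listing-iso G (t * 3) i (P ++ Y)
      (↭-trans all↭ (↭-trans (++-comm Y X) (++⁺ʳ Y (↭-sym P↭X)))) matches))
    (≡.trans (cong (_+ y) (sym size-X)) size)
    (subst (λ i → Balanced i (suc y) δ) size-X bal)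
    (≡.trans (+-cancelˡ-≡ (turán n) _ _ (begin
      turán n + (σ j + q δ)          ≡⟨ cong (_+ (σ j + q δ)) e-G ⟩
      y * i + e X + (σ j + q δ)      ≡⟨ shuffle (y * i) (e X) (σ j) (q δ) ⟩
      y * i + (e X + σ j) + q δ      ≡⟨ cong₂ (λ a b → a + b + q δ) (*-comm y i) count ⟩
      i * y + i + q δ                ≡⟨ defect size bal ⟩
      turán n + ε n                  ∎)) (ε-periodic r k))
    where
    open ≡.≡-Reasoning
    open Layout lay renaming (size to size-X)
    shuffle : ∀ a b c d → a + b + (c + d) ≡ a + (b + c) + d
    shuffle = solve-∀

free-bound : ∀ {n} → 6 ≤ n → (G : Graph n) (free : ¬ Contains (P2 6) G) →
  edgeCount G ≤ turán n × (turán n ≤ edgeCount G → Free.Join G free (allFin n))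
free-bound {n} 6≤n G free with Free.turán-bound G free n (≤-reflexive len) (allFin⁺ n) len≢5
  where
  len : length (allFin n) ≡ n
  len = length-tabulate (λ x → x)
  len≢5 : length (allFin n) ≢ 5
  len≢5 eq = <⇒≱ 6≤n (≤-reflexive (≡.trans (sym len) eq))
... | bound , tight rewrite edgeCount≡e G | length-tabulate {n = n} (λ x → x) = bound , tight 6≤n

extremal⇔family : ∀ r k → r < 6 → 6 ≤ r + k * 6 → (G : Graph (r + k * 6)) →
  Extremal (P2 6) G ⇔ familyByResidue (r + k * 6) r G
extremal⇔family r k r<6 6≤n G = mk⇔ to from
  where
  to : Extremal (P2 6) G → familyByResidue (r + k * 6) r G
  to (free , maximal) with family-inhabited r k r<6
  ... | M , M∈ with family-optimal r k M M∈ | free-bound 6≤n G free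
  ...   | M-free , M-count | bound , tight = join⇒family r k r<6 G free (tight large) (≤-antisym bound large)
    where
    large : turán (r + k * 6) ≤ edgeCount G
    large = ≤-trans (≤-reflexive (sym M-count)) (maximal M M-free)

  from : familyByResidue (r + k * 6) r G → Extremal (P2 6) G
  from G∈ with family-optimal r k G G∈
  ... | free , count = free , λ G′ free′ → ≤-trans (proj₁ (free-bound 6≤n G′ free′)) (≤-reflexive (sym count))

theorem8 : (n : ℕ) → 6 ≤ n → (G : Graph n) →
    Extremal (P2 6) G ⇔ ExtremalFamily G
theorem8 n 6≤n G = at-residue (n % 6) (n / 6) (m≡m%n+[m/n]*n n 6) (m%n<n n 6) 6≤n G
  where
  at-residue : ∀ {n} r k → n ≡ r + k * 6 → r < 6 → 6 ≤ n → (G : Graph n) →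
    Extremal (P2 6) G ⇔ familyByResidue n r G
  at-residue r k refl = extremal⇔family r k
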